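{- Let $X=(x_{ij})$ be an $n\times r$ matrix of indeterminates over $\mathbb{C}$ and let $\lambda$ be a partition with at most $n$ rows. The bideterminants $M_T$, for $T$ running over the Non-Crossing Tableaux of shape $\lambda$ with entries in $\{1,\dots,r\}$, form a basis of $D_\lambda$.
   Context: For a filling $T$ of the Young diagram of $\lambda$ with elements of $\{1,\dots,r\}$ having distinct, increasingly arranged entries in each column, $M_T=\prod_c P_{\{1,\dots,k_c\},J_c}$, where $c$ runs over the columns of $\lambda$, $k_c$ is the length of column $c$, $J_c$ is the set of entries of column $c$ of $T$, and $P_{I,J}$ is the minor of $X$ with row set $I$ and column set $J$. (That is, $M_T$ is the bideterminant of the pair $(T_\lambda,T)$, where $T_\lambda$ has all entries of row $i$ equal to $i$.) $D_\lambda$ is the $\mathbb{C}$-linear span of all such $M_T$. Two disjoint finite sets of integers $a=\{a_1<\dots<a_p\}$ and $b=\{b_1<\dots<b_q\}$ with $p\ge q$ are non-crossing if: (1) for no $1\le i\le q-1$ does $a_i<b_i<a_{i+1}<b_{i+1}$ or $b_i<a_i<b_{i+1}<a_{i+1}$ hold; and (2) if $p>q$, then $a_q<b_q<a_{q+1}$ does not hold. With $N=|\lambda|$, a multiplicity-free Non-Crossing Tableau of shape $\lambda$ is a set partition of $\{1,\dots,N\}$ into pairwise non-crossing blocks whose sizes are the column lengths of $\lambda$. Let $T$ be a filling of shape $\lambda$ with strictly increasing columns in which $v$ occurs $\mu_v$ times, and let $B_1,\dots,B_r$ be the consecutive segments of $\{1,\dots,N\}$ of lengths $\mu_1,\dots,\mu_r$.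 Then $T$ is a Non-Crossing Tableau (Semi-Noncrossing Tableau) if: (i) there is a multiplicity-free Non-Crossing Tableau $\hat T$ of shape $\lambda$, each block of which contains at most one element of each $B_v$, such that replacing every element of $B_v$ by $v$ (for all $v$) turns the multiset of blocks of $\hat T$ into the multiset of columns of $T$; and (ii) columns of equal length are arranged so that whenever a column $a$ is to the left of a different column $b$ of the same length, $a_s<b_s$ for the largest index $s$ with $a_s\neq b_s$. -}

module Defs where

open import Algebra.Bundles.Raw using (RawRing)
open import Data.Fin as Fin using (Fin; zero; suc; toℕ; inject≤; punchIn)
import Data.Fin.Properties as Fin
open import Data.List as List
  using (List; []; _∷_; _++_; length; map; foldr; filter; concat; take; drop; head; allFin)
import Data.List.Properties as List
open import Data.List.Membership.Propositional using (_∈_)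
open import Data.List.Relation.Binary.Permutation.Propositional using (_↭_)
open import Data.List.Relation.Binary.Pointwise using (Pointwise)
open import Data.List.Relation.Unary.All using (All)
open import Data.List.Relation.Unary.AllPairs using (AllPairs)
open import Data.List.Relation.Unary.Linked using (Linked)
open import Data.Maybe using (just)
open import Data.Nat as ℕ using (ℕ; zero; suc)
import Data.Nat.ListAction as ListAction
import Data.Nat.Properties as ℕ
open import Data.Product using (Σ; ∃-syntax; _×_; _,_; proj₁; proj₂)
open import Data.Rational as ℚ using (ℚ; 0ℚ; 1ℚ; ½; Positive; NonNegative; 1/_)
import Data.Rational.Properties as ℚ
open import Data.Rational.Solver using (module +-*-Solver)
open import Data.Vec as Vec using (Vec)
import Data.Vec.Properties as Vec
open import Level using (0ℓ)
open import Relation.Binary.Core using (Rel)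
open import Relation.Binary.Definitions using (DecidableEquality)
open import Relation.Binary.PropositionalEquality
open import Relation.Nullary using (¬_; does)
open import Data.Bool using (if_then_else_; _∧_)

IsCauchy : (ℕ → ℚ) → Set
IsCauchy x = ∀ ε → .{{Positive ε}} →
  ∃[ K ] (∀ m n → K ℕ.≤ m → K ℕ.≤ n → ℚ.∣ x m ℚ.- x n ∣ ℚ.≤ ε)

-- Cauchy sequences of rationals, considered up to _≈ℝ_.
record ℝ : Set where
  constructor mkℝ
  field
    sequence : ℕ → ℚ
    isCauchy : IsCauchy sequence

open ℝ public

infix 4 _≈ℝ_
_≈ℝ_ : Rel ℝ 0ℓ
x ≈ℝ y = ∀ ε → .{{Positive ε}} →
  ∃[ K ] (∀ n → K ℕ.≤ n → ℚ.∣ sequence x n ℚ.- sequence y n ∣ ℚ.≤ ε)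

private
  half-positive : ∀ ε → .{{Positive ε}} → Positive (½ ℚ.* ε)
  half-positive ε = ℚ.pos*pos⇒pos ½ ε

  halves : ∀ ε → ½ ℚ.* ε ℚ.+ ½ ℚ.* ε ≡ ε
  halves ε = trans (sym (ℚ.*-distribʳ-+ ε ½ ½)) (ℚ.*-identityˡ ε)

  sub-+ : ∀ a b c d → (a ℚ.+ b) ℚ.- (c ℚ.+ d) ≡ (a ℚ.- c) ℚ.+ (b ℚ.- d)
  sub-+ = solve 4 (λ a b c d → (a :+ b) :- (c :+ d) := (a :- c) :+ (b :- d)) refl
    where open +-*-Solver

  sub-* : ∀ a b c d →
    a ℚ.* b ℚ.- c ℚ.* d ≡ a ℚ.* (b ℚ.- d) ℚ.+ (a ℚ.- c) ℚ.* d
  sub-* = solve 4 (λ a b c d →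
    a :* b :- c :* d := a :* (b :- d) :+ (a :- c) :* d) refl
    where open +-*-Solver

  split : ∀ a b → a ≡ b ℚ.+ (a ℚ.- b)
  split = solve 2 (λ a b → a := b :+ (a :- b)) refl
    where open +-*-Solver

  sub-neg : ∀ a b → (ℚ.- a) ℚ.- (ℚ.- b) ≡ ℚ.- (a ℚ.- b)
  sub-neg = solve 2 (λ a b → (:- a) :- (:- b) := :- (a :- b)) refl
    where open +-*-Solver

  *-mono-≤ : ∀ {a b c d} → NonNegative b → NonNegative c →
             a ℚ.≤ c → b ℚ.≤ d → a ℚ.* b ℚ.≤ c ℚ.* d
  *-mono-≤ {a} {b} {c} {d} b≥0 c≥0 a≤c b≤d =
    ℚ.≤-trans (ℚ.*-monoʳ-≤-nonNeg b {{b≥0}} a≤c) (ℚ.*-monoˡ-≤-nonNeg c {{c≥0}} b≤d)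

  bounded : ∀ {x} → IsCauchy x →
    ∃[ B ] (Positive B × ∃[ K ] (∀ n → K ℕ.≤ n → ℚ.∣ x n ∣ ℚ.≤ B))
  bounded {x} cx with cx 1ℚ
  ... | K , close =
    ℚ.∣ x K ∣ ℚ.+ 1ℚ
    , ℚ.nonNeg+pos⇒pos ℚ.∣ x K ∣ {{ℚ.∣-∣-nonNeg (x K)}} 1ℚ
    , K
    , λ n K≤n → begin
        ℚ.∣ x n ∣                            ≡⟨ cong ℚ.∣_∣ (split (x n) (x K)) ⟩
        ℚ.∣ x K ℚ.+ (x n ℚ.- x K) ∣          ≤⟨ ℚ.∣p+q∣≤∣p∣+∣q∣ (x K) (x n ℚ.- x K) ⟩
        ℚ.∣ x K ∣ ℚ.+ ℚ.∣ x n ℚ.- x K ∣      ≤⟨ ℚ.+-monoʳ-≤ ℚ.∣ x K ∣ (close n K K≤n ℕ.≤-refl) ⟩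
        ℚ.∣ x K ∣ ℚ.+ 1ℚ                     ∎
    where open ℚ.≤-Reasoning

  +-cauchy : ∀ {x y} → IsCauchy x → IsCauchy y → IsCauchy (λ n → x n ℚ.+ y n)
  +-cauchy {x} {y} cx cy ε
    with cx (½ ℚ.* ε) {{half-positive ε}} | cy (½ ℚ.* ε) {{half-positive ε}}
  ... | K , closeˣ | L , closeʸ = K ℕ.⊔ L , λ m n le-m le-n → begin
      ℚ.∣ (x m ℚ.+ y m) ℚ.- (x n ℚ.+ y n) ∣
        ≡⟨ cong ℚ.∣_∣ (sub-+ (x m) (y m) (x n) (y n)) ⟩
      ℚ.∣ (x m ℚ.- x n) ℚ.+ (y m ℚ.- y n) ∣
        ≤⟨ ℚ.∣p+q∣≤∣p∣+∣q∣ (x m ℚ.- x n) (y m ℚ.- y n) ⟩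
      ℚ.∣ x m ℚ.- x n ∣ ℚ.+ ℚ.∣ y m ℚ.- y n ∣
        ≤⟨ ℚ.+-mono-≤ (closeˣ m n (ℕ.m⊔n≤o⇒m≤o K L le-m) (ℕ.m⊔n≤o⇒m≤o K L le-n))
                      (closeʸ m n (ℕ.m⊔n≤o⇒n≤o K L le-m) (ℕ.m⊔n≤o⇒n≤o K L le-n)) ⟩
      ½ ℚ.* ε ℚ.+ ½ ℚ.* ε
        ≡⟨ halves ε ⟩
      ε ∎
    where open ℚ.≤-Reasoning

  -‿cauchy : ∀ {x} → IsCauchy x → IsCauchy (λ n → ℚ.- x n)
  -‿cauchy {x} cx ε with cx ε
  ... | K , close = K , λ m n le-m le-n →
    subst (ℚ._≤ ε)
      (sym (trans (cong ℚ.∣_∣ (sub-neg (x m) (x n))) (ℚ.∣-p∣≡∣p∣ (x m ℚ.- x n))))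
      (close m n le-m le-n)

  *-estimate : ∀ {a b c d A B δ} → NonNegative A → NonNegative δ →
    ℚ.∣ a ∣ ℚ.≤ A → ℚ.∣ d ∣ ℚ.≤ B → ℚ.∣ a ℚ.- c ∣ ℚ.≤ δ → ℚ.∣ b ℚ.- d ∣ ℚ.≤ δ →
    ℚ.∣ a ℚ.* b ℚ.- c ℚ.* d ∣ ℚ.≤ A ℚ.* δ ℚ.+ δ ℚ.* B
  *-estimate {a} {b} {c} {d} {A} {B} {δ} A≥0 δ≥0 a≤A d≤B a-c≤δ b-d≤δ = begin
    ℚ.∣ a ℚ.* b ℚ.- c ℚ.* d ∣
      ≡⟨ cong ℚ.∣_∣ (sub-* a b c d) ⟩
    ℚ.∣ a ℚ.* (b ℚ.- d) ℚ.+ (a ℚ.- c) ℚ.* d ∣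
      ≤⟨ ℚ.∣p+q∣≤∣p∣+∣q∣ (a ℚ.* (b ℚ.- d)) ((a ℚ.- c) ℚ.* d) ⟩
    ℚ.∣ a ℚ.* (b ℚ.- d) ∣ ℚ.+ ℚ.∣ (a ℚ.- c) ℚ.* d ∣
      ≡⟨ cong₂ ℚ._+_ (ℚ.∣p*q∣≡∣p∣*∣q∣ a (b ℚ.- d)) (ℚ.∣p*q∣≡∣p∣*∣q∣ (a ℚ.- c) d) ⟩
    ℚ.∣ a ∣ ℚ.* ℚ.∣ b ℚ.- d ∣ ℚ.+ ℚ.∣ a ℚ.- c ∣ ℚ.* ℚ.∣ d ∣
      ≤⟨ ℚ.+-mono-≤ (*-mono-≤ (ℚ.∣-∣-nonNeg (b ℚ.- d)) A≥0 a≤A b-d≤δ)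
                    (*-mono-≤ (ℚ.∣-∣-nonNeg d) δ≥0 a-c≤δ d≤B) ⟩
    A ℚ.* δ ℚ.+ δ ℚ.* B ∎
    where open ℚ.≤-Reasoning

  quotient : ∀ C ε → Positive C → Positive ε →
    ∃[ δ ] (Positive δ × C ℚ.* δ ≡ ε)
  quotient C ε C>0 ε>0 =
    C⁻¹ ℚ.* ε
    , ℚ.pos*pos⇒pos C⁻¹ {{ℚ.1/pos⇒pos C {{C>0}}}} ε {{ε>0}}
    , trans (sym (ℚ.*-assoc C C⁻¹ ε))
        (trans (cong (ℚ._* ε) (ℚ.*-inverseʳ C {{C≢0}})) (ℚ.*-identityˡ ε))
    where
    C≢0 = ℚ.pos⇒nonZero C {{C>0}}
    C⁻¹ = (1/ C) {{C≢0}}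

  factor : ∀ A B δ → A ℚ.* δ ℚ.+ δ ℚ.* B ≡ (A ℚ.+ B) ℚ.* δ
  factor A B δ = trans (cong (A ℚ.* δ ℚ.+_) (ℚ.*-comm δ B)) (sym (ℚ.*-distribʳ-+ δ A B))

  *-cauchy : ∀ {x y} → IsCauchy x → IsCauchy y → IsCauchy (λ n → x n ℚ.* y n)
  *-cauchy {x} {y} cx cy ε =
    let A , A>0 , K₁ , x≤A = bounded {x} cx
        B , B>0 , K₂ , y≤B = bounded {y} cy
        δ , δ>0 , eq       = quotient (A ℚ.+ B) ε
                               (ℚ.pos+pos⇒pos A {{A>0}} B {{B>0}})
                               (ℚ.positive (ℚ.positive⁻¹ ε))
        K₃ , closeˣ        = cx δ {{δ>0}}
        K₄ , closeʸ        = cy δ {{δ>0}}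
    in (K₁ ℕ.⊔ K₂) ℕ.⊔ (K₃ ℕ.⊔ K₄) , λ m n le-m le-n →
      let m₁₂ = ℕ.m⊔n≤o⇒m≤o (K₁ ℕ.⊔ K₂) (K₃ ℕ.⊔ K₄) le-m
          m₃₄ = ℕ.m⊔n≤o⇒n≤o (K₁ ℕ.⊔ K₂) (K₃ ℕ.⊔ K₄) le-m
          n₁₂ = ℕ.m⊔n≤o⇒m≤o (K₁ ℕ.⊔ K₂) (K₃ ℕ.⊔ K₄) le-n
          n₃₄ = ℕ.m⊔n≤o⇒n≤o (K₁ ℕ.⊔ K₂) (K₃ ℕ.⊔ K₄) le-n
      in subst (ℚ.∣ x m ℚ.* y m ℚ.- x n ℚ.* y n ∣ ℚ.≤_) (trans (factor A B δ) eq)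
        (*-estimate {x m} {y m} {x n} {y n}
          (ℚ.pos⇒nonNeg A {{A>0}}) (ℚ.pos⇒nonNeg δ {{δ>0}})
          (x≤A m (ℕ.m⊔n≤o⇒m≤o K₁ K₂ m₁₂))
          (y≤B n (ℕ.m⊔n≤o⇒n≤o K₁ K₂ n₁₂))
          (closeˣ m n (ℕ.m⊔n≤o⇒m≤o K₃ K₄ m₃₄) (ℕ.m⊔n≤o⇒m≤o K₃ K₄ n₃₄))
          (closeʸ m n (ℕ.m⊔n≤o⇒n≤o K₃ K₄ m₃₄) (ℕ.m⊔n≤o⇒n≤o K₃ K₄ n₃₄)))

infixl 6 _+ℝ_
infixl 7 _*ℝ_
infix  8 -ℝ_

_+ℝ_ _*ℝ_ : ℝ → ℝ → ℝ
mkℝ x cx +ℝ mkℝ y cy = mkℝ (λ n → x n ℚ.+ y n) (+-cauchy {x} {y} cx cy)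
mkℝ x cx *ℝ mkℝ y cy = mkℝ (λ n → x n ℚ.* y n) (*-cauchy {x} {y} cx cy)

-ℝ_ : ℝ → ℝ
-ℝ mkℝ x cx = mkℝ (λ n → ℚ.- x n) (-‿cauchy {x} cx)

fromℚ : ℚ → ℝ
fromℚ q = mkℝ (λ _ → q) λ ε → 0 , λ _ _ _ _ →
  subst (ℚ._≤ ε) (sym (cong ℚ.∣_∣ (ℚ.+-inverseʳ q))) (ℚ.<⇒≤ (ℚ.positive⁻¹ ε))

infix 5 _+i_
record ℂ : Set where
  constructor _+i_
  field
    re im : ℝ

ℂ-rawRing : RawRing 0ℓ 0ℓ
ℂ-rawRing = record
  { Carrier = ℂ
  ; _≈_     = λ { (a +i b) (c +i d) → a ≈ℝ c × b ≈ℝ d }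
  ; _+_     = λ { (a +i b) (c +i d) → (a +ℝ c) +i (b +ℝ d) }
  ; _*_     = λ { (a +i b) (c +i d) →
                    (a *ℝ c +ℝ (-ℝ (b *ℝ d))) +i (a *ℝ d +ℝ b *ℝ c) }
  ; -_      = λ { (a +i b) → (-ℝ a) +i (-ℝ b) }
  ; 0#      = fromℚ 0ℚ +i fromℚ 0ℚ
  ; 1#      = fromℚ 1ℚ +i fromℚ 0ℚ
  }

module Determinant (R : RawRing 0ℓ 0ℓ) where
  open RawRing R

  sum : List Carrier → Carrier
  sum = foldr _+_ 0#

  product : List Carrier → Carrier
  product = foldr _*_ 1#

  signed : ℕ → Carrier → Carrier
  signed zero    x = x
  signed (suc j) x = - signed j x

  -- Laplace expansion along the first row.
  det : ∀ {k} → (Fin k → Fin k → Carrier) → Carrier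
  det {zero}  A = 1#
  det {suc k} A = sum (List.tabulate λ j →
    signed (toℕ j) (A zero j * det (λ a b → A (suc a) (punchIn j b))))

-- Polynomials over R in the entries x i j of an n × r matrix.
module Polynomials (R : RawRing 0ℓ 0ℓ) (n r : ℕ) where
  private module R = RawRing R

  -- The matrix of exponents.
  Monomial : Set
  Monomial = Vec (Vec ℕ r) n

  _≟ₘ_ : DecidableEquality Monomial
  _≟ₘ_ = Vec.≡-dec (Vec.≡-dec ℕ._≟_)

  -- A formal sum of terms; monomials may repeat and coefficients may be
  -- zero, so equality is equality of all coefficients.
  Polynomial : Set
  Polynomial = List (R.Carrier × Monomial)

  coefficient : Polynomial → Monomial → R.Carrier
  coefficient []            m = R.0#
  coefficient ((c , m′) ∷ p) m =
    if does (m′ ≟ₘ m) then c R.+ coefficient p m else coefficient p m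

  infix 4 _≈_
  _≈_ : Rel Polynomial 0ℓ
  p ≈ q = ∀ m → coefficient p m R.≈ coefficient q m

  one : Monomial
  one = Vec.replicate n (Vec.replicate r 0)

  infixl 7 _·_
  _·_ : Monomial → Monomial → Monomial
  _·_ = Vec.zipWith (Vec.zipWith ℕ._+_)

  polynomialRing : RawRing 0ℓ 0ℓ
  polynomialRing = record
    { Carrier = Polynomial
    ; _≈_     = _≈_
    ; _+_     = _++_
    ; _*_     = List.cartesianProductWith λ { (c , m) (d , m′) → c R.* d , m · m′ }
    ; -_      = map λ { (c , m) → R.- c , m }
    ; 0#      = []
    ; 1#      = (R.1# , one) ∷ []
    }

  open RawRing polynomialRing public using (_+_; _*_; -_; 0#; 1#)

  infixr 7 _•_
  _•_ : R.Carrier → Polynomial → Polynomial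
  c • p = map (λ { (d , m) → c R.* d , m }) p

  x : Fin n → Fin r → Polynomial
  x i j = (R.1# , Vec.tabulate λ i′ → Vec.tabulate λ j′ →
    if does (i Fin.≟ i′) ∧ does (j Fin.≟ j′) then 1 else 0) ∷ []

  module _ {I : Set} (f : I → Polynomial) where

    combination : List (R.Carrier × I) → Polynomial
    combination = foldr (λ { (c , i) p → c • f i + p }) 0#

    Span : Polynomial → Set
    Span p = ∃[ terms ] p ≈ combination terms

  -- The index type carries its own equality _∼_, so that indices may be
  -- functions; only ∼-distinct indices are required to be independent.
  record IsBasis {I : Set} (_∼_ : Rel I 0ℓ) (f : I → Polynomial)
                 (V : Polynomial → Set) : Set where
    field
      member      : ∀ i → V (f i)
      spanning    : ∀ p → V p → Span f p
      independent : ∀ (terms : List (R.Carrier × I)) →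
                    AllPairs (λ s t → ¬ proj₂ s ∼ proj₂ t) terms →
                    combination f terms ≈ 0# →
                    All (λ t → proj₁ t R.≈ R.0#) terms

record Partition : Set where
  field
    parts      : List ℕ
    decreasing : Linked ℕ._≥_ parts
    positive   : All (0 ℕ.<_) parts

  rows : ℕ
  rows = length parts

  size : ℕ
  size = ListAction.sum parts

  width : ℕ
  width = foldr ℕ._⊔_ 0 parts

  columnLength : Fin width → ℕ
  columnLength c = length (filter (toℕ c ℕ.<?_) parts)

  columnLengths : List ℕ
  columnLengths = List.tabulate columnLength

  columnLength≤rows : ∀ c → columnLength c ℕ.≤ rows
  columnLength≤rows c = List.length-filter (toℕ c ℕ.<?_) parts

-- {1,…,r} is represented by Fin r throughout.
record Filling (Λ : Partition) (r : ℕ) : Set where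
  open Partition Λ
  field
    entry      : (c : Fin width) → Fin (columnLength c) → Fin r
    increasing : ∀ c {s t} → s Fin.< t → entry c s Fin.< entry c t

  columns : List (List (Fin r))
  columns = List.tabulate λ c → List.tabulate (entry c)

  multiplicity : Fin r → ℕ
  multiplicity v = length (filter (Fin._≟ v) (concat columns))

infix 4 _≗ᶠ_
_≗ᶠ_ : ∀ {Λ r} → Rel (Filling Λ r) 0ℓ
T ≗ᶠ U = ∀ c s → Filling.entry T c s ≡ Filling.entry U c s

module Bideterminants (n r : ℕ) (Λ : Partition) (rows≤n : Partition.rows Λ ℕ.≤ n) where
  open Partition Λ
  open Polynomials ℂ-rawRing n r public
  open Determinant polynomialRing using (det; product)

  M : Filling Λ r → Polynomial
  M T = product (List.tabulate λ c → det λ i j →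
    x (inject≤ i (ℕ.≤-trans (columnLength≤rows c) rows≤n)) (Filling.entry T c j))

  D : Polynomial → Set
  D = Span M

-- "xs has an element in position i, counting from 0, and it is x".
infix 4 _⟨_⟩=_
_⟨_⟩=_ : ∀ {A : Set} → List A → ℕ → A → Set
xs ⟨ i ⟩= x = head (drop i xs) ≡ just x

-- Finite sets are given as increasing lists; meant for length b ≤ length a.
record NonCrossing {N : ℕ} (a b : List (Fin N)) : Set where
  field
    interleaving : ∀ i {aᵢ aᵢ₊₁ bᵢ bᵢ₊₁} →
      a ⟨ i ⟩= aᵢ → a ⟨ suc i ⟩= aᵢ₊₁ → b ⟨ i ⟩= bᵢ → b ⟨ suc i ⟩= bᵢ₊₁ →
      ¬ (aᵢ Fin.< bᵢ × bᵢ Fin.< aᵢ₊₁ × aᵢ₊₁ Fin.< bᵢ₊₁) ×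
      ¬ (bᵢ Fin.< aᵢ × aᵢ Fin.< bᵢ₊₁ × bᵢ₊₁ Fin.< aᵢ₊₁)
    lastEntry : length b ℕ.< length a → ∀ q {a_q a_q₊₁ b_q} →
      suc q ≡ length b →
      a ⟨ q ⟩= a_q → a ⟨ suc q ⟩= a_q₊₁ → b ⟨ q ⟩= b_q →
      ¬ (a_q Fin.< b_q × b_q Fin.< a_q₊₁)

-- Each block is listed in increasing order.
record IsSetPartition (N : ℕ) (blocks : List (List (Fin N))) : Set where
  field
    increasing : All (Linked Fin._<_) blocks
    nonEmpty   : All (_≢ []) blocks
    exhaustive : concat blocks ↭ allFin N

record IsMultiplicityFreeNCT (Λ : Partition)
         (blocks : List (List (Fin (Partition.size Λ)))) : Set where
  open Partition Λ
  field
    isSetPartition : IsSetPartition size blocks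
    nonCrossing    : ∀ {a b} → a ∈ blocks → b ∈ blocks → a ≢ b →
                     length b ℕ.≤ length a → NonCrossing a b
    sizes          : map length blocks ↭ columnLengths

-- t lies in B_v, the v-th consecutive segment, where B_u has length μ u.
InSegment : ∀ {r N} → (Fin r → ℕ) → Fin N → Fin r → Set
InSegment μ t v = start ℕ.≤ toℕ t × toℕ t ℕ.< start ℕ.+ μ v
  where start = ListAction.sum (take (toℕ v) (List.tabulate μ))

record IsNCT {Λ : Partition} {r : ℕ} (T : Filling Λ r) : Set where
  open Partition Λ
  open Filling T

  _∈B_ : Fin size → Fin r → Set
  _∈B_ = InSegment multiplicity

  field
    -- Replacing each element of B_v by v turns a block into an increasing
    -- list, so comparing lists below is the same as comparing sets.
    liftable : ∃[ blocks ] ∃[ replaced ]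
      IsMultiplicityFreeNCT Λ blocks ×
      (∀ {a} → a ∈ blocks → ∀ v {s t} → s ∈ a → t ∈ a → s ∈B v → t ∈B v → s ≡ t) ×
      Pointwise (Pointwise _∈B_) blocks replaced ×
      replaced ↭ columns

    ordered : ∀ c d → c Fin.< d → (eq : columnLength c ≡ columnLength d) →
      ∀ s → entry c s ≢ entry d (Fin.cast eq s) →
      (∀ t → s Fin.< t → entry c t ≡ entry d (Fin.cast eq t)) →
      entry c s Fin.< entry d (Fin.cast eq s)

NCT : Partition → ℕ → Set
NCT Λ r = Σ (Filling Λ r) IsNCT

{-# OPTIONS --safe #-}
-- The bideterminant M_T has the leading monomial ∏ x_{s,T(s,c)}, with coefficient 1, for the weight
-- Σ i β_j of a monomial ∏ x_{ij}, where β is increasing. It records the contents of the rows of T.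
--
-- Independence: a Non-Crossing Tableau is determined by the contents of its rows. Indeed, let the
-- columns reaching row x be sorted by their elements in row x of a lifting T̂. Non-crossingness forces
-- the first of them to continue into row x + 1 to be the last one whose value in row x is smaller than
-- its value in row x + 1, and so on; this depends only on the values.
--
-- Spanning: give the N cells of T distinct labels, so that M_T is a specialization of the
-- bideterminant of a set partition, a polynomial p that is linear in each of N columns of variables.
-- Its monomials are words w, with letter i in position t for x_{it}. Replacing row i + 1 by row i in a
-- minor gives 0, hence p is killed by the derivations E_i = Σ_t x_{it} ∂/∂x_{i+1,t}. By sl₂ theory E_i is
-- injective on negative weights, hence the leading word of p (for the colexicographic order) has no
-- prefix with more letters i + 1 than i. From such a ballot word the greedy algorithm that attaches each
-- letter i + 1 to the most recent block of length i builds a non-crossing set partition with the same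
-- leading word. So p is a combination of bideterminants of multiplicity-free Non-Crossing Tableaux,
-- which specialize to 0 (two equal columns in a minor) or to bideterminants of Non-Crossing Tableaux.
module Submission where

open import Defs
open import Algebra.Bundles using (CommutativeRing)
open import Algebra.Bundles.Raw using (RawRing)
import Algebra.Properties.AbelianGroup as AbelianGroupProperties
import Algebra.Properties.CommutativeSemigroup as CommutativeSemigroupProperties
import Algebra.Properties.CommutativeMonoid.Sum as CommutativeMonoidSum
import Algebra.Properties.Ring as RingProperties
import Algebra.Properties.Semiring.Mult as SemiringMult
open import Data.Bool using (true; false; if_then_else_; _∧_)
open import Data.Empty using (⊥-elim)
open import Data.Fin as Fin using (Fin; zero; suc; toℕ; inject≤; inject₁; punchIn; fromℕ<)
import Data.Fin.Properties as Fin
open import Data.List as List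
  using (List; []; _∷_; _++_; length; map; foldr; filter; concat; take; allFin; lookup)
import Data.List.Properties as List
open import Data.List.Membership.Propositional using (_∈_)
import Data.List.Membership.Propositional.Properties as ∈
open import Data.List.Relation.Binary.Permutation.Propositional as ↭ using (_↭_; ↭-sym; ↭-trans; ↭-refl; ↭-reflexive)
import Data.List.Relation.Binary.Permutation.Propositional.Properties as ↭
import Data.List.Relation.Binary.Permutation.Setoid.Properties as ↭ₛ
open import Data.List.Relation.Binary.Pointwise as Pointwise using (Pointwise; []; _∷_)
open import Data.List.Relation.Unary.All as All using (All; []; _∷_)
import Data.List.Relation.Unary.All.Properties as All
open import Data.List.Relation.Unary.AllPairs as AllPairs using (AllPairs; []; _∷_)
import Data.List.Relation.Unary.AllPairs.Properties as AllPairs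
open import Data.List.Relation.Unary.Any using (Any; here; there)
open import Data.List.Relation.Unary.Linked as Linked using (Linked; []; [-]; _∷_)
import Data.List.Relation.Unary.Linked.Properties as Linked
open import Data.List.Relation.Unary.Sorted.TotalOrder.Properties using (↗↭↗⇒≋)
import Data.List.Sort as Sorting
open import Data.Nat as ℕ using (ℕ; zero; suc; z≤n; s≤s; _≤_; _<_)
import Data.Nat.ListAction as ListAction
import Data.Nat.ListAction.Properties as ListAction
import Data.Nat.Properties as ℕ
open import Data.Product using (Σ; ∃; ∃-syntax; _×_; _,_; proj₁; proj₂)
open import Data.Sum using (_⊎_; inj₁; inj₂)
open import Data.Vec as Vec using (Vec; []; _∷_)
import Data.Vec.Properties as Vec
open import Function using (_∘_; id; case_of_)
open import Level using (0ℓ)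
import Relation.Binary.Construct.Flip.EqAndOrd as Flip
import Relation.Binary.Construct.On as On
open import Relation.Binary.Definitions using (tri<; tri≈; tri>; Symmetric)
open import Relation.Binary.PropositionalEquality
  using (_≡_; _≢_; refl; sym; trans; cong; cong₂; subst; subst₂; module ≡-Reasoning)
  renaming (setoid to ≡-setoid)
open import Relation.Nullary using (¬_; Dec; yes; no; does)

-- Both halves use triangularity, but for different weights. For spanning, `β` consists of powers of
-- a base exceeding every letter: the weight of a word monomial is the number with that word as
-- digits, so there are no ties. For independence ties are harmless, since different tableaux
-- already have different leading monomials, and `β = toℕ` suffices. Why a leading word is ballot:
-- cut it as `p ++ s`, where `p` has one letter i + 1 too many, and regard the coefficient of
-- `u ++ s` as a function of `u`. In the equation E_i = 0 at `u ++ s`, raising a letter of `s` leads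
-- to a larger word, with coefficient 0. So the function of `u` is itself killed by E_i, and
-- injectivity on weight -1 makes it vanish at `p`. After a bideterminant has been subtracted, the
-- remainder is no longer a bideterminant. The induction therefore runs over all polynomials that
-- are homogeneous in rows and columns and killed by every E_i. Leading coefficients are 1 and the
-- sl₂ argument cancels only positive integers, so everything except the last step is done over a
-- torsion-free commutative ring.

lookup-≗⇒≡ : ∀ {A : Set} {k} {u v : Vec A k} → (∀ i → Vec.lookup u i ≡ Vec.lookup v i) → u ≡ v
lookup-≗⇒≡ {u = u} {v} h = trans (sym (Vec.tabulate∘lookup u)) (trans (Vec.tabulate-cong h) (Vec.tabulate∘lookup v))

-- The commutative ring of polynomials

module PolynomialProperties (R : CommutativeRing 0ℓ 0ℓ) (n r : ℕ) where

  private module R = CommutativeRing R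
  open RingProperties R.ring using (-‿distribˡ-*)
  open AbelianGroupProperties R.+-abelianGroup using (⁻¹-∙-comm; ε⁻¹≈ε)
  open Polynomials R.rawRing n r public
  open CommutativeSemigroupProperties R.+-commutativeSemigroup using (interchange)
  open import Relation.Binary.Reasoning.Setoid R.setoid

  -- Polynomials are compared through all their linear functionals ⟪ φ ⟫, which, unlike
  -- coefficients, are computed on products by iteration.
  ⟪_⟫ : (Monomial → R.Carrier) → Polynomial → R.Carrier
  ⟪ φ ⟫ []            = R.0#
  ⟪ φ ⟫ ((c , m) ∷ p) = c R.* φ m R.+ ⟪ φ ⟫ p

  indicator : Monomial → Monomial → R.Carrier
  indicator m m′ = if does (m′ ≟ₘ m) then R.1# else R.0#

  coefficient-⟪⟫ : ∀ p m → coefficient p m R.≈ ⟪ indicator m ⟫ p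
  coefficient-⟪⟫ []             m = R.refl
  coefficient-⟪⟫ ((c , m′) ∷ p) m with does (m′ ≟ₘ m)
  ... | true  = R.+-cong (R.sym (R.*-identityʳ c)) (coefficient-⟪⟫ p m)
  ... | false = R.trans (coefficient-⟪⟫ p m)
                  (R.sym (R.trans (R.+-congʳ (R.zeroʳ c)) (R.+-identityˡ _)))

  ⟪⟫-cong : ∀ {φ ψ} → (∀ m → φ m R.≈ ψ m) → ∀ p → ⟪ φ ⟫ p R.≈ ⟪ ψ ⟫ p
  ⟪⟫-cong φ≈ψ []            = R.refl
  ⟪⟫-cong φ≈ψ ((c , m) ∷ p) = R.+-cong (R.*-congˡ (φ≈ψ m)) (⟪⟫-cong φ≈ψ p)

  ⟪⟫-++ : ∀ φ p q → ⟪ φ ⟫ (p + q) R.≈ ⟪ φ ⟫ p R.+ ⟪ φ ⟫ q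
  ⟪⟫-++ φ []            q = R.sym (R.+-identityˡ _)
  ⟪⟫-++ φ ((c , m) ∷ p) q = R.trans (R.+-congˡ (⟪⟫-++ φ p q)) (R.sym (R.+-assoc _ _ _))

  ⟪⟫-• : ∀ φ a p → ⟪ φ ⟫ (a • p) R.≈ a R.* ⟪ φ ⟫ p
  ⟪⟫-• φ a []            = R.sym (R.zeroʳ a)
  ⟪⟫-• φ a ((c , m) ∷ p) = begin
    (a R.* c) R.* φ m R.+ ⟪ φ ⟫ (a • p)     ≈⟨ R.+-cong (R.*-assoc a c (φ m)) (⟪⟫-• φ a p) ⟩
    a R.* (c R.* φ m) R.+ a R.* ⟪ φ ⟫ p     ≈⟨ R.distribˡ a _ _ ⟨
    a R.* (c R.* φ m R.+ ⟪ φ ⟫ p)           ∎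

  ⟪⟫-neg : ∀ φ p → ⟪ φ ⟫ (- p) R.≈ R.- ⟪ φ ⟫ p
  ⟪⟫-neg φ []            = R.sym ε⁻¹≈ε
  ⟪⟫-neg φ ((c , m) ∷ p) = begin
    (R.- c) R.* φ m R.+ ⟪ φ ⟫ (- p)         ≈⟨ R.+-cong (R.sym (-‿distribˡ-* c (φ m))) (⟪⟫-neg φ p) ⟩
    R.- (c R.* φ m) R.+ R.- ⟪ φ ⟫ p         ≈⟨ ⁻¹-∙-comm _ _ ⟩
    R.- (c R.* φ m R.+ ⟪ φ ⟫ p)             ∎

  ⟪⟫-0 : ∀ p → ⟪ (λ _ → R.0#) ⟫ p R.≈ R.0#
  ⟪⟫-0 []            = R.refl
  ⟪⟫-0 ((c , m) ∷ p) = R.trans (R.+-cong (R.zeroʳ c) (⟪⟫-0 p)) (R.+-identityˡ _)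

  ⟪⟫-+ : ∀ φ ψ p → ⟪ (λ m → φ m R.+ ψ m) ⟫ p R.≈ ⟪ φ ⟫ p R.+ ⟪ ψ ⟫ p
  ⟪⟫-+ φ ψ []            = R.sym (R.+-identityˡ _)
  ⟪⟫-+ φ ψ ((c , m) ∷ p) = begin
    c R.* (φ m R.+ ψ m) R.+ ⟪ (λ m → φ m R.+ ψ m) ⟫ p
      ≈⟨ R.+-cong (R.distribˡ c _ _) (⟪⟫-+ φ ψ p) ⟩
    (c R.* φ m R.+ c R.* ψ m) R.+ (⟪ φ ⟫ p R.+ ⟪ ψ ⟫ p)
      ≈⟨ interchange _ _ _ _ ⟩
    (c R.* φ m R.+ ⟪ φ ⟫ p) R.+ (c R.* ψ m R.+ ⟪ ψ ⟫ p) ∎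

  ⟪⟫-* : ∀ φ a p → ⟪ (λ m → a R.* φ m) ⟫ p R.≈ a R.* ⟪ φ ⟫ p
  ⟪⟫-* φ a []            = R.sym (R.zeroʳ a)
  ⟪⟫-* φ a ((c , m) ∷ p) = begin
    c R.* (a R.* φ m) R.+ ⟪ (λ m → a R.* φ m) ⟫ p
      ≈⟨ R.+-cong (R.trans (R.sym (R.*-assoc c a _)) (R.trans (R.*-congʳ (R.*-comm c a)) (R.*-assoc a c _))) (⟪⟫-* φ a p) ⟩
    a R.* (c R.* φ m) R.+ a R.* ⟪ φ ⟫ p
      ≈⟨ R.distribˡ a _ _ ⟨
    a R.* (c R.* φ m R.+ ⟪ φ ⟫ p) ∎

  ⟪⟫-product : ∀ φ p q → ⟪ φ ⟫ (p * q) R.≈ ⟪ (λ m → ⟪ (λ m′ → φ (m · m′)) ⟫ q) ⟫ p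
  ⟪⟫-product φ []            q = R.refl
  ⟪⟫-product φ ((c , m) ∷ p) q =
    R.trans (⟪⟫-++ φ (map _ q) (p * q)) (R.+-cong (row q) (⟪⟫-product φ p q))
    where
    row : ∀ q → ⟪ φ ⟫ (map _ q) R.≈ c R.* ⟪ (λ m′ → φ (m · m′)) ⟫ q
    row []             = R.sym (R.zeroʳ c)
    row ((d , m′) ∷ q) =
      R.trans (R.+-cong (R.*-assoc c d _) (row q)) (R.sym (R.distribˡ c _ _))

  -- Fubini for two formal sums; with `⟪⟫-product` it yields commutativity of the product.
  ⟪⟫-swap : ∀ (φ : Monomial → Monomial → R.Carrier) p q →
    ⟪ (λ m → ⟪ φ m ⟫ q) ⟫ p R.≈ ⟪ (λ m′ → ⟪ (λ m → φ m m′) ⟫ p) ⟫ q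
  ⟪⟫-swap φ []            q = R.sym (⟪⟫-0 q)
  ⟪⟫-swap φ ((c , m) ∷ p) q = begin
    c R.* ⟪ φ m ⟫ q R.+ ⟪ (λ m → ⟪ φ m ⟫ q) ⟫ p
      ≈⟨ R.+-cong (R.sym (⟪⟫-* (φ m) c q)) (⟪⟫-swap φ p q) ⟩
    ⟪ (λ m′ → c R.* φ m m′) ⟫ q R.+ ⟪ (λ m′ → ⟪ (λ m → φ m m′) ⟫ p) ⟫ q
      ≈⟨ ⟪⟫-+ _ _ q ⟨
    ⟪ (λ m′ → c R.* φ m m′ R.+ ⟪ (λ m → φ m m′) ⟫ p) ⟫ q ∎

  private
    remove : Monomial → Polynomial → Polynomial
    remove m []             = []
    remove m ((c , m′) ∷ p) = if does (m′ ≟ₘ m) then remove m p else (c , m′) ∷ remove m p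

    remove-length : ∀ m p → length (remove m p) ≤ length p
    remove-length m []             = z≤n
    remove-length m ((c , m′) ∷ p) with does (m′ ≟ₘ m)
    ... | true  = ℕ.m≤n⇒m≤1+n (remove-length m p)
    ... | false = s≤s (remove-length m p)

    ⟪⟫-remove : ∀ φ m p → ⟪ φ ⟫ p R.≈ coefficient p m R.* φ m R.+ ⟪ φ ⟫ (remove m p)
    ⟪⟫-remove φ m []             = R.sym (R.trans (R.+-identityʳ _) (R.zeroˡ _))
    ⟪⟫-remove φ m ((c , m′) ∷ p) with m′ ≟ₘ m
    ... | yes refl = begin
      c R.* φ m R.+ ⟪ φ ⟫ p
        ≈⟨ R.+-congˡ (⟪⟫-remove φ m p) ⟩
      c R.* φ m R.+ (coefficient p m R.* φ m R.+ ⟪ φ ⟫ (remove m p))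
        ≈⟨ R.+-assoc _ _ _ ⟨
      (c R.* φ m R.+ coefficient p m R.* φ m) R.+ ⟪ φ ⟫ (remove m p)
        ≈⟨ R.+-congʳ (R.distribʳ _ _ _) ⟨
      (c R.+ coefficient p m) R.* φ m R.+ ⟪ φ ⟫ (remove m p) ∎
    ... | no _ = begin
      c R.* φ m′ R.+ ⟪ φ ⟫ p
        ≈⟨ R.+-congˡ (⟪⟫-remove φ m p) ⟩
      c R.* φ m′ R.+ (coefficient p m R.* φ m R.+ ⟪ φ ⟫ (remove m p))
        ≈⟨ R.+-assoc _ _ _ ⟨
      (c R.* φ m′ R.+ coefficient p m R.* φ m) R.+ ⟪ φ ⟫ (remove m p)
        ≈⟨ R.+-congʳ (R.+-comm _ _) ⟩
      (coefficient p m R.* φ m R.+ c R.* φ m′) R.+ ⟪ φ ⟫ (remove m p)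
        ≈⟨ R.+-assoc _ _ _ ⟩
      coefficient p m R.* φ m R.+ (c R.* φ m′ R.+ ⟪ φ ⟫ (remove m p)) ∎

    coefficient-remove : ∀ m p m″ → coefficient p m″ R.≈ R.0# → coefficient (remove m p) m″ R.≈ R.0#
    coefficient-remove m p m″ z with m ≟ₘ m″
    ... | yes refl = gone p
      where
      gone : ∀ p → coefficient (remove m p) m R.≈ R.0#
      gone []             = R.refl
      gone ((c , m′) ∷ p) with m′ ≟ₘ m
      ... | yes _ = gone p
      ... | no m′≢m with m′ ≟ₘ m
      ...   | yes m′≡m = ⊥-elim (m′≢m m′≡m)
      ...   | no _     = gone p
    ... | no m≢m″ = R.trans (R.reflexive (same p)) z
      where
      same : ∀ p → coefficient (remove m p) m″ ≡ coefficient p m″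
      same []             = refl
      same ((c , m′) ∷ p) with m′ ≟ₘ m
      same ((c , m′) ∷ p) | yes refl with m′ ≟ₘ m″
      ...   | yes eq = ⊥-elim (m≢m″ eq)
      ...   | no _   = same p
      same ((c , m′) ∷ p) | no _ with m′ ≟ₘ m″
      ...   | yes _ = cong (c R.+_) (same p)
      ...   | no _  = same p

    -- All terms with the first monomial are taken out together: their coefficients add up to 0, and
    -- the rest is shorter and still has zero coefficients. The rest is not a subterm of `p`, hence
    -- the bound `k`.
    ⟪⟫-zero : ∀ k φ p → length p ≤ k → p ≈ 0# → ⟪ φ ⟫ p R.≈ R.0#
    ⟪⟫-zero k       φ []              _       p≈0 = R.refl
    ⟪⟫-zero (suc k) φ p@((c , m) ∷ p′) (s≤s l) p≈0 = begin
      ⟪ φ ⟫ p                                          ≈⟨ ⟪⟫-remove φ m p ⟩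
      coefficient p m R.* φ m R.+ ⟪ φ ⟫ (remove m p)   ≈⟨ R.+-cong (R.trans (R.*-congʳ (p≈0 m)) (R.zeroˡ _))
                                                            (⟪⟫-zero k φ (remove m p) shorter (λ m″ → coefficient-remove m p m″ (p≈0 m″))) ⟩
      R.0# R.+ R.0#                                    ≈⟨ R.+-identityˡ _ ⟩
      R.0#                                             ∎
      where
      shorter : length (remove m p) ≤ k
      shorter with m ≟ₘ m
      ... | yes _   = ℕ.≤-trans (remove-length m p′) l
      ... | no m≢m  = ⊥-elim (m≢m refl)

  ⟪⟫-ext : ∀ {p q} → (∀ φ → ⟪ φ ⟫ p R.≈ ⟪ φ ⟫ q) → p ≈ q
  ⟪⟫-ext {p} {q} h m =
    R.trans (coefficient-⟪⟫ p m) (R.trans (h (indicator m)) (R.sym (coefficient-⟪⟫ q m)))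

  -- Polynomials with equal coefficients may be different formal sums, so this takes an argument:
  -- `⟪⟫-zero` is applied to the difference `p + - q`.
  ⟪⟫-resp : ∀ φ p q → p ≈ q → ⟪ φ ⟫ p R.≈ ⟪ φ ⟫ q
  ⟪⟫-resp φ p q p≈q = x∙y⁻¹≈ε⇒x≈y _ _ (begin
    ⟪ φ ⟫ p R.+ R.- ⟪ φ ⟫ q   ≈⟨ R.+-congˡ (⟪⟫-neg φ q) ⟨
    ⟪ φ ⟫ p R.+ ⟪ φ ⟫ (- q)   ≈⟨ ⟪⟫-++ φ p (- q) ⟨
    ⟪ φ ⟫ (p + - q)           ≈⟨ ⟪⟫-zero _ φ (p + - q) ℕ.≤-refl vanish ⟩
    R.0#                      ∎)
    where
    open AbelianGroupProperties R.+-abelianGroup using (x∙y⁻¹≈ε⇒x≈y)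
    vanish : (p + - q) ≈ 0#
    vanish m = begin
      coefficient (p + - q) m                 ≈⟨ coefficient-⟪⟫ (p + - q) m ⟩
      ⟪ indicator m ⟫ (p + - q)               ≈⟨ ⟪⟫-++ _ p (- q) ⟩
      ⟪ indicator m ⟫ p R.+ ⟪ indicator m ⟫ (- q)
        ≈⟨ R.+-cong (R.sym (coefficient-⟪⟫ p m)) (R.trans (⟪⟫-neg _ q) (R.-‿cong (R.sym (coefficient-⟪⟫ q m)))) ⟩
      coefficient p m R.+ R.- coefficient q m ≈⟨ R.+-congʳ (p≈q m) ⟩
      coefficient q m R.+ R.- coefficient q m ≈⟨ R.-‿inverseʳ _ ⟩
      R.0#                                    ∎

  _⟦_,_⟧ : Monomial → Fin n → Fin r → ℕ
  m ⟦ i , j ⟧ = Vec.lookup (Vec.lookup m i) j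

  monomial : (Fin n → Fin r → ℕ) → Monomial
  monomial f = Vec.tabulate λ i → Vec.tabulate (f i)

  monomial-⟦⟧ : ∀ f i j → monomial f ⟦ i , j ⟧ ≡ f i j
  monomial-⟦⟧ f i j = trans (cong (λ v → Vec.lookup v j) (Vec.lookup∘tabulate _ i)) (Vec.lookup∘tabulate (f i) j)

  monomial-ext : ∀ {m m′} → (∀ i j → m ⟦ i , j ⟧ ≡ m′ ⟦ i , j ⟧) → m ≡ m′
  monomial-ext h = lookup-≗⇒≡ λ i → lookup-≗⇒≡ (h i)

  ·-⟦⟧ : ∀ m m′ i j → (m · m′) ⟦ i , j ⟧ ≡ m ⟦ i , j ⟧ ℕ.+ m′ ⟦ i , j ⟧
  ·-⟦⟧ m m′ i j = trans (cong (λ v → Vec.lookup v j) (Vec.lookup-zipWith _ i m m′))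
                    (Vec.lookup-zipWith ℕ._+_ j (Vec.lookup m i) (Vec.lookup m′ i))

  one-⟦⟧ : ∀ i j → one ⟦ i , j ⟧ ≡ 0
  one-⟦⟧ i j = trans (cong (λ v → Vec.lookup v j) (Vec.lookup-replicate i (Vec.replicate r 0)))
                 (Vec.lookup-replicate j 0)

  ·-comm : ∀ m m′ → m · m′ ≡ m′ · m
  ·-comm m m′ = monomial-ext λ i j →
    trans (·-⟦⟧ m m′ i j) (trans (ℕ.+-comm (m ⟦ i , j ⟧) _) (sym (·-⟦⟧ m′ m i j)))

  ·-assoc : ∀ m m′ m″ → (m · m′) · m″ ≡ m · (m′ · m″)
  ·-assoc m m′ m″ = monomial-ext λ i j →
    trans (·-⟦⟧ (m · m′) m″ i j) (trans (cong (ℕ._+ _) (·-⟦⟧ m m′ i j))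
      (trans (ℕ.+-assoc (m ⟦ i , j ⟧) _ _)
        (sym (trans (·-⟦⟧ m (m′ · m″) i j) (cong (m ⟦ i , j ⟧ ℕ.+_) (·-⟦⟧ m′ m″ i j))))))

  ·-identityˡ : ∀ m → one · m ≡ m
  ·-identityˡ m = monomial-ext λ i j →
    trans (·-⟦⟧ one m i j) (cong (ℕ._+ m ⟦ i , j ⟧) (one-⟦⟧ i j))

  polynomialCommutativeRing : CommutativeRing 0ℓ 0ℓ
  polynomialCommutativeRing = record
    { RawRing polynomialRing
    ; isCommutativeRing = record
      { isRing = record
        { +-isAbelianGroup = record
          { isGroup = record
            { isMonoid = record
              { isSemigroup = record
                { isMagma = record
                  { isEquivalence = record
                    { refl  = λ m → R.refl
                    ; sym   = λ p m → R.sym (p m)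
                    ; trans = λ p q m → R.trans (p m) (q m)
                    }
                  ; ∙-cong = λ {p} {p′} {q} {q′} p≈ q≈ → ⟪⟫-ext {p + q} {p′ + q′} λ φ →
                      R.trans (⟪⟫-++ φ p q) (R.trans (R.+-cong (⟪⟫-resp φ p p′ p≈) (⟪⟫-resp φ q q′ q≈)) (R.sym (⟪⟫-++ φ p′ q′)))
                  }
                ; assoc = λ p q s m → R.reflexive (cong (λ t → coefficient t m) (List.++-assoc p q s))
                }
              ; identity = (λ p m → R.refl) , λ p m → R.reflexive (cong (λ t → coefficient t m) (List.++-identityʳ p))
              }
            ; inverse = (λ p → ⟪⟫-ext {(- p) + p} {0#} λ φ →
                          R.trans (⟪⟫-++ φ (- p) p) (R.trans (R.+-congʳ (⟪⟫-neg φ p)) (R.-‿inverseˡ _)))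
                      , (λ p → ⟪⟫-ext {p + - p} {0#} λ φ →
                          R.trans (⟪⟫-++ φ p (- p)) (R.trans (R.+-congˡ (⟪⟫-neg φ p)) (R.-‿inverseʳ _)))
            ; ⁻¹-cong = λ {p} {q} p≈ → ⟪⟫-ext {(- p)} {(- q)} λ φ →
                R.trans (⟪⟫-neg φ p) (R.trans (R.-‿cong (⟪⟫-resp φ p q p≈)) (R.sym (⟪⟫-neg φ q)))
            }
          ; comm = λ p q → ⟪⟫-ext {p + q} {q + p} λ φ →
              R.trans (⟪⟫-++ φ p q) (R.trans (R.+-comm _ _) (R.sym (⟪⟫-++ φ q p)))
          }
        ; *-cong = λ {p} {p′} {q} {q′} p≈ q≈ → ⟪⟫-ext {p * q} {p′ * q′} λ φ →
            R.trans (⟪⟫-product φ p q)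
              (R.trans (R.trans (⟪⟫-cong (λ m → ⟪⟫-resp _ q q′ q≈) p) (⟪⟫-resp _ p p′ p≈))
                (R.sym (⟪⟫-product φ p′ q′)))
        ; *-assoc = λ p q s → ⟪⟫-ext {(p * q) * s} {p * (q * s)} λ φ → begin
            ⟪ φ ⟫ ((p * q) * s)
              ≈⟨ ⟪⟫-product φ (p * q) s ⟩
            ⟪ (λ m → ⟪ (λ m″ → φ (m · m″)) ⟫ s) ⟫ (p * q)
              ≈⟨ ⟪⟫-product _ p q ⟩
            ⟪ (λ m → ⟪ (λ m′ → ⟪ (λ m″ → φ ((m · m′) · m″)) ⟫ s) ⟫ q) ⟫ p
              ≈⟨ ⟪⟫-cong (λ m → ⟪⟫-cong (λ m′ → ⟪⟫-cong (λ m″ → R.reflexive (cong φ (·-assoc m m′ m″))) s) q) p ⟩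
            ⟪ (λ m → ⟪ (λ m′ → ⟪ (λ m″ → φ (m · (m′ · m″))) ⟫ s) ⟫ q) ⟫ p
              ≈⟨ ⟪⟫-cong (λ m → ⟪⟫-product (λ m′ → φ (m · m′)) q s) p ⟨
            ⟪ (λ m → ⟪ (λ m′ → φ (m · m′)) ⟫ (q * s)) ⟫ p
              ≈⟨ ⟪⟫-product φ p (q * s) ⟨
            ⟪ φ ⟫ (p * (q * s)) ∎
        ; *-identity = (λ p → ⟪⟫-ext {1# * p} {p} (identityˡ p))
                     , (λ p → ⟪⟫-ext {p * 1#} {p} λ φ → R.trans (comm′ p 1# φ) (identityˡ p φ))
        ; distrib = (λ p q s → ⟪⟫-ext {p * (q + s)} {p * q + p * s} (distribˡ′ p q s))
                  , (λ p q s → ⟪⟫-ext {(q + s) * p} {q * p + s * p} λ φ →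
                      R.trans (⟪⟫-product φ (q + s) p) (R.trans (⟪⟫-++ _ q s)
                        (R.sym (R.trans (⟪⟫-++ φ (q * p) (s * p)) (R.+-cong (⟪⟫-product φ q p) (⟪⟫-product φ s p))))))
        }
      ; *-comm = λ p q → ⟪⟫-ext {p * q} {q * p} (comm′ p q)
      }
    }
    where
    comm′ : ∀ p q φ → ⟪ φ ⟫ (p * q) R.≈ ⟪ φ ⟫ (q * p)
    comm′ p q φ = begin
      ⟪ φ ⟫ (p * q)                                  ≈⟨ ⟪⟫-product φ p q ⟩
      ⟪ (λ m → ⟪ (λ m′ → φ (m · m′)) ⟫ q) ⟫ p        ≈⟨ ⟪⟫-swap _ p q ⟩
      ⟪ (λ m′ → ⟪ (λ m → φ (m · m′)) ⟫ p) ⟫ q        ≈⟨ ⟪⟫-cong (λ m′ → ⟪⟫-cong (λ m → R.reflexive (cong φ (·-comm m m′))) p) q ⟩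
      ⟪ (λ m′ → ⟪ (λ m → φ (m′ · m)) ⟫ p) ⟫ q        ≈⟨ ⟪⟫-product φ q p ⟨
      ⟪ φ ⟫ (q * p)                                  ∎
    identityˡ : ∀ p φ → ⟪ φ ⟫ (1# * p) R.≈ ⟪ φ ⟫ p
    identityˡ p φ = begin
      ⟪ φ ⟫ (1# * p)                                           ≈⟨ ⟪⟫-product φ 1# p ⟩
      R.1# R.* ⟪ (λ m → φ (one · m)) ⟫ p R.+ R.0#              ≈⟨ R.+-identityʳ _ ⟩
      R.1# R.* ⟪ (λ m → φ (one · m)) ⟫ p                       ≈⟨ R.*-identityˡ _ ⟩
      ⟪ (λ m → φ (one · m)) ⟫ p                                ≈⟨ ⟪⟫-cong (λ m → R.reflexive (cong φ (·-identityˡ m))) p ⟩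
      ⟪ φ ⟫ p                                                  ∎
    distribˡ′ : ∀ p q s φ → ⟪ φ ⟫ (p * (q + s)) R.≈ ⟪ φ ⟫ (p * q + p * s)
    distribˡ′ p q s φ = begin
      ⟪ φ ⟫ (p * (q + s))
        ≈⟨ ⟪⟫-product φ p (q + s) ⟩
      ⟪ (λ m → ⟪ (λ m′ → φ (m · m′)) ⟫ (q + s)) ⟫ p
        ≈⟨ ⟪⟫-cong (λ m → ⟪⟫-++ _ q s) p ⟩
      ⟪ (λ m → ⟪ (λ m′ → φ (m · m′)) ⟫ q R.+ ⟪ (λ m′ → φ (m · m′)) ⟫ s) ⟫ p
        ≈⟨ ⟪⟫-+ _ _ p ⟩
      _ ≈⟨ R.+-cong (⟪⟫-product φ p q) (⟪⟫-product φ p s) ⟨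
      ⟪ φ ⟫ (p * q) R.+ ⟪ φ ⟫ (p * s)
        ≈⟨ ⟪⟫-++ φ (p * q) (p * s) ⟨
      ⟪ φ ⟫ (p * q + p * s) ∎

-- Determinants and derivations over a commutative ring

module DeterminantProperties (S : CommutativeRing 0ℓ 0ℓ) where

  open CommutativeRing S hiding (zero) renaming (refl to ≈-refl; sym to ≈-sym; trans to ≈-trans)
  open RingProperties ring using (-‿distribʳ-*)
  open AbelianGroupProperties +-abelianGroup using (⁻¹-∙-comm; ε⁻¹≈ε; ⁻¹-involutive)
  open CommutativeSemigroupProperties +-commutativeSemigroup using (interchange)
  open Determinant rawRing public
  open import Relation.Binary.Reasoning.Setoid setoid

  ∑ : ∀ {k} → (Fin k → Carrier) → Carrier
  ∑ f = sum (List.tabulate f)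

  ∑-cong : ∀ {k} {f g : Fin k → Carrier} → (∀ i → f i ≈ g i) → ∑ f ≈ ∑ g
  ∑-cong {zero}  h = ≈-refl
  ∑-cong {suc k} h = +-cong (h zero) (∑-cong (h ∘ suc))

  ∑-0 : ∀ {k} {f : Fin k → Carrier} → (∀ i → f i ≈ 0#) → ∑ f ≈ 0#
  ∑-0 {zero}  h = ≈-refl
  ∑-0 {suc k} h = ≈-trans (+-cong (h zero) (∑-0 (h ∘ suc))) (+-identityˡ _)

  ∑-+ : ∀ {k} (f g : Fin k → Carrier) → ∑ (λ i → f i + g i) ≈ ∑ f + ∑ g
  ∑-+ {zero}  f g = ≈-sym (+-identityˡ _)
  ∑-+ {suc k} f g = ≈-trans (+-congˡ (∑-+ (f ∘ suc) (g ∘ suc))) (interchange _ _ _ _)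

  ∑-* : ∀ {k} a (f : Fin k → Carrier) → a * ∑ f ≈ ∑ (λ i → a * f i)
  ∑-* {zero}  a f = zeroʳ a
  ∑-* {suc k} a f = ≈-trans (distribˡ a _ _) (+-congˡ (∑-* a (f ∘ suc)))

  signed-cong : ∀ j {x y} → x ≈ y → signed j x ≈ signed j y
  signed-cong zero    h = h
  signed-cong (suc j) h = -‿cong (signed-cong j h)

  signed-0 : ∀ j {x} → x ≈ 0# → signed j x ≈ 0#
  signed-0 zero    h = h
  signed-0 (suc j) h = ≈-trans (-‿cong (signed-0 j h)) ε⁻¹≈ε

  signed-+ : ∀ j x y → signed j (x + y) ≈ signed j x + signed j y
  signed-+ zero    x y = ≈-refl
  signed-+ (suc j) x y = ≈-trans (-‿cong (signed-+ j x y)) (≈-sym (⁻¹-∙-comm _ _))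

  signed-∑ : ∀ j {k} (f : Fin k → Carrier) → signed j (∑ f) ≈ ∑ (λ i → signed j (f i))
  signed-∑ j {zero}  f = signed-0 j ≈-refl
  signed-∑ j {suc k} f = ≈-trans (signed-+ j _ _) (+-congˡ (signed-∑ j (f ∘ suc)))

  signed-*ʳ : ∀ j x y → x * signed j y ≈ signed j (x * y)
  signed-*ʳ zero    x y = ≈-refl
  signed-*ʳ (suc j) x y = ≈-trans (≈-sym (-‿distribʳ-* x _)) (-‿cong (signed-*ʳ j x y))

  signed-neg : ∀ j x → signed j (- x) ≈ - signed j x
  signed-neg zero    x = ≈-refl
  signed-neg (suc j) x = -‿cong (signed-neg j x)

  det-cong : ∀ {k} {A B : Fin k → Fin k → Carrier} → (∀ i j → A i j ≈ B i j) → det A ≈ det B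
  det-cong {zero}  h = ≈-refl
  det-cong {suc k} h = ∑-cong λ j →
    signed-cong (toℕ j) (*-cong (h zero j) (det-cong λ a b → h (suc a) (punchIn j b)))

  laplace-cong : ∀ {k} (a f g : Fin k → Carrier) → (∀ j → f j ≈ g j) →
    ∑ (λ j → signed (toℕ j) (a j * f j)) ≈ ∑ (λ j → signed (toℕ j) (a j * g j))
  laplace-cong a f g h = ∑-cong λ j → signed-cong (toℕ j) (*-congˡ (h j))

  laplace-0 : ∀ {k} (a f : Fin k → Carrier) → (∀ j → f j ≈ 0#) →
    ∑ (λ j → signed (toℕ j) (a j * f j)) ≈ 0#
  laplace-0 a f h = ∑-0 λ j → signed-0 (toℕ j) (≈-trans (*-congˡ (h j)) (zeroʳ _))

  private
    -- The pairs (j , l) and (punchIn j l , j′) remove the same two columns, with opposite signs.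
    removals-cancel : ∀ {k} (a : Fin (2 ℕ.+ k) → Carrier) (H : (Fin k → Fin (2 ℕ.+ k)) → Carrier) →
      (∀ {g g′} → (∀ x → g x ≡ g′ x) → H g ≈ H g′) →
      ∑ (λ j → ∑ λ l → signed (toℕ j) (signed (toℕ l) (a j * (a (punchIn j l) * H (punchIn j ∘ punchIn l))))) ≈ 0#
    removals-cancel {k} a H H-cong = begin
      ∑ (F zero) + ∑ (λ j → ∑ (F (suc j)))
        ≈⟨ +-congˡ (∑-+ (λ j → F (suc j) zero) (λ j → ∑ λ l → F (suc j) (suc l))) ⟩
      ∑ (F zero) + (∑ (λ j → F (suc j) zero) + ∑ (λ j → ∑ λ l → F (suc j) (suc l)))
        ≈⟨ +-assoc _ _ _ ⟨
      (∑ (F zero) + ∑ (λ j → F (suc j) zero)) + ∑ (λ j → ∑ λ l → F (suc j) (suc l))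
        ≈⟨ +-cong (≈-sym (∑-+ (F zero) (λ j → F (suc j) zero))) (later k a H H-cong) ⟩
      ∑ (λ j → F zero j + F (suc j) zero) + 0#
        ≈⟨ +-identityʳ _ ⟩
      ∑ (λ j → F zero j + F (suc j) zero)
        ≈⟨ ∑-0 opposite ⟩
      0# ∎
      where
      F : Fin (2 ℕ.+ k) → Fin (suc k) → Carrier
      F j l = signed (toℕ j) (signed (toℕ l) (a j * (a (punchIn j l) * H (punchIn j ∘ punchIn l))))
      opposite : ∀ j → F zero j + F (suc j) zero ≈ 0#
      opposite j = ≈-trans (+-congˡ (-‿cong (signed-cong (toℕ j) (begin
        a (suc j) * (a zero * H (suc ∘ punchIn j))  ≈⟨ *-assoc _ _ _ ⟨
        (a (suc j) * a zero) * H (suc ∘ punchIn j)  ≈⟨ *-congʳ (*-comm _ _) ⟩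
        (a zero * a (suc j)) * H (suc ∘ punchIn j)  ≈⟨ *-assoc _ _ _ ⟩
        a zero * (a (suc j) * H (suc ∘ punchIn j))  ∎)))) (-‿inverseʳ _)
      -- The pairs that avoid column 0: both signs flip, and column 0 always survives, so this is
      -- the same sum for `a ∘ suc`, with `lift 1` putting column 0 back.
      later : ∀ k (a : Fin (2 ℕ.+ k) → Carrier) (H : (Fin k → Fin (2 ℕ.+ k)) → Carrier) →
        (∀ {g g′} → (∀ x → g x ≡ g′ x) → H g ≈ H g′) →
        ∑ {suc k} (λ j → ∑ {k} λ l → signed (toℕ (suc j)) (signed (toℕ (suc l))
          (a (suc j) * (a (punchIn (suc j) (suc l)) * H (punchIn (suc j) ∘ punchIn (suc l)))))) ≈ 0#
      later zero    a H H-cong = ∑-0 {1} λ _ → ≈-refl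
      later (suc k) a H H-cong = ≈-trans
        (∑-cong λ j → ∑-cong λ l → term j l)
        (removals-cancel {k} (a ∘ suc) (H ∘ Fin.lift 1)
          (λ h → H-cong λ { zero → refl ; (suc x) → cong suc (h x) }))
        where
        term : ∀ j l →
          signed (toℕ (suc j)) (signed (toℕ (suc l))
            (a (suc j) * (a (punchIn (suc j) (suc l)) * H (punchIn (suc j) ∘ punchIn (suc l))))) ≈
          signed (toℕ j) (signed (toℕ l)
            (a (suc j) * (a (suc (punchIn j l)) * H (Fin.lift 1 (punchIn j ∘ punchIn l)))))
        term j l = ≈-trans (-‿cong (signed-neg (toℕ j) _)) (≈-trans (⁻¹-involutive _)
          (signed-cong (toℕ j) (signed-cong (toℕ l) (*-congˡ {a (suc j)} (*-congˡ {a (suc (punchIn j l))}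
            (H-cong λ { zero → refl ; (suc x) → refl }))))))

  -- Rows are indexed by ℕ and columns by labels in `V`, so that the submatrices in a Laplace
  -- expansion are of the same form: the first row is dropped by `Y ∘ suc`, a column by
  -- `e ∘ punchIn j`.
  rowDet : ∀ {V : Set} {k} → (ℕ → V → Carrier) → (Fin k → V) → Carrier
  rowDet Y e = det λ a b → Y (toℕ a) (e b)

  module _ {V : Set} where

    rowDet-cong : ∀ {k} (Y : ℕ → V → Carrier) {e e′ : Fin k → V} → (∀ j → e j ≡ e′ j) → rowDet Y e ≈ rowDet Y e′
    rowDet-cong Y h = det-cong λ a b → reflexive (cong (Y (toℕ a)) (h b))

    -- The Laplace expansion along the first two rows, which are arguments of their own so that they
    -- can be set equal.
    twoRows : ∀ {k} → (V → Carrier) → (V → Carrier) → (ℕ → V → Carrier) → (Fin (2 ℕ.+ k) → V) → Carrier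
    twoRows {k} f g Y e = ∑ λ j → signed (toℕ j) (f (e j) * ∑ {suc k} λ l → signed (toℕ l)
      (g (e (punchIn j l)) * rowDet Y (e ∘ punchIn j ∘ punchIn l)))

    twoRows-equal : ∀ {k} f (Y : ℕ → V → Carrier) (e : Fin (2 ℕ.+ k) → V) → twoRows f f Y e ≈ 0#
    twoRows-equal {k} f Y e = ≈-trans
      (∑-cong λ j → ≈-trans (signed-cong (toℕ j) (≈-trans
          (∑-* (f (e j)) λ l → signed (toℕ l) (f (e (punchIn j l)) * rowDet Y (e ∘ punchIn j ∘ punchIn l)))
          (∑-cong λ l → signed-*ʳ (toℕ l) (f (e j)) (f (e (punchIn j l)) * rowDet Y (e ∘ punchIn j ∘ punchIn l)))))
        (signed-∑ (toℕ j) (λ l → signed (toℕ l) (f (e j) * (f (e (punchIn j l)) * rowDet Y (e ∘ punchIn j ∘ punchIn l))))))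
      (removals-cancel (f ∘ e) (λ g → rowDet Y (e ∘ g)) (λ h → rowDet-cong Y (λ x → cong e (h x))))

    private
      ∑-pair : ∀ {k} (f : Fin (suc k) → Carrier) (j : Fin k) → f (inject₁ j) + f (suc j) ≈ 0# →
        (∀ l → l ≢ inject₁ j → l ≢ suc j → f l ≈ 0#) → ∑ f ≈ 0#
      ∑-pair {suc k} f zero    pair rest =
        ≈-trans (≈-sym (+-assoc _ _ _)) (≈-trans (+-cong pair (∑-0 λ i → rest (suc (suc i)) (λ ()) (λ ()))) (+-identityˡ _))
      ∑-pair {suc k} f (suc j) pair rest =
        ≈-trans (+-cong (rest zero (λ ()) (λ ())) (∑-pair (f ∘ suc) j pair
          (λ l p q → rest (suc l) (p ∘ Fin.suc-injective) (q ∘ Fin.suc-injective)))) (+-identityˡ _)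

      punchIn-adjacent : ∀ {k} (l : Fin (2 ℕ.+ k)) (j : Fin (suc k)) → l ≢ inject₁ j → l ≢ suc j →
        ∃[ j′ ] punchIn l (inject₁ j′) ≡ inject₁ j × punchIn l (suc j′) ≡ suc j
      punchIn-adjacent         zero          zero    p q = ⊥-elim (p refl)
      punchIn-adjacent         zero          (suc j) p q = j , refl , refl
      punchIn-adjacent         (suc zero)    zero    p q = ⊥-elim (q refl)
      punchIn-adjacent {suc k} (suc (suc l)) zero    p q = zero , refl , refl
      punchIn-adjacent {suc k} (suc l)       (suc j) p q =
        let j′ , eq , eq′ = punchIn-adjacent l j (p ∘ cong suc) (q ∘ cong suc)
        in suc j′ , cong suc eq , cong suc eq′

      punchIn-swap : ∀ {k} (e : Fin (2 ℕ.+ k) → V) (j : Fin (suc k)) → e (inject₁ j) ≡ e (suc j) →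
        ∀ b → e (punchIn (inject₁ j) b) ≡ e (punchIn (suc j) b)
      punchIn-swap         e zero    h zero    = sym h
      punchIn-swap         e zero    h (suc b) = refl
      punchIn-swap         e (suc j) h zero    = refl
      punchIn-swap {suc k} e (suc j) h (suc b) = punchIn-swap (e ∘ suc) j h b

    -- A term of the first-row expansion that removes neither of the two columns keeps them adjacent
    -- and equal in its minor, so induction applies. The two terms that remove one of them have
    -- equal entries and equal minors but opposite signs.
    rowDet-equalColumns : ∀ {k} (Y : ℕ → V → Carrier) (e : Fin (suc k) → V) (j : Fin k) →
      e (inject₁ j) ≡ e (suc j) → rowDet Y e ≈ 0#
    rowDet-equalColumns {suc k} Y e j h = ∑-pair _ j cancel λ l p q →
      let j′ , eq , eq′ = punchIn-adjacent l j p q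
      in signed-0 (toℕ l) (≈-trans (*-congˡ {Y 0 (e l)} (rowDet-equalColumns (Y ∘ suc) (e ∘ punchIn l) j′
           (trans (cong e eq) (trans h (cong e (sym eq′)))))) (zeroʳ _))
      where
      cancel : _ ≈ 0#
      cancel = ≈-trans (+-congʳ (≈-trans (reflexive (cong (λ t → signed t (Y 0 (e (inject₁ j)) * rowDet (Y ∘ suc) (e ∘ punchIn (inject₁ j)))) (Fin.toℕ-inject₁ j)))
        (signed-cong (toℕ j) (*-cong (reflexive (cong (Y 0) h))
          (rowDet-cong (Y ∘ suc) (punchIn-swap e j h)))))) (-‿inverseʳ _)

  record IsDerivation (δ : Carrier → Carrier) : Set where
    field
      δ-cong : ∀ {x y} → x ≈ y → δ x ≈ δ y
      δ-0    : δ 0# ≈ 0#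
      δ-1    : δ 1# ≈ 0#
      δ-+    : ∀ x y → δ (x + y) ≈ δ x + δ y
      δ-neg  : ∀ x → δ (- x) ≈ - δ x
      δ-*    : ∀ x y → δ (x * y) ≈ δ x * y + x * δ y

    δ-constant* : ∀ x y → δ x ≈ 0# → δ (x * y) ≈ x * δ y
    δ-constant* x y p = ≈-trans (δ-* x y) (≈-trans (+-congʳ (≈-trans (*-congʳ p) (zeroˡ _))) (+-identityˡ _))

    δ-*constant : ∀ x y → δ y ≈ 0# → δ (x * y) ≈ δ x * y
    δ-*constant x y q = ≈-trans (δ-* x y) (≈-trans (+-congˡ (≈-trans (*-congˡ q) (zeroʳ _))) (+-identityʳ _))

    δ-signed : ∀ j x → δ (signed j x) ≈ signed j (δ x)
    δ-signed zero    x = ≈-refl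
    δ-signed (suc j) x = ≈-trans (δ-neg _) (-‿cong (δ-signed j x))

    δ-∑ : ∀ {k} (f : Fin k → Carrier) → δ (∑ f) ≈ ∑ (δ ∘ f)
    δ-∑ {zero}  f = δ-0
    δ-∑ {suc k} f = ≈-trans (δ-+ _ _) (+-congˡ (δ-∑ (f ∘ suc)))

    module _ {V : Set} where

      private
        expand : ∀ {k} (Y : ℕ → V → Carrier) (e : Fin (suc k) → V) → (∀ v → δ (Y 0 v) ≈ 0#) →
          δ (rowDet Y e) ≈ ∑ (λ j → signed (toℕ j) (Y 0 (e j) * δ (rowDet (Y ∘ suc) (e ∘ punchIn j))))
        expand Y e Y₀ = ≈-trans (δ-∑ (λ j → signed (toℕ j) (Y 0 (e j) * rowDet (Y ∘ suc) (e ∘ punchIn j))))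
          (∑-cong λ j → ≈-trans (δ-signed (toℕ j) _) (signed-cong (toℕ j)
            (δ-constant* _ (rowDet (Y ∘ suc) (e ∘ punchIn j)) (Y₀ (e j)))))

      rowDet-constant : ∀ {k} (Y : ℕ → V → Carrier) (e : Fin k → V) →
        (∀ a v → δ (Y a v) ≈ 0#) → δ (rowDet Y e) ≈ 0#
      rowDet-constant {zero}  Y e h = δ-1
      rowDet-constant {suc k} Y e h = ≈-trans (expand Y e (h 0)) (laplace-0 (Y 0 ∘ e) _ λ j →
        rowDet-constant (Y ∘ suc) (e ∘ punchIn j) (h ∘ suc))

      -- Deriving row i + 1 turns it into a copy of row i.
      rowDet-killed : ∀ {k} i (Y : ℕ → V → Carrier) (e : Fin k → V) →
        (∀ v → δ (Y (suc i) v) ≈ Y i v) → (∀ a v → a ≢ suc i → δ (Y a v) ≈ 0#) →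
        δ (rowDet Y e) ≈ 0#
      rowDet-killed {zero}        i       Y e h h₀ = δ-1
      rowDet-killed {suc k}       (suc i) Y e h h₀ = ≈-trans (expand Y e (λ v → h₀ 0 v λ ())) (laplace-0 (Y 0 ∘ e) _ λ j →
        rowDet-killed i (Y ∘ suc) (e ∘ punchIn j) h (λ a v p → h₀ (suc a) v (p ∘ ℕ.suc-injective)))
      rowDet-killed {suc zero}    zero    Y e h h₀ = ≈-trans (expand Y e (λ v → h₀ 0 v λ ())) (laplace-0 (Y 0 ∘ e) (λ _ → δ 1#) λ j → δ-1)
      -- The derivative of the second row is the first row, so the expansion along these two rows
      -- becomes `twoRows` with equal rows.
      rowDet-killed {suc (suc k)} zero    Y e h h₀ = ≈-trans (expand Y e (λ v → h₀ 0 v λ ()))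
        (≈-trans (laplace-cong (Y 0 ∘ e) _ _ λ j → second (e ∘ punchIn j))
          (twoRows-equal (Y 0) (λ a → Y (2 ℕ.+ a)) e))
        where
        second : (e : Fin (suc k) → V) → δ (rowDet (Y ∘ suc) e) ≈
          ∑ (λ l → signed (toℕ l) (Y 0 (e l) * rowDet (λ a → Y (2 ℕ.+ a)) (e ∘ punchIn l)))
        second e = ≈-trans (δ-∑ (λ l → signed (toℕ l) (Y 1 (e l) * rowDet (λ a → Y (2 ℕ.+ a)) (e ∘ punchIn l))))
          (∑-cong λ l → ≈-trans (δ-signed (toℕ l) _) (signed-cong (toℕ l)
            (≈-trans (δ-*constant _ (rowDet (λ a → Y (2 ℕ.+ a)) (e ∘ punchIn l))
                (rowDet-constant (λ a → Y (2 ℕ.+ a)) (e ∘ punchIn l) (λ a v → h₀ (2 ℕ.+ a) v λ ())))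
              (*-congʳ (h (e l))))))

module DeterminantHomomorphism (S S′ : CommutativeRing 0ℓ 0ℓ) where
  private
    module S = CommutativeRing S
    module S′ = CommutativeRing S′
    module D = DeterminantProperties S
    module D′ = DeterminantProperties S′

  module _ (h : S.Carrier → S′.Carrier)
    (h-0 : h S.0# S′.≈ S′.0#) (h-1 : h S.1# S′.≈ S′.1#)
    (h-+ : ∀ x y → h (x S.+ y) S′.≈ (h x S′.+ h y))
    (h-neg : ∀ x → h (S.- x) S′.≈ (S′.- h x))
    (h-* : ∀ x y → h (x S.* y) S′.≈ (h x S′.* h y)) where

    private
      h-signed : ∀ j x → h (D.signed j x) S′.≈ D′.signed j (h x)
      h-signed zero    x = S′.refl
      h-signed (suc j) x = S′.trans (h-neg _) (S′.-‿cong (h-signed j x))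

      h-∑ : ∀ {k} (f : Fin k → S.Carrier) → h (D.∑ f) S′.≈ D′.∑ (h ∘ f)
      h-∑ {zero}  f = h-0
      h-∑ {suc k} f = S′.trans (h-+ _ _) (S′.+-congˡ (h-∑ (f ∘ suc)))

    -- Meant for the substitution of values for labels, where source and target are polynomial rings
    -- in different variables.
    h-det : ∀ {k} (A : Fin k → Fin k → S.Carrier) → h (D.det A) S′.≈ D′.det (λ i j → h (A i j))
    h-det {zero}  A = h-1
    h-det {suc k} A = S′.trans (h-∑ λ j → D.signed (toℕ j) (A zero j S.* D.det (λ a b → A (suc a) (punchIn j b))))
      (D′.∑-cong λ j → S′.trans (h-signed (toℕ j) _) (D′.signed-cong (toℕ j)
        (S′.trans (h-* _ _) (S′.*-congˡ {h (A zero j)} (h-det (λ a b → A (suc a) (punchIn j b)))))))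

-- Sums of natural numbers and the rearrangement inequality

open CommutativeSemigroupProperties ℕ.+-commutativeSemigroup public using () renaming (interchange to ℕ-interchange)
open CommutativeMonoidSum ℕ.+-0-commutativeMonoid public
  using () renaming (sum to sumℕ; sum-cong-≗ to sumℕ-cong; ∑-distrib-+ to sumℕ-+; sum-remove to sumℕ-remove; ∑-comm to sumℕ-comm)

kronecker : ℕ → ℕ → ℕ
kronecker i j = if i ℕ.≡ᵇ j then 1 else 0

kronecker-refl : ∀ i → kronecker i i ≡ 1
kronecker-refl zero    = refl
kronecker-refl (suc i) = kronecker-refl i

kronecker-≢ : ∀ {i j} → i ≢ j → kronecker i j ≡ 0
kronecker-≢ {zero}  {zero}  h = ⊥-elim (h refl)
kronecker-≢ {zero}  {suc j} h = refl
kronecker-≢ {suc i} {zero}  h = refl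
kronecker-≢ {suc i} {suc j} h = kronecker-≢ {i} {j} (h ∘ cong suc)

kronecker-sym : ∀ i j → kronecker i j ≡ kronecker j i
kronecker-sym zero    zero    = refl
kronecker-sym zero    (suc j) = refl
kronecker-sym (suc i) zero    = refl
kronecker-sym (suc i) (suc j) = kronecker-sym i j

kronecker-≡ : ∀ i j → kronecker i j ≢ 0 → i ≡ j
kronecker-≡ i j h with i ℕ.≟ j
... | yes eq = eq
... | no neq = ⊥-elim (h (kronecker-≢ neq))

sumℕ-0 : ∀ {k} {f : Fin k → ℕ} → (∀ i → f i ≡ 0) → sumℕ f ≡ 0
sumℕ-0 {zero}  h = refl
sumℕ-0 {suc k} h = cong₂ ℕ._+_ (h zero) (sumℕ-0 (h ∘ suc))

sumℕ-kronecker : ∀ {k} (i : Fin k) (f : Fin k → ℕ) → sumℕ (λ j → f j ℕ.* kronecker (toℕ i) (toℕ j)) ≡ f i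
sumℕ-kronecker zero    f = trans (cong₂ ℕ._+_ (ℕ.*-identityʳ (f zero)) (sumℕ-0 λ j → ℕ.*-zeroʳ (f (suc j)))) (ℕ.+-identityʳ _)
sumℕ-kronecker (suc i) f = cong₂ ℕ._+_ (ℕ.*-zeroʳ (f zero)) (sumℕ-kronecker i (f ∘ suc))

sumℕ-*ʳ : ∀ {k} (f : Fin k → ℕ) c → sumℕ (λ j → f j ℕ.* c) ≡ sumℕ f ℕ.* c
sumℕ-*ʳ {zero}  f c = refl
sumℕ-*ʳ {suc k} f c = trans (cong (f zero ℕ.* c ℕ.+_) (sumℕ-*ʳ (f ∘ suc) c)) (sym (ℕ.*-distribʳ-+ c (f zero) _))

exchange-< : ∀ {a b c d} → a < b → c < d → a ℕ.* d ℕ.+ b ℕ.* c < a ℕ.* c ℕ.+ b ℕ.* d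
exchange-< {a} {b} {c} {d} a<b c<d
  with ℕ.m≤n⇒∃[o]m+o≡n a<b | ℕ.m≤n⇒∃[o]m+o≡n c<d
... | o , refl | o′ , refl = subst (a ℕ.* (suc c ℕ.+ o′) ℕ.+ (suc a ℕ.+ o) ℕ.* c <_) (sym (lemma a o c o′)) (ℕ.m<m+n _ (s≤s z≤n))
  where
  open import Data.Nat.Solver using (module +-*-Solver)
  open +-*-Solver
  lemma : ∀ a o c o′ → a ℕ.* c ℕ.+ (suc a ℕ.+ o) ℕ.* (suc c ℕ.+ o′) ≡
    (a ℕ.* (suc c ℕ.+ o′) ℕ.+ (suc a ℕ.+ o) ℕ.* c) ℕ.+ (suc o ℕ.* suc o′)
  lemma = solve 4 (λ a o c o′ →
    a :* c :+ (con 1 :+ a :+ o) :* (con 1 :+ c :+ o′) :=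
    (a :* (con 1 :+ c :+ o′) :+ (con 1 :+ a :+ o) :* c) :+ ((con 1 :+ o) :* (con 1 :+ o′))) refl

-- The rearrangement inequality in the form that fits a Laplace expansion: the first row takes entry
-- `j`, the others keep their order. Exchanging `b zero` and `b (suc j)` between the coefficients
-- `ρ 0` and `ρ 1` strictly increases the sum; the rows after the first are then improved by
-- induction.
rearrangement : ∀ {k} (ρ : ℕ → ℕ) (b : Fin (suc k) → ℕ) → (∀ a → ρ a < ρ (suc a)) →
  (∀ {i j} → i Fin.< j → b i < b j) → ∀ j →
  j ≡ zero ⊎ ρ 0 ℕ.* b j ℕ.+ sumℕ (λ a → ρ (suc (toℕ a)) ℕ.* b (punchIn j a)) < sumℕ (λ a → ρ (toℕ a) ℕ.* b a)
rearrangement         ρ b ρ< b< zero    = inj₁ refl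
rearrangement {suc k} ρ b ρ< b< (suc j) = inj₂ (begin-strict
  ρ 0 ℕ.* bⱼ ℕ.+ (ρ 1 ℕ.* b zero ℕ.+ rest)  ≡⟨ ℕ.+-assoc (ρ 0 ℕ.* bⱼ) _ _ ⟨
  (ρ 0 ℕ.* bⱼ ℕ.+ ρ 1 ℕ.* b zero) ℕ.+ rest  <⟨ ℕ.+-monoˡ-< rest (exchange-< (ρ< 0) (b< (s≤s z≤n))) ⟩
  (ρ 0 ℕ.* b zero ℕ.+ ρ 1 ℕ.* bⱼ) ℕ.+ rest  ≡⟨ ℕ.+-assoc (ρ 0 ℕ.* b zero) _ _ ⟩
  ρ 0 ℕ.* b zero ℕ.+ (ρ 1 ℕ.* bⱼ ℕ.+ rest)  ≤⟨ ℕ.+-monoʳ-≤ (ρ 0 ℕ.* b zero) (inner (rearrangement (ρ ∘ suc) (b ∘ suc) (ρ< ∘ suc) (b< ∘ s≤s) j)) ⟩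
  ρ 0 ℕ.* b zero ℕ.+ sumℕ (λ a → ρ (suc (toℕ a)) ℕ.* b (suc a)) ∎)
  where
  open ℕ.≤-Reasoning
  bⱼ = b (suc j)
  rest = sumℕ (λ a → ρ (suc (suc (toℕ a))) ℕ.* b (suc (punchIn j a)))
  inner : j ≡ zero ⊎ ρ 1 ℕ.* bⱼ ℕ.+ rest < sumℕ (λ a → ρ (suc (toℕ a)) ℕ.* b (suc a)) →
    ρ 1 ℕ.* bⱼ ℕ.+ rest ≤ sumℕ (λ a → ρ (suc (toℕ a)) ℕ.* b (suc a))
  inner (inj₁ refl) = ℕ.≤-refl
  inner (inj₂ lt)   = ℕ.<⇒≤ lt

punchIn-mono-< : ∀ {k} (l : Fin (suc k)) {i j : Fin k} → i Fin.< j → punchIn l i Fin.< punchIn l j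
punchIn-mono-< l {i} {j} lt = ℕ.≤∧≢⇒< (Fin.punchIn-mono-≤ l i j (ℕ.<⇒≤ lt))
  λ eq → ℕ.<⇒≢ lt (cong toℕ (Fin.punchIn-injective l i j (Fin.toℕ-injective eq)))

AllPairs-lookup : ∀ {A : Set} {Q : A → A → Set} {xs} → AllPairs Q xs → ∀ {i j} → i Fin.< j → Q (lookup xs i) (lookup xs j)
AllPairs-lookup (q ∷ qs) {zero}  {suc j} _        = All.lookup q (∈.∈-lookup j)
AllPairs-lookup (q ∷ qs) {suc i} {suc j} (s≤s lt) = AllPairs-lookup qs lt

-- Minors, gradings and leading monomials

module Minors (R : CommutativeRing 0ℓ 0ℓ) (n r : ℕ) where

  private module R = CommutativeRing R
  open PolynomialProperties R n r public
  private module P = CommutativeRing polynomialCommutativeRing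
  open DeterminantProperties polynomialCommutativeRing public
    using (det; product; sum; signed; det-cong; rowDet; rowDet-cong; rowDet-equalColumns; IsDerivation)

  ≈-refl : ∀ p → p ≈ p
  ≈-refl p m = R.refl

  cell : ℕ → Fin r → Monomial
  cell i v = monomial λ i′ j → kronecker i (toℕ i′) ℕ.* kronecker (toℕ v) (toℕ j)

  cell-⟦⟧ : ∀ i v i′ j → cell i v ⟦ i′ , j ⟧ ≡ kronecker i (toℕ i′) ℕ.* kronecker (toℕ v) (toℕ j)
  cell-⟦⟧ i v = monomial-⟦⟧ _

  -- Rows are indexed by ℕ; for i ≥ n the monomial is junk, namely one.
  X : ℕ → Fin r → Polynomial
  X i v = (R.1# , cell i v) ∷ []

  x≡X : ∀ i v → x i v ≡ X (toℕ i) v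
  x≡X i v = cong (λ m → (R.1# , m) ∷ []) (monomial-ext λ i′ j →
    trans (monomial-⟦⟧ (λ i′ j → if does (i Fin.≟ i′) ∧ does (v Fin.≟ j) then 1 else 0) i′ j)
      (trans (both (i Fin.≟ i′) (v Fin.≟ j)) (sym (cell-⟦⟧ (toℕ i) v i′ j))))
    where
    both : ∀ {i′ j} (d : Dec (i ≡ i′)) (d′ : Dec (v ≡ j)) →
      (if does d ∧ does d′ then 1 else 0) ≡ kronecker (toℕ i) (toℕ i′) ℕ.* kronecker (toℕ v) (toℕ j)
    both (yes refl) (yes refl) = sym (cong₂ ℕ._*_ (kronecker-refl (toℕ i)) (kronecker-refl (toℕ v)))
    both (yes refl) (no neq)   = sym (trans (cong (kronecker (toℕ i) (toℕ i) ℕ.*_) (kronecker-≢ (neq ∘ Fin.toℕ-injective))) (ℕ.*-zeroʳ (kronecker (toℕ i) (toℕ i))))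
    both (no neq)   d′         = sym (cong (ℕ._* _) (kronecker-≢ (neq ∘ Fin.toℕ-injective)))

  minor : List (Fin r) → Polynomial
  minor J = rowDet X (lookup J)

  bideterminant : List (List (Fin r)) → Polynomial
  bideterminant Js = product (map minor Js)

  product-↭ : ∀ {ps qs} → ps ↭ qs → product ps ≈ product qs
  product-↭ {ps} ↭.refl       = ≈-refl (product ps)
  product-↭ (↭.prep {ps} {qs} p h)   = P.*-cong {p} {p} {product ps} {product qs} (≈-refl p) (product-↭ h)
  product-↭ (↭.swap {ps} {qs} p q h) m = R.trans
    (R.sym (P.*-assoc p q (product ps) m)) (R.trans
      (P.*-cong {p * q} {q * p} {product ps} {product qs} (P.*-comm p q) (product-↭ h) m)
      (P.*-assoc q p (product qs) m))
  product-↭ (↭.trans h h′) m  = R.trans (product-↭ h m) (product-↭ h′ m)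

  -- A condition on all listed terms, including those that cancel or have coefficient 0. It is not
  -- invariant under `_≈_`, but passes through sums, signs and products without any discussion of
  -- cancellation.
  Terms : (Monomial → Set) → Polynomial → Set
  Terms Q = All (Q ∘ proj₂)

  coefficient-absent : ∀ {Q : Monomial → Set} {p} → Terms Q p → ∀ m → ¬ Q m → coefficient p m R.≈ R.0#
  coefficient-absent {p = []}          []       m ¬Q = R.refl
  coefficient-absent {p = (c , m′) ∷ p} (q ∷ qs) m ¬Q with m′ ≟ₘ m
  ... | yes refl = ⊥-elim (¬Q q)
  ... | no _     = coefficient-absent qs m ¬Q

  Terms-scale : ∀ {Q : Monomial → Set} c {p} → Terms Q p → Terms Q (c • p)
  Terms-scale c = All.map⁺

  Terms-neg : ∀ {Q : Monomial → Set} {p} → Terms Q p → Terms Q (- p)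
  Terms-neg = All.map⁺

  Terms-signed : ∀ {Q : Monomial → Set} j {p} → Terms Q p → Terms Q (signed j p)
  Terms-signed zero    h = h
  Terms-signed (suc j) h = Terms-neg (Terms-signed j h)

  Terms-sum : ∀ {Q : Monomial → Set} {k} {f : Fin k → Polynomial} → (∀ i → Terms Q (f i)) → Terms Q (sum (List.tabulate f))
  Terms-sum {k = zero}  h = []
  Terms-sum {k = suc k} h = All.++⁺ (h zero) (Terms-sum (h ∘ suc))

  Terms-* : ∀ {Q Q′ Q″ : Monomial → Set} → (∀ {m m′} → Q m → Q′ m′ → Q″ (m · m′)) →
    ∀ {p q} → Terms Q p → Terms Q′ q → Terms Q″ (p * q)
  Terms-* h []        qs = []
  Terms-* h (u ∷ us) qs = All.++⁺ (All.map⁺ (All.map (h u) qs)) (Terms-* h us qs)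

  module Grading (ω : Fin n → Fin r → ℕ) where

    degree : Monomial → ℕ
    degree m = sumℕ λ i → sumℕ λ j → ω i j ℕ.* m ⟦ i , j ⟧

    degree-· : ∀ m m′ → degree (m · m′) ≡ degree m ℕ.+ degree m′
    degree-· m m′ = trans (sumℕ-cong λ i → trans (sumℕ-cong λ j →
        trans (cong (ω i j ℕ.*_) (·-⟦⟧ m m′ i j)) (ℕ.*-distribˡ-+ (ω i j) (m ⟦ i , j ⟧) _))
        (sumℕ-+ (λ j → ω i j ℕ.* m ⟦ i , j ⟧) (λ j → ω i j ℕ.* m′ ⟦ i , j ⟧)))
      (sumℕ-+ (λ i → sumℕ λ j → ω i j ℕ.* m ⟦ i , j ⟧) (λ i → sumℕ λ j → ω i j ℕ.* m′ ⟦ i , j ⟧))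

    degree-one : degree one ≡ 0
    degree-one = sumℕ-0 λ i → sumℕ-0 λ j → trans (cong (ω i j ℕ.*_) (one-⟦⟧ i j)) (ℕ.*-zeroʳ (ω i j))

    degree-cell : ∀ i v → degree (cell (toℕ i) v) ≡ ω i v
    degree-cell i v = trans (sumℕ-cong λ i′ → trans (trans (sumℕ-cong λ j →
        trans (cong (ω i′ j ℕ.*_) (trans (cell-⟦⟧ (toℕ i) v i′ j) (ℕ.*-comm (kronecker (toℕ i) (toℕ i′)) _)))
          (sym (ℕ.*-assoc (ω i′ j) _ _)))
        (sumℕ-*ʳ (λ j → ω i′ j ℕ.* kronecker (toℕ v) (toℕ j)) (kronecker (toℕ i) (toℕ i′))))
        (cong (ℕ._* kronecker (toℕ i) (toℕ i′)) (sumℕ-kronecker v (ω i′))))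
      (sumℕ-kronecker i (λ i′ → ω i′ v))

    -- The degree of an entry is a row part plus a column part, and every term of the full expansion
    -- uses each row and each column exactly once. Only rows `a < k` are asked about, because `X` is
    -- junk from row n on.
    rowDet-homogeneous : ∀ {k} (Y : ℕ → Fin r → Polynomial) (e : Fin k → Fin r) (c : ℕ → ℕ) (d : Fin r → ℕ) →
      (∀ a v → a < k → Terms (λ m → degree m ≡ c a ℕ.+ d v) (Y a v)) →
      Terms (λ m → degree m ≡ sumℕ {k} (c ∘ toℕ) ℕ.+ sumℕ (d ∘ e)) (rowDet Y e)
    rowDet-homogeneous {zero}  Y e c d h = degree-one ∷ []
    rowDet-homogeneous {suc k} Y e c d h = Terms-sum λ j → Terms-signed (toℕ j)
      (Terms-* (λ {m} {m′} q q′ → trans (degree-· m m′) (trans (cong₂ ℕ._+_ q q′) (collect j)))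
        (h 0 (e j) (s≤s z≤n))
        (rowDet-homogeneous (Y ∘ suc) (e ∘ punchIn j) (c ∘ suc) d (λ a v lt → h (suc a) v (s≤s lt))))
      where
      collect : ∀ j → (c 0 ℕ.+ d (e j)) ℕ.+ (sumℕ {k} (c ∘ suc ∘ toℕ) ℕ.+ sumℕ (d ∘ e ∘ punchIn j)) ≡
        (c 0 ℕ.+ sumℕ {k} (c ∘ suc ∘ toℕ)) ℕ.+ sumℕ (d ∘ e)
      collect j = trans (ℕ-interchange (c 0) (d (e j)) _ _) (cong (c 0 ℕ.+ sumℕ {k} (c ∘ suc ∘ toℕ) ℕ.+_) (sym (sumℕ-remove {i = j} (d ∘ e))))

  module Leading (β : Fin r → ℕ) (β-increasing : ∀ {u v} → u Fin.< v → β u < β v) where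

    open Grading (λ i v → toℕ i ℕ.* β v) public renaming (degree to weight; degree-· to weight-·)

    -- The leading coefficient is 1 and no term of `lower` reaches the weight of `m`. Leads
    -- therefore multiply over every commutative ring, without a condition on zero divisors.
    record HasLead (p : Polynomial) (m : Monomial) : Set where
      constructor hasLead
      field
        lower      : Polynomial
        expansion  : p ≈ ((R.1# , m) ∷ lower)
        lower-less : Terms (λ m′ → weight m′ < weight m) lower

    weight-cell : ∀ {i} v → i < n → weight (cell i v) ≡ i ℕ.* β v
    weight-cell {i} v i<n = subst (λ t → weight (cell t v) ≡ t ℕ.* β v) (Fin.toℕ-fromℕ< i<n) (degree-cell (fromℕ< i<n) v)

    HasLead-* : ∀ {p p′ m m′} → HasLead p m → HasLead p′ m′ → HasLead (p * p′) (m · m′)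
    HasLead-* {p} {p′} {m} {m′} (hasLead q p≈ q<) (hasLead q′ p′≈ q′<) = hasLead _ eq bound
      where
      eq : p * p′ ≈ ((R.1# , m · m′) ∷ (map _ q′ + q * ((R.1# , m′) ∷ q′)))
      eq μ = R.trans (P.*-cong {p} {(R.1# , m) ∷ q} {p′} {(R.1# , m′) ∷ q′} p≈ p′≈ μ) (head≈ μ)
        where
        head≈ : ((R.1# , m) ∷ q) * ((R.1# , m′) ∷ q′) ≈ ((R.1# , m · m′) ∷ (map _ q′ + q * ((R.1# , m′) ∷ q′)))
        head≈ = ⟪⟫-ext {((R.1# , m) ∷ q) * ((R.1# , m′) ∷ q′)} {(R.1# , m · m′) ∷ (map _ q′ + q * ((R.1# , m′) ∷ q′))}
          λ φ → R.+-congʳ (R.*-congʳ (R.*-identityˡ R.1#))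
      bound : Terms (λ μ → weight μ < weight (m · m′)) (map _ q′ + q * ((R.1# , m′) ∷ q′))
      bound = All.++⁺
        (All.map⁺ (All.map (λ {t} lt → subst₂ _<_ (sym (weight-· m (proj₂ t))) (sym (weight-· m m′)) (ℕ.+-monoʳ-< (weight m) lt)) q′<))
        (Terms-* (λ {μ} {μ′} lt le → subst₂ _<_ (sym (weight-· μ μ′)) (sym (weight-· m m′)) (ℕ.+-mono-<-≤ lt le)) q<
          (ℕ.≤-refl ∷ All.map ℕ.<⇒≤ q′<))

    HasLead-1# : HasLead 1# one
    HasLead-1# = hasLead [] (≈-refl 1#) []

    HasLead-≈ : ∀ {p q m} → p ≈ q → HasLead p m → HasLead q m
    HasLead-≈ h (hasLead q p≈ q<) = hasLead q (λ m → R.trans (R.sym (h m)) (p≈ m)) q<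

    coefficient-lead : ∀ {p m} → HasLead p m → coefficient p m R.≈ R.1#
    coefficient-lead {p} {m} (hasLead q p≈ q<) = R.trans (p≈ m) leading
      where
      leading : coefficient ((R.1# , m) ∷ q) m R.≈ R.1#
      leading with m ≟ₘ m
      ... | yes _  = R.trans (R.+-congˡ (coefficient-absent q< m (ℕ.<-irrefl refl))) (R.+-identityʳ _)
      ... | no neq = ⊥-elim (neq refl)

    coefficient-above : ∀ {p m} → HasLead p m → ∀ m′ → weight m ≤ weight m′ → m′ ≢ m → coefficient p m′ R.≈ R.0#
    coefficient-above {p} {m} (hasLead q p≈ q<) m′ le neq = R.trans (p≈ m′) above
      where
      above : coefficient ((R.1# , m) ∷ q) m′ R.≈ R.0#
      above with m ≟ₘ m′
      ... | yes eq = ⊥-elim (neq (sym eq))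
      ... | no _   = coefficient-absent q< m′ (ℕ.≤⇒≯ le)

    diagonal : ∀ {k} → (ℕ → ℕ) → (Fin k → Fin r) → Monomial
    diagonal {zero}  ρ e = one
    diagonal {suc k} ρ e = cell (ρ 0) (e zero) · diagonal (ρ ∘ suc) (e ∘ suc)

    W : ∀ {k} → (ℕ → ℕ) → (Fin k → Fin r) → ℕ
    W ρ e = sumℕ λ a → ρ (toℕ a) ℕ.* β (e a)

    weight-diagonal : ∀ {k} ρ (e : Fin k → Fin r) → (∀ a → a < k → ρ a < n) → weight (diagonal ρ e) ≡ W ρ e
    weight-diagonal {zero}  ρ e h = degree-one
    weight-diagonal {suc k} ρ e h = trans (weight-· (cell (ρ 0) (e zero)) _)
      (cong₂ ℕ._+_ (weight-cell (e zero) (h 0 (s≤s z≤n))) (weight-diagonal (ρ ∘ suc) (e ∘ suc) (λ a lt → h (suc a) (s≤s lt))))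

    -- Proved together with the bound for a single term of the expansion, which needs it for the
    -- smaller minor. That minor has its rows from `ρ 1` on, hence the general sequence `ρ` of rows.
    rowDet-bounded : ∀ {k} ρ (e : Fin k → Fin r) → (∀ a → ρ a < ρ (suc a)) → (∀ {i j} → i Fin.< j → e i Fin.< e j) →
      (∀ a → a < k → ρ a < n) → Terms (λ m → weight m ≤ W ρ e) (rowDet (X ∘ ρ) e)
    rowDet-term-bounded : ∀ {k} ρ (e : Fin (suc k) → Fin r) → (∀ a → ρ a < ρ (suc a)) → (∀ {i j} → i Fin.< j → e i Fin.< e j) →
      (∀ a → a < suc k → ρ a < n) → ∀ j →
      Terms (λ m → weight m ≤ ρ 0 ℕ.* β (e j) ℕ.+ W (ρ ∘ suc) (e ∘ punchIn j))
        (signed (toℕ j) (X (ρ 0) (e j) * rowDet (X ∘ ρ ∘ suc) (e ∘ punchIn j)))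
    rowDet-bounded {zero}  ρ e ρ< e< h = ℕ.≤-reflexive degree-one ∷ []
    rowDet-bounded {suc k} ρ e ρ< e< h = Terms-sum λ j → All.map (λ le → ℕ.≤-trans le (best j)) (rowDet-term-bounded ρ e ρ< e< h j)
      where
      best : ∀ j → ρ 0 ℕ.* β (e j) ℕ.+ W (ρ ∘ suc) (e ∘ punchIn j) ≤ W ρ e
      best j with rearrangement ρ (β ∘ e) ρ< (β-increasing ∘ e<) j
      ... | inj₁ refl = ℕ.≤-refl
      ... | inj₂ lt   = ℕ.<⇒≤ lt
    rowDet-term-bounded ρ e ρ< e< h j = Terms-signed (toℕ j)
      (Terms-* (λ {m} {m′} q q′ → ℕ.≤-trans (ℕ.≤-reflexive (weight-· m m′)) (ℕ.+-mono-≤ q q′))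
        (ℕ.≤-reflexive (weight-cell (e j) (h 0 (s≤s z≤n))) ∷ [])
        (rowDet-bounded (ρ ∘ suc) (e ∘ punchIn j) (ρ< ∘ suc)
          (λ {a} {b} lt → e< (punchIn-mono-< j lt)) (λ a lt → h (suc a) (s≤s lt))))

    -- The term that takes column 0 in the first row carries the diagonal; by `rearrangement` every
    -- other term of the first-row expansion stays strictly below it.
    rowDet-lead : ∀ {k} ρ (e : Fin k → Fin r) → (∀ a → ρ a < ρ (suc a)) → (∀ {i j} → i Fin.< j → e i Fin.< e j) →
      (∀ a → a < k → ρ a < n) → HasLead (rowDet (X ∘ ρ) e) (diagonal ρ e)
    rowDet-lead {zero}  ρ e ρ< e< h = HasLead-1#
    rowDet-lead {suc k} ρ e ρ< e< h with
      HasLead-* {X (ρ 0) (e zero)} {rowDet (X ∘ ρ ∘ suc) (e ∘ suc)} {cell (ρ 0) (e zero)} (hasLead [] (≈-refl (X (ρ 0) (e zero))) [])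
        (rowDet-lead (ρ ∘ suc) (e ∘ suc) (ρ< ∘ suc) (e< ∘ s≤s) (λ a lt → h (suc a) (s≤s lt)))
    ... | hasLead q ≈q q< = hasLead (q + rest) eq (All.++⁺ q< (Terms-sum lower))
      where
      term : Fin (suc k) → Polynomial
      term j = signed (toℕ j) (X (ρ 0) (e j) * rowDet (X ∘ ρ ∘ suc) (e ∘ punchIn j))
      rest : Polynomial
      rest = sum (List.tabulate (term ∘ suc))
      eq : rowDet (X ∘ ρ) e ≈ ((R.1# , diagonal ρ e) ∷ (q + rest))
      eq = P.+-cong {term zero} {(R.1# , diagonal ρ e) ∷ q} {rest} {rest} ≈q (≈-refl rest)
      lower : ∀ j → Terms (λ m → weight m < weight (diagonal ρ e)) (term (suc j))
      lower j with rearrangement ρ (β ∘ e) ρ< (β-increasing ∘ e<) (suc j)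
      ... | inj₂ lt = All.map (λ le → ℕ.<-≤-trans (ℕ.≤-<-trans le lt) (ℕ.≤-reflexive (sym (weight-diagonal ρ e h))))
                        (rowDet-term-bounded ρ e ρ< e< h (suc j))

  columnMonomial : ℕ → List (Fin r) → Monomial
  columnMonomial s []      = one
  columnMonomial s (v ∷ J) = cell s v · columnMonomial (suc s) J

  leadingMonomial : List (List (Fin r)) → Monomial
  leadingMonomial = foldr (λ J m → columnMonomial 0 J · m) one

  module _ (β : Fin r → ℕ) (β-increasing : ∀ {u v} → u Fin.< v → β u < β v) where
    open Leading β β-increasing

    minor-lead : ∀ J → (∀ {i j} → i Fin.< j → lookup J i Fin.< lookup J j) → length J ≤ n → HasLead (minor J) (columnMonomial 0 J)
    minor-lead J J< J≤n = subst (HasLead (minor J)) (diagonal≡ 0 id J (λ _ → refl))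
      (rowDet-lead id (lookup J) (λ a → ℕ.n<1+n a) J< (λ a lt → ℕ.<-≤-trans lt J≤n))
      where
      diagonal≡ : ∀ s ρ J → (∀ a → ρ a ≡ s ℕ.+ a) → diagonal ρ (lookup J) ≡ columnMonomial s J
      diagonal≡ s ρ []      h = refl
      diagonal≡ s ρ (v ∷ J) h = cong₂ (λ a m → cell a v · m) (trans (h 0) (ℕ.+-identityʳ s))
        (diagonal≡ (suc s) (ρ ∘ suc) J (λ a → trans (h (suc a)) (ℕ.+-suc s a)))

    bideterminant-lead : ∀ {Js} → All (λ J → AllPairs Fin._<_ J × length J ≤ n) Js →
      HasLead (bideterminant Js) (leadingMonomial Js)
    bideterminant-lead {[]}     []              = HasLead-1#
    bideterminant-lead {J ∷ Js} ((J< , J≤n) ∷ hs) = HasLead-* {minor J} {bideterminant Js} (minor-lead J (AllPairs-lookup J<) J≤n) (bideterminant-lead hs)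

-- Row degrees, column degrees and words

less : ℕ → ℕ → ℕ
less i       zero    = 0
less zero    (suc k) = 1
less (suc i) (suc k) = less i k

sumℕ-less : ∀ i k → sumℕ {k} (λ a → kronecker i (toℕ a)) ≡ less i k
sumℕ-less i       zero    = refl
sumℕ-less zero    (suc k) = cong suc (sumℕ-0 {k} λ _ → refl)
sumℕ-less (suc i) (suc k) = sumℕ-less i k

sum-tabulate : ∀ {k} (f : Fin k → ℕ) → ListAction.sum (List.tabulate f) ≡ sumℕ f
sum-tabulate {zero}  f = refl
sum-tabulate {suc k} f = cong (f zero ℕ.+_) (sum-tabulate (f ∘ suc))

occurrences : ∀ {r} → Fin r → List (Fin r) → ℕ
occurrences t L = ListAction.sum (map (λ v → kronecker (toℕ t) (toℕ v)) L)

occurrences-++ : ∀ {r} (t : Fin r) L L′ → occurrences t (L ++ L′) ≡ occurrences t L ℕ.+ occurrences t L′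
occurrences-++ t L L′ = trans (cong ListAction.sum (List.map-++ _ L L′)) (ListAction.sum-++ (map _ L) _)

occurrences-↭ : ∀ {r} (t : Fin r) {L L′} → L ↭ L′ → occurrences t L ≡ occurrences t L′
occurrences-↭ t h = ListAction.sum-↭ (↭.map⁺ _ h)

occurrences-lookup : ∀ {r} (t : Fin r) L → sumℕ (λ b → kronecker (toℕ t) (toℕ (lookup L b))) ≡ occurrences t L
occurrences-lookup t []      = refl
occurrences-lookup t (v ∷ L) = cong (kronecker (toℕ t) (toℕ v) ℕ.+_) (occurrences-lookup t L)

occurrences-allFin : ∀ {r} (t : Fin r) → occurrences t (allFin r) ≡ 1
occurrences-allFin {r} t = trans (cong ListAction.sum (List.map-tabulate {n = r} id (λ v → kronecker (toℕ t) (toℕ v)))) (go {r} t)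
  where
  zeros : ∀ k → ListAction.sum (List.tabulate {n = k} λ _ → 0) ≡ 0
  zeros zero    = refl
  zeros (suc k) = zeros k
  go : ∀ {k} (t : Fin k) → ListAction.sum (List.tabulate {n = k} λ v → kronecker (toℕ t) (toℕ v)) ≡ 1
  go {suc k} zero    = cong suc (zeros k)
  go {suc k} (suc t) = go t

-- The length of row `i` in the shape whose columns are the given lists: `less i k` is 1 if `i < k`
-- and 0 otherwise.
longer : ∀ {A : Set} → ℕ → List (List A) → ℕ
longer i Js = ListAction.sum (map (less i ∘ length) Js)

module Homogeneity (R : CommutativeRing 0ℓ 0ℓ) (n r : ℕ) where

  open Minors R n r public

  module Column (t : Fin r) = Grading (λ _ v → kronecker (toℕ t) (toℕ v))
  module Row (i : Fin n) = Grading (λ i′ _ → kronecker (toℕ i) (toℕ i′))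

  columnDegree : Fin r → Monomial → ℕ
  columnDegree t = Column.degree t

  rowDegree : Fin n → Monomial → ℕ
  rowDegree i = Row.degree i

  minor-columnDegree : ∀ t J → length J ≤ n → Terms (λ m → columnDegree t m ≡ occurrences t J) (minor J)
  minor-columnDegree t J J≤n = All.map (λ h → trans h (cong₂ ℕ._+_ (sumℕ-0 {length J} λ _ → refl) (occurrences-lookup t J)))
    (Column.rowDet-homogeneous t X (lookup J) (λ _ → 0) (λ v → kronecker (toℕ t) (toℕ v))
      λ a v a<k → let a<n = ℕ.<-≤-trans a<k J≤n in
        subst (λ b → columnDegree t (cell b v) ≡ _) (Fin.toℕ-fromℕ< a<n) (Column.degree-cell t (fromℕ< a<n) v) ∷ [])

  minor-rowDegree : ∀ i J → length J ≤ n → Terms (λ m → rowDegree i m ≡ less (toℕ i) (length J)) (minor J)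
  minor-rowDegree i J J≤n = All.map (λ h → trans h (trans (cong₂ ℕ._+_ (sumℕ-less (toℕ i) (length J)) (sumℕ-0 {length J} λ _ → refl)) (ℕ.+-identityʳ _)))
    (Row.rowDet-homogeneous i X (lookup J) (kronecker (toℕ i)) (λ _ → 0)
      λ a v a<k → let a<n = ℕ.<-≤-trans a<k J≤n in
        subst (λ b → rowDegree i (cell b v) ≡ kronecker (toℕ i) b ℕ.+ 0) (Fin.toℕ-fromℕ< a<n)
          (trans (Row.degree-cell i (fromℕ< a<n) v) (sym (ℕ.+-identityʳ _))) ∷ [])

  bideterminant-columnDegree : ∀ t {Js} → All (λ J → length J ≤ n) Js →
    Terms (λ m → columnDegree t m ≡ occurrences t (concat Js)) (bideterminant Js)
  bideterminant-columnDegree t {[]}     []       = Column.degree-one t ∷ []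
  bideterminant-columnDegree t {J ∷ Js} (h ∷ hs) = Terms-* (λ {m} {m′} q q′ →
      trans (Column.degree-· t m m′) (trans (cong₂ ℕ._+_ q q′) (sym (occurrences-++ t J (concat Js)))))
    (minor-columnDegree t J h) (bideterminant-columnDegree t hs)

  bideterminant-rowDegree : ∀ i {Js} → All (λ J → length J ≤ n) Js →
    Terms (λ m → rowDegree i m ≡ longer (toℕ i) Js) (bideterminant Js)
  bideterminant-rowDegree i {[]}     []       = Row.degree-one i ∷ []
  bideterminant-rowDegree i {J ∷ Js} (h ∷ hs) = Terms-* (λ {m} {m′} q q′ →
      trans (Row.degree-· i m m′) (cong₂ ℕ._+_ q q′))
    (minor-rowDegree i J h) (bideterminant-rowDegree i hs)

  wordMonomial : Vec (Fin n) r → Monomial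
  wordMonomial w = monomial λ i t → kronecker (toℕ (Vec.lookup w t)) (toℕ i)

  wordMonomial-⟦⟧ : ∀ w i t → wordMonomial w ⟦ i , t ⟧ ≡ kronecker (toℕ (Vec.lookup w t)) (toℕ i)
  wordMonomial-⟦⟧ w = monomial-⟦⟧ _

  wordMonomial-injective : ∀ w w′ → wordMonomial w ≡ wordMonomial w′ → w ≡ w′
  wordMonomial-injective w w′ eq = lookup-≗⇒≡ λ t → Fin.toℕ-injective (same t)
    where
    same : ∀ t → toℕ (Vec.lookup w t) ≡ toℕ (Vec.lookup w′ t)
    same t = kronecker-≡ (toℕ (Vec.lookup w t)) (toℕ b) λ z → case trans (sym z) (begin
      kronecker (toℕ (Vec.lookup w t)) (toℕ b)   ≡⟨ wordMonomial-⟦⟧ w b t ⟨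
      wordMonomial w ⟦ b , t ⟧                   ≡⟨ cong (_⟦ b , t ⟧) eq ⟩
      wordMonomial w′ ⟦ b , t ⟧                  ≡⟨ wordMonomial-⟦⟧ w′ b t ⟩
      kronecker (toℕ b) (toℕ b)                  ≡⟨ kronecker-refl (toℕ b) ⟩
      1                                          ∎) of λ ()
      where
      open ≡-Reasoning
      b = Vec.lookup w′ t

  -- The exponents in each column add up to 1, so exactly one of them is 1; its row is the letter.
  columnDegree-1⇒word : ∀ m → (∀ t → columnDegree t m ≡ 1) → ∃[ w ] wordMonomial w ≡ m
  columnDegree-1⇒word m h = w , monomial-ext λ i t →
    trans (wordMonomial-⟦⟧ w i t) (trans (cong (λ v → kronecker (toℕ v) (toℕ i)) (Vec.lookup∘tabulate (proj₁ ∘ letter) t)) (proj₂ (letter t) i))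
    where
    only : ∀ {k} (f : Fin k → ℕ) → sumℕ f ≡ 1 → Σ (Fin k) λ i → ∀ i′ → kronecker (toℕ i) (toℕ i′) ≡ f i′
    only {suc k} f eq with f zero in f0
    ... | suc zero = zero , λ { zero → sym f0 ; (suc i′) → sym (zero′ (f ∘ suc) (ℕ.suc-injective eq) i′) }
      where
      zero′ : ∀ {k} (f : Fin k → ℕ) → sumℕ f ≡ 0 → ∀ i → f i ≡ 0
      zero′ f eq zero    = ℕ.m+n≡0⇒m≡0 (f zero) eq
      zero′ f eq (suc i) = zero′ (f ∘ suc) (ℕ.m+n≡0⇒n≡0 (f zero) eq) i
    ... | zero = let i , g = only (f ∘ suc) eq in suc i , λ { zero → sym f0 ; (suc i′) → g i′ }
    letter : ∀ t → Σ (Fin n) λ i → ∀ i′ → kronecker (toℕ i) (toℕ i′) ≡ m ⟦ i′ , t ⟧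
    letter t = only (λ i → m ⟦ i , t ⟧) (trans (sumℕ-cong λ i →
      sym (trans (sumℕ-cong λ j → ℕ.*-comm (kronecker (toℕ t) (toℕ j)) (m ⟦ i , j ⟧)) (sumℕ-kronecker t (λ j → m ⟦ i , j ⟧)))) (h t))
    w : Vec (Fin n) r
    w = Vec.tabulate (proj₁ ∘ letter)

  rowDegree-word : ∀ i w → rowDegree i (wordMonomial w) ≡ occurrences i (Vec.toList w)
  rowDegree-word i w = trans (sumℕ-cong λ i′ → trans (sumℕ-cong λ t → cong (kronecker (toℕ i) (toℕ i′) ℕ.*_) (wordMonomial-⟦⟧ w i′ t))
      (sumℕ-*ˡ (kronecker (toℕ i) (toℕ i′)) (λ t → kronecker (toℕ (Vec.lookup w t)) (toℕ i′))))
    (trans (sumℕ-cong λ i′ → ℕ.*-comm (kronecker (toℕ i) (toℕ i′)) (count i′))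
      (trans (sumℕ-kronecker i count) (letters w)))
    where
    count : Fin n → ℕ
    count i′ = sumℕ λ t → kronecker (toℕ (Vec.lookup w t)) (toℕ i′)
    sumℕ-*ˡ : ∀ {k} c (f : Fin k → ℕ) → sumℕ (λ j → c ℕ.* f j) ≡ c ℕ.* sumℕ f
    sumℕ-*ˡ c f = trans (sumℕ-cong λ j → ℕ.*-comm c (f j)) (trans (sumℕ-*ʳ f c) (ℕ.*-comm _ c))
    letters : ∀ {k} (w : Vec (Fin n) k) → sumℕ (λ t → kronecker (toℕ (Vec.lookup w t)) (toℕ i)) ≡ occurrences i (Vec.toList w)
    letters []      = refl
    letters (v ∷ w) = cong₂ ℕ._+_ (kronecker-sym (toℕ v) (toℕ i)) (letters w)

-- The derivations E_i on polynomials

module Lowering (R : CommutativeRing 0ℓ 0ℓ) (n r : ℕ) (i i′ : Fin n) (i′≡1+i : toℕ i′ ≡ suc (toℕ i)) where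

  private module R = CommutativeRing R
  open Homogeneity R n r
  open RingProperties R.ring using (-‿distribʳ-*)
  private module ΣR = DeterminantProperties R
  open SemiringMult R.semiring using (×-homo-+) renaming (_×_ to _⊠_)
  open import Relation.Binary.Reasoning.Setoid R.setoid
  open ΣR using (∑; ∑-cong; ∑-0; ∑-+; ∑-*)

  ι : ℕ → R.Carrier
  ι k = k ⊠ R.1#

  -- The truncated subtraction loses information only if the exponent of x_{i′,t} in `m` is 0; in
  -- `δ` and `δ*` this exponent is a factor of the term in which `shift t m` occurs.
  shift : Fin r → Monomial → Monomial
  shift t m = monomial λ a b → (m ⟦ a , b ⟧ ℕ.∸ cell (toℕ i′) t ⟦ a , b ⟧) ℕ.+ cell (toℕ i) t ⟦ a , b ⟧

  δ* : (Monomial → R.Carrier) → Monomial → R.Carrier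
  δ* φ m = ∑ λ t → ι (m ⟦ i′ , t ⟧) R.* φ (shift t m)

  -- δ is the derivation ∑ₜ x i t ∂/∂(x i′ t), and δ* its transpose.
  δ : Polynomial → Polynomial
  δ = List.concatMap λ { (c , m) → List.tabulate λ t → ι (m ⟦ i′ , t ⟧) R.* c , shift t m }

  ⟪⟫-tabulate : ∀ φ {k} (f : Fin k → R.Carrier × Monomial) → ⟪ φ ⟫ (List.tabulate f) R.≈ ∑ (λ t → proj₁ (f t) R.* φ (proj₂ (f t)))
  ⟪⟫-tabulate φ {zero}  f = R.refl
  ⟪⟫-tabulate φ {suc k} f = R.+-congˡ (⟪⟫-tabulate φ (f ∘ suc))

  ⟪⟫-δ : ∀ φ p → ⟪ φ ⟫ (δ p) R.≈ ⟪ δ* φ ⟫ p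
  ⟪⟫-δ φ []            = R.refl
  ⟪⟫-δ φ ((c , m) ∷ p) = R.trans (⟪⟫-++ φ (List.tabulate f) (δ p)) (R.+-cong term (⟪⟫-δ φ p))
    where
    f : Fin r → R.Carrier × Monomial
    f t = ι (m ⟦ i′ , t ⟧) R.* c , shift t m
    term : ⟪ φ ⟫ (List.tabulate f) R.≈ c R.* δ* φ m
    term = R.trans (⟪⟫-tabulate φ f) (R.trans
      (∑-cong λ t → R.trans (R.*-congʳ {φ (shift t m)} (R.*-comm (ι (m ⟦ i′ , t ⟧)) c)) (R.*-assoc c (ι (m ⟦ i′ , t ⟧)) (φ (shift t m))))
      (R.sym (∑-* c λ t → ι (m ⟦ i′ , t ⟧) R.* φ (shift t m))))

  ⟪⟫-∑ : ∀ {k} (φ : Fin k → Monomial → R.Carrier) p → ⟪ (λ m → ∑ λ t → φ t m) ⟫ p R.≈ ∑ (λ t → ⟪ φ t ⟫ p)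
  ⟪⟫-∑ {zero}  φ p = ⟪⟫-0 p
  ⟪⟫-∑ {suc k} φ p = R.trans (⟪⟫-+ (φ zero) (λ m → ∑ λ t → φ (suc t) m) p) (R.+-congˡ (⟪⟫-∑ (φ ∘ suc) p))

  shift-· : ∀ t m m′ → m ⟦ i′ , t ⟧ ≢ 0 → shift t (m · m′) ≡ shift t m · m′
  shift-· t m m′ nz = monomial-ext λ a b →
    trans (monomial-⟦⟧ _ a b) (trans (cong (λ s → (s ℕ.∸ cell (toℕ i′) t ⟦ a , b ⟧) ℕ.+ cell (toℕ i) t ⟦ a , b ⟧) (·-⟦⟧ m m′ a b))
      (trans (arith (m ⟦ a , b ⟧) (m′ ⟦ a , b ⟧) (cell (toℕ i′) t ⟦ a , b ⟧) (cell (toℕ i) t ⟦ a , b ⟧) (cell≤ a b))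
        (sym (trans (·-⟦⟧ (shift t m) m′ a b) (cong (ℕ._+ m′ ⟦ a , b ⟧) (monomial-⟦⟧ _ a b))))))
    where
    cell≤ : ∀ a b → cell (toℕ i′) t ⟦ a , b ⟧ ≤ m ⟦ a , b ⟧
    cell≤ a b = subst (_≤ m ⟦ a , b ⟧) (sym (cell-⟦⟧ (toℕ i′) t a b)) (go (i′ Fin.≟ a) (t Fin.≟ b))
      where
      go : Dec (i′ ≡ a) → Dec (t ≡ b) → kronecker (toℕ i′) (toℕ a) ℕ.* kronecker (toℕ t) (toℕ b) ≤ m ⟦ a , b ⟧
      go (yes refl) (yes refl) = ℕ.≤-trans (ℕ.≤-reflexive (cong₂ ℕ._*_ (kronecker-refl (toℕ a)) (kronecker-refl (toℕ b)))) (ℕ.n≢0⇒n>0 nz)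
      go (no neq)   _          = ℕ.≤-trans (ℕ.≤-reflexive (cong (ℕ._* kronecker (toℕ t) (toℕ b)) (kronecker-≢ (neq ∘ Fin.toℕ-injective)))) z≤n
      go (yes refl) (no neq)   = ℕ.≤-trans (ℕ.≤-reflexive (trans
        (cong (kronecker (toℕ i′) (toℕ a) ℕ.*_) (kronecker-≢ (neq ∘ Fin.toℕ-injective)))
        (ℕ.*-zeroʳ (kronecker (toℕ i′) (toℕ a))))) z≤n
    arith : ∀ x y c d → c ≤ x → ((x ℕ.+ y) ℕ.∸ c) ℕ.+ d ≡ ((x ℕ.∸ c) ℕ.+ d) ℕ.+ y
    arith x y c d c≤x = trans (cong (ℕ._+ d) (trans (cong (ℕ._∸ c) (ℕ.+-comm x y)) (trans (ℕ.+-∸-assoc y c≤x) (ℕ.+-comm y _))))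
      (trans (ℕ.+-assoc (x ℕ.∸ c) y d) (trans (cong (x ℕ.∸ c ℕ.+_) (ℕ.+-comm y d)) (sym (ℕ.+-assoc (x ℕ.∸ c) d y))))

  -- The Leibniz rule on the transposed side: the exponent of a product is a sum of two exponents,
  -- and each summand moves a variable inside its own factor.
  δ*-· : ∀ φ m m′ → δ* φ (m · m′) R.≈ (δ* (λ μ → φ (μ · m′)) m R.+ δ* (λ μ → φ (m · μ)) m′)
  δ*-· φ m m′ = R.trans (∑-cong leibniz)
    (∑-+ (λ t → ι (m ⟦ i′ , t ⟧) R.* φ (shift t m · m′)) (λ t → ι (m′ ⟦ i′ , t ⟧) R.* φ (m · shift t m′)))
    where
    -- `shift` passes to a factor only if that factor has a positive exponent; otherwise the scalar
    -- `ι` is 0.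
    scaled : ∀ k {μ μ′} → (k ≢ 0 → μ ≡ μ′) → ι k R.* φ μ R.≈ ι k R.* φ μ′
    scaled zero    h = R.trans (R.zeroˡ _) (R.sym (R.zeroˡ _))
    scaled (suc k) h = R.*-congˡ (R.reflexive (cong φ (h λ ())))
    leibniz : ∀ t → ι ((m · m′) ⟦ i′ , t ⟧) R.* φ (shift t (m · m′)) R.≈
      ι (m ⟦ i′ , t ⟧) R.* φ (shift t m · m′) R.+ ι (m′ ⟦ i′ , t ⟧) R.* φ (m · shift t m′)
    leibniz t = begin
      ι ((m · m′) ⟦ i′ , t ⟧) R.* φ μ                             ≈⟨ R.*-congʳ (R.reflexive (cong ι (·-⟦⟧ m m′ i′ t))) ⟩
      ι (m ⟦ i′ , t ⟧ ℕ.+ m′ ⟦ i′ , t ⟧) R.* φ μ                  ≈⟨ R.*-congʳ (×-homo-+ R.1# (m ⟦ i′ , t ⟧) _) ⟩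
      (ι (m ⟦ i′ , t ⟧) R.+ ι (m′ ⟦ i′ , t ⟧)) R.* φ μ            ≈⟨ R.distribʳ _ _ _ ⟩
      ι (m ⟦ i′ , t ⟧) R.* φ μ R.+ ι (m′ ⟦ i′ , t ⟧) R.* φ μ      ≈⟨ R.+-cong (scaled (m ⟦ i′ , t ⟧) (shift-· t m m′)) (scaled (m′ ⟦ i′ , t ⟧) right) ⟩
      _                                                           ∎
      where
      μ = shift t (m · m′)
      right : m′ ⟦ i′ , t ⟧ ≢ 0 → shift t (m · m′) ≡ m · shift t m′
      right nz = trans (cong (shift t) (·-comm m m′)) (trans (shift-· t m′ m nz) (·-comm (shift t m′) m))

  δ*-⟪⟫ : ∀ (φ : Monomial → Monomial → R.Carrier) q m → δ* (λ μ → ⟪ φ μ ⟫ q) m R.≈ ⟪ (λ m′ → δ* (λ μ → φ μ m′) m) ⟫ q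
  δ*-⟪⟫ φ q m = R.trans (∑-cong λ t → R.sym (⟪⟫-* (φ (shift t m)) (ι (m ⟦ i′ , t ⟧)) q))
    (R.sym (⟪⟫-∑ (λ t m′ → ι (m ⟦ i′ , t ⟧) R.* φ (shift t m) m′) q))

  δ-isDerivation : DeterminantProperties.IsDerivation polynomialCommutativeRing δ
  δ-isDerivation = record
    { δ-cong = λ {p} {q} p≈q → ⟪⟫-ext {δ p} {δ q} λ φ →
        R.trans (⟪⟫-δ φ p) (R.trans (⟪⟫-resp (δ* φ) p q p≈q) (R.sym (⟪⟫-δ φ q)))
    ; δ-0 = λ m → R.refl
    ; δ-1 = ⟪⟫-ext {δ 1#} {0#} λ φ → R.trans (⟪⟫-δ φ 1#) (R.trans (R.+-identityʳ _) (R.trans (R.*-identityˡ _)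
        (∑-0 λ t → R.trans (R.*-congʳ (R.reflexive (cong ι (one-⟦⟧ i′ t)))) (R.zeroˡ _))))
    ; δ-+ = λ p q → ⟪⟫-ext {δ (p + q)} {δ p + δ q} λ φ → R.trans (⟪⟫-δ φ (p + q)) (R.trans (⟪⟫-++ (δ* φ) p q)
        (R.trans (R.+-cong (R.sym (⟪⟫-δ φ p)) (R.sym (⟪⟫-δ φ q))) (R.sym (⟪⟫-++ φ (δ p) (δ q)))))
    ; δ-neg = λ p → ⟪⟫-ext {δ (- p)} { - δ p} λ φ → R.trans (⟪⟫-δ φ (- p)) (R.trans (⟪⟫-neg (δ* φ) p)
        (R.trans (R.-‿cong (R.sym (⟪⟫-δ φ p))) (R.sym (⟪⟫-neg φ (δ p)))))
    ; δ-* = λ p q → ⟪⟫-ext {δ (p * q)} {δ p * q + p * δ q} λ φ → begin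
        ⟪ φ ⟫ (δ (p * q))
          ≈⟨ ⟪⟫-δ φ (p * q) ⟩
        ⟪ δ* φ ⟫ (p * q)
          ≈⟨ ⟪⟫-product (δ* φ) p q ⟩
        ⟪ (λ m → ⟪ (λ m′ → δ* φ (m · m′)) ⟫ q) ⟫ p
          ≈⟨ ⟪⟫-cong (λ m → ⟪⟫-cong (δ*-· φ m) q) p ⟩
        ⟪ (λ m → ⟪ (λ m′ → δ* (λ μ → φ (μ · m′)) m R.+ δ* (λ μ → φ (m · μ)) m′) ⟫ q) ⟫ p
          ≈⟨ ⟪⟫-cong (λ m → ⟪⟫-+ (λ m′ → δ* (λ μ → φ (μ · m′)) m) (λ m′ → δ* (λ μ → φ (m · μ)) m′) q) p ⟩
        ⟪ (λ m → ⟪ (λ m′ → δ* (λ μ → φ (μ · m′)) m) ⟫ q R.+ ⟪ δ* (λ μ → φ (m · μ)) ⟫ q) ⟫ p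
          ≈⟨ ⟪⟫-+ (λ m → ⟪ (λ m′ → δ* (λ μ → φ (μ · m′)) m) ⟫ q) (λ m → ⟪ δ* (λ μ → φ (m · μ)) ⟫ q) p ⟩
        ⟪ (λ m → ⟪ (λ m′ → δ* (λ μ → φ (μ · m′)) m) ⟫ q) ⟫ p R.+ ⟪ (λ m → ⟪ δ* (λ μ → φ (m · μ)) ⟫ q) ⟫ p
          ≈⟨ R.+-cong
               (R.trans (⟪⟫-cong (λ m → R.sym (δ*-⟪⟫ (λ μ m′ → φ (μ · m′)) q m)) p)
                 (R.trans (R.sym (⟪⟫-δ (λ μ → ⟪ (λ m′ → φ (μ · m′)) ⟫ q) p)) (R.sym (⟪⟫-product φ (δ p) q))))
               (R.trans (⟪⟫-cong (λ m → R.sym (⟪⟫-δ (λ μ → φ (m · μ)) q)) p) (R.sym (⟪⟫-product φ p (δ q)))) ⟩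
        ⟪ φ ⟫ (δ p * q) R.+ ⟪ φ ⟫ (p * δ q)
          ≈⟨ ⟪⟫-++ φ (δ p * q) (p * δ q) ⟨
        ⟪ φ ⟫ (δ p * q + p * δ q) ∎
    }

  open DeterminantProperties.IsDerivation δ-isDerivation using (δ-1; δ-*; rowDet-killed)

  private
    δ-X-killed : ∀ a v → a ≢ suc (toℕ i) → δ (X a v) ≈ 0#
    δ-X-killed a v neq = ⟪⟫-ext {δ (X a v)} {0#} λ φ → R.trans (⟪⟫-δ φ (X a v)) (R.trans (R.+-identityʳ _) (R.trans (R.*-identityˡ _)
      (∑-0 λ t → R.trans (R.*-congʳ (R.reflexive (cong ι (trans (cell-⟦⟧ a v i′ t)
        (cong (ℕ._* kronecker (toℕ v) (toℕ t)) (kronecker-≢ (λ eq → neq (trans eq i′≡1+i)))))))) (R.zeroˡ _))))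

    ∑-only : ∀ {k} (f : Fin k → R.Carrier) v → (∀ t → t ≢ v → f t R.≈ R.0#) → ∑ f R.≈ f v
    ∑-only f zero    h = R.trans (R.+-congˡ (∑-0 λ t → h (suc t) λ ())) (R.+-identityʳ _)
    ∑-only f (suc v) h = R.trans (R.+-cong (h zero λ ()) (∑-only (f ∘ suc) v λ t neq → h (suc t) (neq ∘ Fin.suc-injective))) (R.+-identityˡ _)

    δ-X : ∀ v → δ (X (suc (toℕ i)) v) ≈ X (toℕ i) v
    δ-X v = ⟪⟫-ext {δ (X (suc (toℕ i)) v)} {X (toℕ i) v} λ φ → R.trans (⟪⟫-δ φ (X (suc (toℕ i)) v)) (R.+-congʳ (R.*-congˡ
      (R.trans (∑-only (λ t → ι (cell (suc (toℕ i)) v ⟦ i′ , t ⟧) R.* φ (shift t (cell (suc (toℕ i)) v))) v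
        λ t neq → R.trans (R.*-congʳ (R.reflexive (cong ι (trans (cell-⟦⟧ (suc (toℕ i)) v i′ t)
          (trans (cong (kronecker (suc (toℕ i)) (toℕ i′) ℕ.*_) (kronecker-≢ (λ eq → neq (sym (Fin.toℕ-injective eq))))) (ℕ.*-zeroʳ (kronecker (suc (toℕ i)) (toℕ i′)))))))) (R.zeroˡ _))
        (R.trans (R.*-cong (R.trans (R.reflexive (cong ι (trans (cell-⟦⟧ (suc (toℕ i)) v i′ v)
            (cong₂ ℕ._*_ (trans (cong (kronecker (suc (toℕ i))) i′≡1+i) (kronecker-refl (toℕ i))) (kronecker-refl (toℕ v)))))) (R.+-identityʳ _))
          (R.reflexive (cong φ moved))) (R.*-identityˡ _)))))
      where
      moved : shift v (cell (suc (toℕ i)) v) ≡ cell (toℕ i) v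
      moved = monomial-ext λ a b → trans (monomial-⟦⟧ _ a b) (cong (ℕ._+ cell (toℕ i) v ⟦ a , b ⟧)
        (trans (cong (λ s → cell s v ⟦ a , b ⟧ ℕ.∸ cell (toℕ i′) v ⟦ a , b ⟧) (sym i′≡1+i)) (ℕ.n∸n≡0 (cell (toℕ i′) v ⟦ a , b ⟧))))

  minor-killed : ∀ J → δ (minor J) ≈ 0#
  minor-killed J = rowDet-killed (toℕ i) X (lookup J) δ-X δ-X-killed

  private module P = CommutativeRing polynomialCommutativeRing

  bideterminant-killed : ∀ Js → δ (bideterminant Js) ≈ 0#
  bideterminant-killed []       = δ-1
  bideterminant-killed (J ∷ Js) m = R.trans (δ-* (minor J) (bideterminant Js) m) (R.trans
    (P.+-cong {δ (minor J) * bideterminant Js} {0#} {minor J * δ (bideterminant Js)} {0#}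
      (λ m → R.trans (P.*-cong {δ (minor J)} {0#} {bideterminant Js} {bideterminant Js} (minor-killed J) (≈-refl (bideterminant Js)) m) (P.zeroˡ (bideterminant Js) m))
      (λ m → R.trans (P.*-cong {minor J} {minor J} {δ (bideterminant Js)} {0#} (≈-refl (minor J)) (bideterminant-killed Js) m) (P.zeroʳ (minor J) m)) m)
    R.refl)

-- Raising operators on functions of words

TorsionFree : CommutativeRing 0ℓ 0ℓ → Set
TorsionFree R = ∀ k x → suc k ⊠ x ≈ 0# → x ≈ 0#
  where
  open CommutativeRing R
  open SemiringMult semiring using () renaming (_×_ to _⊠_)

-- Base n + 2 rather than n, so that the place values strictly increase for every n.
base : ∀ {n k} → Vec (Fin n) k → ℕ
base     []      = 0
base {n} (x ∷ u) = toℕ x ℕ.+ (2 ℕ.+ n) ℕ.* base u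

-- First letters are low digits, and each digit is smaller than the base, so no prefix can make up
-- for a larger suffix.
base-++-< : ∀ {n k l} (p q : Vec (Fin n) k) {s s′ : Vec (Fin n) l} → base s < base s′ → base (p Vec.++ s) < base (q Vec.++ s′)
base-++-<     []      []      lt = lt
base-++-< {n} (x ∷ p) (y ∷ q) {s} {s′} lt = begin-strict
  toℕ x ℕ.+ B ℕ.* base (p Vec.++ s)    <⟨ ℕ.+-monoˡ-< _ (ℕ.<-≤-trans (Fin.toℕ<n x) (ℕ.m≤n+m n 2)) ⟩
  B ℕ.+ B ℕ.* base (p Vec.++ s)        ≡⟨ ℕ.*-suc B _ ⟨
  B ℕ.* suc (base (p Vec.++ s))        ≤⟨ ℕ.*-monoʳ-≤ B (base-++-< p q {s} {s′} lt) ⟩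
  B ℕ.* base (q Vec.++ s′)             ≤⟨ ℕ.m≤n+m _ (toℕ y) ⟩
  toℕ y ℕ.+ B ℕ.* base (q Vec.++ s′)   ∎
  where
  open ℕ.≤-Reasoning
  B = 2 ℕ.+ n

base-injective : ∀ {n k} (u v : Vec (Fin n) k) → base u ≡ base v → u ≡ v
base-injective     []      []      eq = refl
base-injective {n} (x ∷ u) (y ∷ v) eq with ℕ.<-cmp (base u) (base v)
... | tri< lt _ _ = ⊥-elim (ℕ.<⇒≢ (base-++-< (x ∷ []) (y ∷ []) {u} {v} lt) eq)
... | tri> _ _ gt = ⊥-elim (ℕ.<⇒≢ (base-++-< (y ∷ []) (x ∷ []) {v} {u} gt) (sym eq))
... | tri≈ _ e _ with base-injective u v e
...   | refl = cong (_∷ u) (Fin.toℕ-injective (ℕ.+-cancelʳ-≡ _ (toℕ x) (toℕ y) eq))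

base-bounded : ∀ {n k} (u : Vec (Fin n) k) → base u < (2 ℕ.+ n) ℕ.^ k
base-bounded     []      = s≤s z≤n
base-bounded {n} {suc k} (x ∷ u) = begin-strict
  toℕ x ℕ.+ B ℕ.* base u    <⟨ ℕ.+-monoˡ-< _ (ℕ.<-≤-trans (Fin.toℕ<n x) (ℕ.m≤n+m n 2)) ⟩
  B ℕ.+ B ℕ.* base u        ≡⟨ ℕ.*-suc B _ ⟨
  B ℕ.* suc (base u)        ≤⟨ ℕ.*-monoʳ-≤ B (base-bounded u) ⟩
  B ℕ.* (B ℕ.^ k)           ∎
  where
  open ℕ.≤-Reasoning
  B = 2 ℕ.+ n

letterCount : ∀ {n k} → Fin n → Vec (Fin n) k → ℕ
letterCount a u = occurrences a (Vec.toList u)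

module Raising (R : CommutativeRing 0ℓ 0ℓ) (torsionFree : TorsionFree R) (n : ℕ)
               (i i′ : Fin n) (i<i′ : toℕ i < toℕ i′) where

  open CommutativeRing R hiding (zero) renaming (refl to ≈-refl; sym to ≈-sym; trans to ≈-trans)
  open SemiringMult semiring using (×-congʳ) renaming (_×_ to _⊠_)
  open CommutativeSemigroupProperties +-commutativeSemigroup using (interchange)
  open import Relation.Binary.Reasoning.Setoid setoid

  Word : ℕ → Set
  Word = Vec (Fin n)

  -- E g w is the sum of g over all words obtained from w by raising one letter i to i′.
  E : ∀ {k} → (Word k → Carrier) → Word k → Carrier
  E g []      = 0#
  E g (x ∷ u) = (if does (x Fin.≟ i) then g (i′ ∷ u) else 0#) + E (g ∘ (x ∷_)) u

  E-cong : ∀ {k} {g h : Word k → Carrier} → (∀ u → g u ≈ h u) → ∀ u → E g u ≈ E h u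
  E-cong eq []      = ≈-refl
  E-cong eq (x ∷ u) with does (x Fin.≟ i)
  ... | true  = +-cong (eq _) (E-cong (eq ∘ (x ∷_)) u)
  ... | false = +-congˡ (E-cong (eq ∘ (x ∷_)) u)

  E-0 : ∀ {k} (u : Word k) → E (λ _ → 0#) u ≈ 0#
  E-0 []      = ≈-refl
  E-0 (x ∷ u) with does (x Fin.≟ i)
  ... | true  = ≈-trans (+-identityˡ _) (E-0 u)
  ... | false = ≈-trans (+-identityˡ _) (E-0 u)

  E-+ : ∀ {k} (g h : Word k → Carrier) u → E (λ u → g u + h u) u ≈ E g u + E h u
  E-+ g h []      = ≈-sym (+-identityˡ _)
  E-+ g h (x ∷ u) with does (x Fin.≟ i)
  ... | true  = ≈-trans (+-congˡ (E-+ (g ∘ (x ∷_)) (h ∘ (x ∷_)) u)) (interchange _ _ _ _)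
  ... | false = ≈-trans (+-cong (≈-sym (+-identityˡ _)) (E-+ (g ∘ (x ∷_)) (h ∘ (x ∷_)) u)) (interchange _ _ _ _)

  E-⊠ : ∀ {k} m (g : Word k → Carrier) u → E (λ u → m ⊠ g u) u ≈ m ⊠ E g u
  E-⊠ zero    g u = E-0 u
  E-⊠ (suc m) g u = ≈-trans (E-+ g (λ u → m ⊠ g u) u) (+-congˡ (E-⊠ m g u))

  E^ : ℕ → ∀ {k} → (Word k → Carrier) → Word k → Carrier
  E^ zero    g = g
  E^ (suc j) g = E (E^ j g)

  private
    i≢i′ : i ≢ i′
    i≢i′ refl = ℕ.<-irrefl refl i<i′

    E-other : ∀ {k} {x} → x ≢ i → ∀ (g : Word (suc k) → Carrier) u → E g (x ∷ u) ≈ E (g ∘ (x ∷_)) u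
    E-other {x = x} x≢i g u with x Fin.≟ i
    ... | yes x≡i = ⊥-elim (x≢i x≡i)
    ... | no _    = +-identityˡ _

    E-i : ∀ {k} (g : Word (suc k) → Carrier) u → E g (i ∷ u) ≈ g (i′ ∷ u) + E (g ∘ (i ∷_)) u
    E-i g u with i Fin.≟ i
    ... | yes _  = ≈-refl
    ... | no neq = ⊥-elim (neq refl)

  E^-other : ∀ j {k} {x} → x ≢ i → ∀ (g : Word (suc k) → Carrier) u → E^ j g (x ∷ u) ≈ E^ j (g ∘ (x ∷_)) u
  E^-other zero    x≢i g u = ≈-refl
  E^-other (suc j) x≢i g u = ≈-trans (E-other x≢i (E^ j g) u) (E-cong (E^-other j x≢i g) u)

  -- `E` acts on the first letter and on the rest of the word, and these two actions commute. The
  -- first letter can be raised only once, as `i′` is not raised further, so the binomial formula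
  -- has just two terms.
  E^-i : ∀ j {k} (g : Word (suc k) → Carrier) u →
    E^ (suc j) g (i ∷ u) ≈ E^ (suc j) (g ∘ (i ∷_)) u + suc j ⊠ E^ j (g ∘ (i′ ∷_)) u
  E^-i zero    g u = ≈-trans (E-i g u) (≈-trans (+-comm _ _) (+-congˡ (≈-sym (+-identityʳ _))))
  E^-i (suc j) g u = begin
    E (E^ (suc j) g) (i ∷ u)
      ≈⟨ E-i (E^ (suc j) g) u ⟩
    E^ (suc j) g (i′ ∷ u) + E (E^ (suc j) g ∘ (i ∷_)) u
      ≈⟨ +-cong (E^-other (suc j) (i≢i′ ∘ sym) g u)
           (≈-trans (E-cong (E^-i j g) u) (E-+ (E^ (suc j) (g ∘ (i ∷_))) (λ u → suc j ⊠ E^ j (g ∘ (i′ ∷_)) u) u)) ⟩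
    a + (b + E (λ u → suc j ⊠ E^ j (g ∘ (i′ ∷_)) u) u)
      ≈⟨ +-congˡ (+-congˡ (E-⊠ (suc j) (E^ j (g ∘ (i′ ∷_))) u)) ⟩
    a + (b + suc j ⊠ a)
      ≈⟨ +-comm a _ ⟩
    (b + suc j ⊠ a) + a
      ≈⟨ +-assoc b _ a ⟩
    b + (suc j ⊠ a + a)
      ≈⟨ +-congˡ (+-comm _ a) ⟩
    b + suc (suc j) ⊠ a ∎
    where
    a = E^ (suc j) (g ∘ (i′ ∷_)) u
    b = E^ (suc (suc j)) (g ∘ (i ∷_)) u

  -- p − q is the weight #i − #i′ of the word u.
  Weight : ℕ → ℕ → ∀ {k} → Word k → Set
  Weight p q u = letterCount i′ u ℕ.+ p ≡ q ℕ.+ letterCount i u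

  private
    count-i : ∀ {k} (u : Word k) → letterCount i (i ∷ u) ≡ suc (letterCount i u)
    count-i u = cong (ℕ._+ letterCount i u) (kronecker-refl (toℕ i))

    count-i′ : ∀ {k} (u : Word k) → letterCount i′ (i′ ∷ u) ≡ suc (letterCount i′ u)
    count-i′ u = cong (ℕ._+ letterCount i′ u) (kronecker-refl (toℕ i′))

    count-≢ : ∀ {k a x} → x ≢ a → ∀ (u : Word k) → letterCount a (x ∷ u) ≡ letterCount a u
    count-≢ {a = a} neq u = cong (ℕ._+ letterCount a u) (kronecker-≢ (neq ∘ sym ∘ Fin.toℕ-injective))

    weight-i : ∀ p q {k} (u : Word k) → Weight p (suc q) u → Weight p q (i ∷ u)
    weight-i p q u h = trans (cong (ℕ._+ p) (count-≢ i≢i′ u)) (trans h (trans (sym (ℕ.+-suc q _)) (cong (q ℕ.+_) (sym (count-i u)))))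

    weight-i⁻ : ∀ p q {k} (u : Word k) → Weight p q (i ∷ u) → Weight p (suc q) u
    weight-i⁻ p q u h = trans (cong (ℕ._+ p) (sym (count-≢ i≢i′ u))) (trans h (trans (cong (q ℕ.+_) (count-i u)) (ℕ.+-suc q _)))

    weight-i′ : ∀ p q {k} (u : Word k) → Weight (suc p) q u → Weight p q (i′ ∷ u)
    weight-i′ p q u h = trans (cong (ℕ._+ p) (count-i′ u)) (trans (sym (ℕ.+-suc _ p)) (trans h (cong (q ℕ.+_) (sym (count-≢ (i≢i′ ∘ sym) u)))))

    weight-i′⁻ : ∀ p q {k} (u : Word k) → Weight p q (i′ ∷ u) → Weight (suc p) q u
    weight-i′⁻ p q u h = trans (ℕ.+-suc _ p) (trans (cong (ℕ._+ p) (sym (count-i′ u))) (trans h (cong (q ℕ.+_) (count-≢ (i≢i′ ∘ sym) u))))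

    weight-other : ∀ p q {k x} → x ≢ i → x ≢ i′ → (u : Word k) → Weight p q u → Weight p q (x ∷ u)
    weight-other p q x≢i x≢i′ u h = trans (cong (ℕ._+ p) (count-≢ x≢i′ u)) (trans h (cong (q ℕ.+_) (sym (count-≢ x≢i u))))

    weight-other⁻ : ∀ p q {k x} → x ≢ i → x ≢ i′ → (u : Word k) → Weight p q (x ∷ u) → Weight p q u
    weight-other⁻ p q x≢i x≢i′ u h = trans (cong (ℕ._+ p) (sym (count-≢ x≢i′ u))) (trans h (cong (q ℕ.+_) (count-≢ x≢i u)))

    weight-suc : ∀ p q {k} (u : Word k) → Weight p q u → Weight (suc p) (suc q) u
    weight-suc p q u h = trans (ℕ.+-suc _ p) (cong suc h)

    weight-pred : ∀ p q {k} (u : Word k) → Weight (suc p) (suc q) u → Weight p q u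
    weight-pred p q u h = ℕ.suc-injective (trans (sym (ℕ.+-suc _ p)) h)

  Vanishes : ∀ {k} → ℕ → ℕ → (Word k → Carrier) → Set
  Vanishes p q g = ∀ u → Weight p q u → g u ≈ 0#

  -- Raising a letter lowers the weight of a word by 2, so `E g` at weight p + 2 - q only sees `g`
  -- at weight p - q.
  E-vanishes : ∀ {k} p q {g : Word k → Carrier} → Vanishes p q g → Vanishes (2 ℕ.+ p) q (E g)
  E-vanishes p q h []      _  = ≈-refl
  E-vanishes p q {g} h (x ∷ u) wt with x Fin.≟ i
  ... | yes refl = ≈-trans (+-cong (h (i′ ∷ u) (weight-i′ p q u (weight-pred (suc p) q u (weight-i⁻ (2 ℕ.+ p) q u wt))))
                     (E-vanishes p (suc q) (λ u wt → h (i ∷ u) (weight-i p q u wt)) u (weight-i⁻ (2 ℕ.+ p) q u wt)))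
                     (+-identityˡ _)
  ... | no x≢i with x Fin.≟ i′
  ...   | yes refl = ≈-trans (+-identityˡ _) (E-vanishes (suc p) q (λ u wt → h (i′ ∷ u) (weight-i′ p q u wt)) u
                       (weight-i′⁻ (2 ℕ.+ p) q u wt))
  ...   | no x≢i′ = ≈-trans (+-identityˡ _) (E-vanishes p q (λ u wt → h (x ∷ u) (weight-other p q x≢i x≢i′ u wt)) u
                      (weight-other⁻ (2 ℕ.+ p) q x≢i x≢i′ u wt))

  -- Weight -(j + q) moves to j - q after `j` applications of `E`. The induction needs an arbitrary
  -- starting weight, which is carried by `go`.
  E^-vanishes : ∀ {k} j q {g : Word k → Carrier} → Vanishes 0 (j ℕ.+ q) g → Vanishes j q (E^ j g)
  E^-vanishes j q {g} h u wt = go j 0 (j ℕ.+ q) h u (shifted j 0 q u (subst (λ p → Weight p q u) (sym (ℕ.+-identityʳ j)) wt))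
    where
    go : ∀ {k} j p q {g : Word k → Carrier} → Vanishes p q g → Vanishes (j ℕ.+ (j ℕ.+ p)) q (E^ j g)
    go zero    p q h = h
    go (suc j) p q {g} h = subst (λ s → Vanishes s q (E (E^ j g))) (cong suc (sym (ℕ.+-suc j (j ℕ.+ p))))
      (E-vanishes (j ℕ.+ (j ℕ.+ p)) q (go j p q h))
    shifted : ∀ j p q {k} (u : Word k) → Weight (j ℕ.+ p) q u → Weight (j ℕ.+ (j ℕ.+ p)) (j ℕ.+ q) u
    shifted zero    p q u wt = wt
    shifted (suc j) p q u wt = weight-suc (j ℕ.+ suc (j ℕ.+ p)) (j ℕ.+ q) u
      (subst (λ s → Weight (j ℕ.+ s) (j ℕ.+ q) u) (ℕ.+-suc j p)
        (shifted j (suc p) q u (subst (λ s → Weight s q u) (sym (ℕ.+-suc j p)) wt)))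

  -- In the language of sl₂: E^s is injective on weight −s.
  E^-injective : ∀ k s (g : Word k → Carrier) → Vanishes s 0 (E^ s g) → Vanishes 0 s g
  E^-injective zero    zero    g h []      wt = h [] refl
  E^-injective (suc k) zero    g h u       wt = h u wt
  E^-injective (suc k) (suc s) g h (x ∷ u) wt = finish (x Fin.≟ i) (x Fin.≟ i′)
    where
    multiple-0 : ∀ m {y} → y ≈ 0# → m ⊠ y ≈ 0#
    multiple-0 zero    y≈0 = ≈-refl
    multiple-0 (suc m) y≈0 = ≈-trans (+-cong y≈0 (multiple-0 m y≈0)) (+-identityˡ _)
    relation : Vanishes s 0 (λ u → E^ (suc s) (g ∘ (i ∷_)) u + suc s ⊠ E^ s (g ∘ (i′ ∷_)) u)
    relation u wt = ≈-trans (≈-sym (E^-i s g u)) (h (i ∷ u) (weight-i (suc s) 0 u (weight-suc s 0 u wt)))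
    -- One more `E` turns the second summand of `relation` into a multiple of `E^ (suc s)` applied
    -- to `g ∘ (i′ ∷_)`, which vanishes by `h` at words beginning with `i′`. Hence `g ∘ (i ∷_)`
    -- satisfies the induction hypothesis for s + 2.
    gᵢ : Vanishes 0 (2 ℕ.+ s) (g ∘ (i ∷_))
    gᵢ = E^-injective k (2 ℕ.+ s) (g ∘ (i ∷_)) λ u wt → begin
      E^ (2 ℕ.+ s) (g ∘ (i ∷_)) u
        ≈⟨ +-identityʳ _ ⟨
      E^ (2 ℕ.+ s) (g ∘ (i ∷_)) u + 0#
        ≈⟨ +-congˡ (multiple-0 (suc s) (≈-trans (≈-sym (E^-other (suc s) (i≢i′ ∘ sym) g u))
             (h (i′ ∷ u) (weight-i′ (suc s) 0 u wt)))) ⟨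
      E^ (2 ℕ.+ s) (g ∘ (i ∷_)) u + suc s ⊠ E^ (suc s) (g ∘ (i′ ∷_)) u
        ≈⟨ +-congˡ (E-⊠ (suc s) (E^ s (g ∘ (i′ ∷_))) u) ⟨
      E^ (2 ℕ.+ s) (g ∘ (i ∷_)) u + E (λ u → suc s ⊠ E^ s (g ∘ (i′ ∷_)) u) u
        ≈⟨ E-+ (E^ (suc s) (g ∘ (i ∷_))) (λ u → suc s ⊠ E^ s (g ∘ (i′ ∷_)) u) u ⟨
      E (λ u → E^ (suc s) (g ∘ (i ∷_)) u + suc s ⊠ E^ s (g ∘ (i′ ∷_)) u) u
        ≈⟨ E-vanishes s 0 relation u wt ⟩
      0# ∎
    -- Now the first summand of `relation` vanishes as well, and torsion-freeness removes the factor
    -- s + 1 from the second.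
    gᵢ′ : Vanishes 0 s (g ∘ (i′ ∷_))
    gᵢ′ = E^-injective k s (g ∘ (i′ ∷_)) λ u wt → torsionFree s _ (≈-trans (≈-sym (+-identityˡ _))
      (≈-trans (+-congʳ (≈-sym (E^-vanishes (suc s) 1 (subst (λ t → Vanishes 0 t (g ∘ (i ∷_))) (cong suc (ℕ.+-comm 1 s)) gᵢ) u (weight-suc s 0 u wt))))
        (relation u wt)))
    finish : Dec (x ≡ i) → Dec (x ≡ i′) → g (x ∷ u) ≈ 0#
    finish (yes refl) _          = gᵢ u (weight-i⁻ 0 (suc s) u wt)
    finish (no x≢i)   (yes refl) = gᵢ′ u (weight-pred 0 s u (weight-i′⁻ 0 (suc s) u wt))
    finish (no x≢i)   (no x≢i′)  = E^-injective k (suc s) (g ∘ (x ∷_))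
      (λ u wt → ≈-trans (≈-sym (E^-other (suc s) x≢i g u)) (h (x ∷ u) (weight-other (suc s) 0 x≢i x≢i′ u wt))) u
      (weight-other⁻ 0 (suc s) x≢i x≢i′ u wt)

  private
    E-++ : ∀ {k l} (f : Word (k ℕ.+ l) → Carrier) (u : Word k) (s : Word l) →
      E f (u Vec.++ s) ≈ E (λ u → f (u Vec.++ s)) u + E (λ s → f (u Vec.++ s)) s
    E-++ f []      s = ≈-sym (+-identityˡ _)
    E-++ f (x ∷ u) s = ≈-trans (+-congˡ (E-++ (f ∘ (x ∷_)) u s)) (≈-sym (+-assoc _ _ _))

    E-larger : ∀ {k} (g : Word k → Carrier) s → (∀ s′ → base s < base s′ → g s′ ≈ 0#) → E g s ≈ 0#
    E-larger g []      h = ≈-refl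
    E-larger g (x ∷ s) h with x Fin.≟ i
    ... | yes refl = ≈-trans (+-cong (h (i′ ∷ s) (ℕ.+-monoˡ-< _ i<i′)) (E-larger (g ∘ (x ∷_)) s λ s′ lt → h (x ∷ s′) (base-++-< (x ∷ []) (x ∷ []) {s} {s′} lt))) (+-identityˡ _)
    ... | no _     = ≈-trans (+-identityˡ _) (E-larger (g ∘ (x ∷_)) s λ s′ lt → h (x ∷ s′) (base-++-< (x ∷ []) (x ∷ []) {s} {s′} lt))

  -- The last hypothesis speaks of words above `p ++ s`, but is used for every prefix `u` of the
  -- same length as `p`: a word with a larger suffix lies above `p ++ s` whatever its prefix.
  unbalanced-vanishes : ∀ {k l} (f : Word (k ℕ.+ l) → Carrier) → (∀ w → E f w ≈ 0#) → (p : Word k) (s : Word l) →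
    letterCount i′ p ≡ suc (letterCount i p) →
    (∀ w → base (p Vec.++ s) < base w → f w ≈ 0#) → f (p Vec.++ s) ≈ 0#
  unbalanced-vanishes f Ef≈0 p s unbalanced larger =
    E^-injective _ 1 (λ u → f (u Vec.++ s)) (λ u _ → ≈-trans (≈-sym (+-identityʳ _))
        (≈-trans (+-congˡ (≈-sym (E-larger (λ s → f (u Vec.++ s)) s λ s′ lt → larger (u Vec.++ s′) (base-++-< p u {s} {s′} lt))))
          (≈-trans (≈-sym (E-++ f u s)) (Ef≈0 (u Vec.++ s)))))
      p (trans (ℕ.+-identityʳ _) unbalanced)

  open DeterminantProperties R using (∑)

  E-∑ : ∀ {k} (g : Word k → Carrier) w →
    E g w ≈ ∑ (λ t → if does (Vec.lookup w t Fin.≟ i) then g (w Vec.[ t ]≔ i′) else 0#)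
  E-∑ g []      = ≈-refl
  E-∑ g (x ∷ u) = +-congˡ (E-∑ (g ∘ (x ∷_)) u)

-- The derivation on polynomials and the raising operator on words agree

module LoweringWords (R : CommutativeRing 0ℓ 0ℓ) (torsionFree : TorsionFree R) (n r : ℕ)
                     (i i′ : Fin n) (i′≡1+i : toℕ i′ ≡ suc (toℕ i)) where

  private module R = CommutativeRing R
  open Homogeneity R n r
  open Lowering R n r i i′ i′≡1+i
  open Raising R torsionFree n i i′ (ℕ.≤-reflexive (sym i′≡1+i))
  open DeterminantProperties R using (∑; ∑-cong)

  private
    -- `shift` and the update of a letter are compared after multiplication by a variable: this
    -- clears the subtraction, and `·-cancelʳ` undoes the multiplication.
    shift-·-cell : ∀ t m → m ⟦ i′ , t ⟧ ≢ 0 → shift t m · cell (toℕ i′) t ≡ m · cell (toℕ i) t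
    shift-·-cell t m nz = trans (sym (shift-· t m (cell (toℕ i′) t) nz)) (monomial-ext λ a b →
      trans (monomial-⟦⟧ _ a b) (trans (cong (λ s → (s ℕ.∸ cell (toℕ i′) t ⟦ a , b ⟧) ℕ.+ cell (toℕ i) t ⟦ a , b ⟧) (·-⟦⟧ m (cell (toℕ i′) t) a b))
        (trans (cong (ℕ._+ cell (toℕ i) t ⟦ a , b ⟧) (ℕ.m+n∸n≡m (m ⟦ a , b ⟧) (cell (toℕ i′) t ⟦ a , b ⟧))) (sym (·-⟦⟧ m (cell (toℕ i) t) a b)))))

    ·-cancelʳ : ∀ m m′ c → m · c ≡ m′ · c → m ≡ m′
    ·-cancelʳ m m′ c eq = monomial-ext λ a b → ℕ.+-cancelʳ-≡ (c ⟦ a , b ⟧) _ _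
      (trans (sym (·-⟦⟧ m c a b)) (trans (cong (_⟦ a , b ⟧) eq) (·-⟦⟧ m′ c a b)))

    updated : ∀ (w : Word r) t → Vec.lookup w t ≡ i →
      wordMonomial (w Vec.[ t ]≔ i′) · cell (toℕ i) t ≡ wordMonomial w · cell (toℕ i′) t
    updated w t eq = monomial-ext λ a b → trans (entry (w Vec.[ t ]≔ i′) (toℕ i) a b)
        (trans (at (b Fin.≟ t) a) (sym (entry w (toℕ i′) a b)))
      where
      entry : ∀ w j a b → (wordMonomial w · cell j t) ⟦ a , b ⟧ ≡
        kronecker (toℕ (Vec.lookup w b)) (toℕ a) ℕ.+ kronecker j (toℕ a) ℕ.* kronecker (toℕ t) (toℕ b)
      entry w j a b = trans (·-⟦⟧ (wordMonomial w) (cell j t) a b) (cong₂ ℕ._+_ (wordMonomial-⟦⟧ w a b) (cell-⟦⟧ j t a b))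
      diagonal : ∀ j (a : Fin n) → kronecker j (toℕ a) ℕ.* kronecker (toℕ t) (toℕ t) ≡ kronecker j (toℕ a)
      diagonal j a = trans (cong (kronecker j (toℕ a) ℕ.*_) (kronecker-refl (toℕ t))) (ℕ.*-identityʳ _)
      off : ∀ j (a : Fin n) {b} → b ≢ t → kronecker j (toℕ a) ℕ.* kronecker (toℕ t) (toℕ b) ≡ 0
      off j a neq = trans (cong (kronecker j (toℕ a) ℕ.*_) (kronecker-≢ (neq ∘ sym ∘ Fin.toℕ-injective))) (ℕ.*-zeroʳ (kronecker j (toℕ a)))
      at : ∀ {b} → Dec (b ≡ t) → ∀ (a : Fin n) →
        kronecker (toℕ (Vec.lookup (w Vec.[ t ]≔ i′) b)) (toℕ a) ℕ.+ kronecker (toℕ i) (toℕ a) ℕ.* kronecker (toℕ t) (toℕ b) ≡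
        kronecker (toℕ (Vec.lookup w b)) (toℕ a) ℕ.+ kronecker (toℕ i′) (toℕ a) ℕ.* kronecker (toℕ t) (toℕ b)
      at (yes refl) a = trans
        (cong₂ ℕ._+_ (cong (λ v → kronecker (toℕ v) (toℕ a)) (Vec.lookup∘updateAt t {λ _ → i′} w)) (diagonal (toℕ i) a))
        (trans (ℕ.+-comm (kronecker (toℕ i′) (toℕ a)) _)
          (sym (cong₂ ℕ._+_ (cong (λ v → kronecker (toℕ v) (toℕ a)) eq) (diagonal (toℕ i′) a))))
      at (no neq)   a = cong₂ ℕ._+_ (cong (λ v → kronecker (toℕ v) (toℕ a)) (Vec.lookup∘update′ neq w i′))
        (trans (off (toℕ i) a neq) (sym (off (toℕ i′) a neq)))

    word-entry : ∀ (w : Word r) t {a} → Vec.lookup w t ≡ a → wordMonomial w ⟦ a , t ⟧ ≡ 1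
    word-entry w t refl = trans (wordMonomial-⟦⟧ w _ t) (kronecker-refl (toℕ (Vec.lookup w t)))

    -- If `w` has letter `i` in position `t`, both sides test whether `m` is `w` with this letter
    -- raised; if it is, the exponent and with it `ι` is 1. For another letter, `shift t m` contains
    -- x_{i,t} while `wordMonomial w` does not, so the indicator is 0.
    transpose-term : ∀ (w : Word r) t m → ι (m ⟦ i′ , t ⟧) R.* indicator (wordMonomial w) (shift t m) R.≈
      (if does (Vec.lookup w t Fin.≟ i) then indicator (wordMonomial (w Vec.[ t ]≔ i′)) m else R.0#)
    transpose-term w t m with Vec.lookup w t Fin.≟ i | m ⟦ i′ , t ⟧ in eq
    ... | yes wt≡i | zero with m ≟ₘ wordMonomial (w Vec.[ t ]≔ i′)
    ...   | yes refl = ⊥-elim (ℕ.0≢1+n (trans (sym eq) (word-entry (w Vec.[ t ]≔ i′) t (Vec.lookup∘updateAt t w))))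
    ...   | no _     = R.zeroˡ _
    transpose-term w t m | yes wt≡i | suc k
      with shift-·-cell t m (λ z → ℕ.0≢1+n (trans (sym z) eq)) | shift t m ≟ₘ wordMonomial w | m ≟ₘ wordMonomial (w Vec.[ t ]≔ i′)
    ...   | rel | yes p | yes refl = R.trans (R.*-identityʳ _) (one≈ k (trans (sym eq) (word-entry (w Vec.[ t ]≔ i′) t (Vec.lookup∘updateAt t w))))
      where
      one≈ : ∀ k → suc k ≡ 1 → ι (suc k) R.≈ R.1#
      one≈ zero refl = R.+-identityʳ _
    ...   | rel | no ¬p | no _     = R.zeroʳ _
    ...   | rel | yes p | no ¬q    = ⊥-elim (¬q (·-cancelʳ m _ (cell (toℕ i) t) (trans (sym rel) (trans (cong (_· cell (toℕ i′) t) p) (sym (updated w t wt≡i))))))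
    ...   | rel | no ¬p | yes refl = ⊥-elim (¬p (·-cancelʳ (shift t m) _ (cell (toℕ i′) t) (trans rel (updated w t wt≡i))))
    transpose-term w t m | no wt≢i | zero  = R.zeroˡ _
    transpose-term w t m | no wt≢i | suc k with shift t m ≟ₘ wordMonomial w
    ...   | no _  = R.zeroʳ _
    ...   | yes p = ⊥-elim (wt≢i (Fin.toℕ-injective (kronecker-≡ (toℕ (Vec.lookup w t)) (toℕ i) λ z →
              ℕ.m+1+n≢0 _ (trans (sym present) (trans (cong (_⟦ i , t ⟧) p) (trans (wordMonomial-⟦⟧ w i t) z))))))
      where
      present : shift t m ⟦ i , t ⟧ ≡ (m ⟦ i , t ⟧ ℕ.∸ cell (toℕ i′) t ⟦ i , t ⟧) ℕ.+ 1
      present = trans (monomial-⟦⟧ _ i t) (cong (m ⟦ i , t ⟧ ℕ.∸ cell (toℕ i′) t ⟦ i , t ⟧ ℕ.+_)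
        (trans (cell-⟦⟧ (toℕ i) t i t) (cong₂ ℕ._*_ (kronecker-refl (toℕ i)) (kronecker-refl (toℕ t)))))

  -- The sum `E` of coefficients is the coefficient of `wordMonomial w` in `δ p`, because `δ*` takes
  -- the indicator of `w` to the sum of the indicators of the raised words.
  E-coefficient : ∀ p → δ p ≈ 0# → ∀ w → E (λ w → coefficient p (wordMonomial w)) w R.≈ R.0#
  E-coefficient p killed w = begin
    E (λ w → coefficient p (wordMonomial w)) w
      ≈⟨ E-cong (λ w → coefficient-⟪⟫ p (wordMonomial w)) w ⟩
    E (λ w → ⟪ indicator (wordMonomial w) ⟫ p) w
      ≈⟨ E-∑ (λ w → ⟪ indicator (wordMonomial w) ⟫ p) w ⟩
    ∑ (λ t → if does (Vec.lookup w t Fin.≟ i) then ⟪ indicator (wordMonomial (w Vec.[ t ]≔ i′)) ⟫ p else R.0#)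
      ≈⟨ ∑-cong term ⟩
    ∑ (λ t → ⟪ (λ m → if does (Vec.lookup w t Fin.≟ i) then indicator (wordMonomial (w Vec.[ t ]≔ i′)) m else R.0#) ⟫ p)
      ≈⟨ ⟪⟫-∑ (λ t m → if does (Vec.lookup w t Fin.≟ i) then indicator (wordMonomial (w Vec.[ t ]≔ i′)) m else R.0#) p ⟨
    ⟪ (λ m → ∑ λ t → if does (Vec.lookup w t Fin.≟ i) then indicator (wordMonomial (w Vec.[ t ]≔ i′)) m else R.0#) ⟫ p
      ≈⟨ ⟪⟫-cong (λ m → ∑-cong λ t → transpose-term w t m) p ⟨
    ⟪ δ* (indicator (wordMonomial w)) ⟫ p
      ≈⟨ ⟪⟫-δ (indicator (wordMonomial w)) p ⟨
    ⟪ indicator (wordMonomial w) ⟫ (δ p)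
      ≈⟨ ⟪⟫-resp (indicator (wordMonomial w)) (δ p) 0# killed ⟩
    R.0# ∎
    where
    open import Relation.Binary.Reasoning.Setoid R.setoid
    term : ∀ t → (if does (Vec.lookup w t Fin.≟ i) then ⟪ indicator (wordMonomial (w Vec.[ t ]≔ i′)) ⟫ p else R.0#) R.≈
      ⟪ (λ m → if does (Vec.lookup w t Fin.≟ i) then indicator (wordMonomial (w Vec.[ t ]≔ i′)) m else R.0#) ⟫ p
    term t with does (Vec.lookup w t Fin.≟ i)
    ... | true  = R.refl
    ... | false = R.sym (⟪⟫-0 p)

  unbalanced-coefficient : ∀ p → δ p ≈ 0# → ∀ {k l} (eq : k ℕ.+ l ≡ r) (u : Word k) (s : Word l) →
    letterCount i′ u ≡ suc (letterCount i u) →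
    (∀ w → base (u Vec.++ s) < base w → coefficient p (wordMonomial w) R.≈ R.0#) →
    coefficient p (wordMonomial (subst Word eq (u Vec.++ s))) R.≈ R.0#
  unbalanced-coefficient p killed refl = unbalanced-vanishes (λ w → coefficient p (wordMonomial w)) (E-coefficient p killed)

-- Lists and shapes determined by counting

module _ {A : Set} where

  All-remove : ∀ {Q : A → Set} us {c vs} → All Q (us ++ c ∷ vs) → All Q (us ++ vs) × Q c
  All-remove us h = All.++⁺ (All.++⁻ˡ us h) (All.tail (All.++⁻ʳ us h)) , All.head (All.++⁻ʳ us h)

  AllPairs-remove : ∀ {Q : A → A → Set} us {c vs} → AllPairs Q (us ++ c ∷ vs) →
    AllPairs Q (us ++ vs) × All (λ b → Q b c) us × All (Q c) vs
  AllPairs-remove []       (h ∷ hs) = hs , [] , h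
  AllPairs-remove (u ∷ us) (h ∷ hs) = let p , q , r = AllPairs-remove us hs ; h′ , hc = All-remove us h in
    (h′ ∷ p) , (hc ∷ q) , r

count : ℕ → List ℕ → ℕ
count v xs = ListAction.sum (map (kronecker v) xs)

count-↭ : ∀ v {xs ys} → xs ↭ ys → count v xs ≡ count v ys
count-↭ v h = ListAction.sum-↭ (↭.map⁺ (kronecker v) h)

count⇒∈ : ∀ v xs → count v xs ≢ 0 → v ∈ xs
count⇒∈ v []       h = ⊥-elim (h refl)
count⇒∈ v (x ∷ xs) h with v ℕ.≟ x
... | yes eq = here eq
... | no neq = there (count⇒∈ v xs (h ∘ trans (cong (ℕ._+ count v xs) (kronecker-≢ neq))))

count⇒↭ : ∀ xs ys → (∀ v → count v xs ≡ count v ys) → xs ↭ ys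
count⇒↭ []       []       h = ↭-refl
count⇒↭ []       (y ∷ ys) h = ⊥-elim (ℕ.0≢1+n (trans (h y) (cong (ℕ._+ count y ys) (kronecker-refl y))))
count⇒↭ (x ∷ xs) ys       h with ∈.∈-∃++ (count⇒∈ x ys λ z → ℕ.0≢1+n (trans (sym z) (trans (sym (h x)) (cong (ℕ._+ count x xs) (kronecker-refl x)))))
... | us , vs , refl = ↭-trans (↭.prep x (count⇒↭ xs (us ++ vs) λ v →
        ℕ.+-cancelˡ-≡ (kronecker v x) _ _ (trans (h v) (count-↭ v (↭.shift x us vs))))) (↭-sym (↭.shift x us vs))

occurrences-count : ∀ {r} (t : Fin r) L → occurrences t L ≡ count (toℕ t) (map toℕ L)
occurrences-count t L = cong ListAction.sum (List.map-∘ L)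

occurrences⇒↭ : ∀ {r} (L L′ : List (Fin r)) → (∀ t → occurrences t L ≡ occurrences t L′) → L ↭ L′
occurrences⇒↭ {r} L L′ h with ↭.↭-map-inv toℕ (count⇒↭ (map toℕ L) (map toℕ L′) same)
  where
  absent : ∀ v → r ≤ v → ∀ L → count v (map (toℕ {r}) L) ≡ 0
  absent v r≤v []      = refl
  absent v r≤v (x ∷ L) = cong₂ ℕ._+_ (kronecker-≢ (ℕ.<⇒≢ (ℕ.<-≤-trans (Fin.toℕ<n x) r≤v) ∘ sym)) (absent v r≤v L)
  same : ∀ v → count v (map toℕ L) ≡ count v (map toℕ L′)
  same v with v ℕ.<? r
  ... | no v≮r  = trans (absent v (ℕ.≮⇒≥ v≮r) L) (sym (absent v (ℕ.≮⇒≥ v≮r) L′))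
  ... | yes v<r = subst (λ v → count v (map toℕ L) ≡ count v (map toℕ L′)) (Fin.toℕ-fromℕ< v<r)
                    (trans (sym (occurrences-count (fromℕ< v<r) L)) (trans (h (fromℕ< v<r)) (occurrences-count (fromℕ< v<r) L′)))
... | ys , eq , L↭ys = subst (L ↭_) (sym (List.map-injective Fin.toℕ-injective eq)) L↭ys

less-suc : ∀ i k → kronecker (suc i) k ℕ.+ less (suc i) k ≡ less i k
less-suc i       zero          = refl
less-suc zero    (suc zero)    = refl
less-suc zero    (suc (suc k)) = refl
less-suc (suc i) (suc k)       = less-suc i k

-- By `less-suc` the number of lists of length i + 1 is `longer i` minus `longer (suc i)`. Empty
-- lists are invisible to `longer`, hence the two positivity hypotheses.
longer⇒lengths-↭ : ∀ {A B : Set} (as : List (List A)) (bs : List (List B)) → (∀ i → longer i as ≡ longer i bs) →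
  All (λ a → 0 < length a) as → All (λ b → 0 < length b) bs → map length as ↭ map length bs
longer⇒lengths-↭ as bs h as>0 bs>0 = count⇒↭ (map length as) (map length bs) same
  where
  sum-cong : ∀ {A : Set} (f g : A → ℕ) → (∀ x → f x ≡ g x) → ∀ xs → ListAction.sum (map f xs) ≡ ListAction.sum (map g xs)
  sum-cong f g h xs = cong ListAction.sum (List.map-cong h xs)
  sum-+ : ∀ {A : Set} (f g : A → ℕ) xs → ListAction.sum (map (λ x → f x ℕ.+ g x) xs) ≡ ListAction.sum (map f xs) ℕ.+ ListAction.sum (map g xs)
  sum-+ f g []       = refl
  sum-+ f g (x ∷ xs) = trans (cong (f x ℕ.+ g x ℕ.+_) (sum-+ f g xs)) (ℕ-interchange (f x) (g x) _ _)
  split : ∀ {A : Set} i (as : List (List A)) → count (suc i) (map length as) ℕ.+ longer (suc i) as ≡ longer i as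
  split i as = trans (cong (ℕ._+ longer (suc i) as) (cong ListAction.sum (sym (List.map-∘ as))))
    (trans (sym (sum-+ (kronecker (suc i) ∘ length) (less (suc i) ∘ length) as))
      (sum-cong _ (less i ∘ length) (λ a → less-suc i (length a)) as))
  nonempty : ∀ {A : Set} {as : List (List A)} → All (λ a → 0 < length a) as → count 0 (map length as) ≡ 0
  nonempty []                              = refl
  nonempty {as = (_ ∷ _) ∷ _} (s≤s _ ∷ hs) = nonempty hs
  same : ∀ v → count v (map length as) ≡ count v (map length bs)
  same zero    = trans (nonempty as>0) (sym (nonempty bs>0))
  same (suc i) = ℕ.+-cancelʳ-≡ (longer (suc i) as) _ _
    (trans (split i as) (trans (h i) (trans (sym (split i bs)) (cong (count (suc i) (map length bs) ℕ.+_) (sym (h (suc i)))))))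

-- The non-crossing relation

-- 0 past the end of the list.
at : ∀ {N} → ℕ → List (Fin N) → ℕ
at i       []      = 0
at zero    (x ∷ _) = toℕ x
at (suc i) (_ ∷ l) = at i l

⟨⟩=-at : ∀ {N} (l : List (Fin N)) i {x} → l ⟨ i ⟩= x → i < length l × at i l ≡ toℕ x
⟨⟩=-at []      zero    ()
⟨⟩=-at []      (suc i) ()
⟨⟩=-at (y ∷ l) zero    refl = s≤s z≤n , refl
⟨⟩=-at (y ∷ l) (suc i) h    = let lt , eq = ⟨⟩=-at l i h in s≤s lt , eq

at-⟨⟩= : ∀ {N} (l : List (Fin N)) i → i < length l → Σ (Fin N) λ x → l ⟨ i ⟩= x × at i l ≡ toℕ x
at-⟨⟩= (y ∷ l) zero    lt       = y , refl , refl
at-⟨⟩= (y ∷ l) (suc i) (s≤s lt) = at-⟨⟩= l i lt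

at-All : ∀ {N} {Q : ℕ → Set} (l : List (Fin N)) → All (Q ∘ toℕ) l → ∀ i → i < length l → Q (at i l)
at-All (y ∷ l) (q ∷ qs) zero    lt       = q
at-All {Q = Q} (y ∷ l) (q ∷ qs) (suc i) (s≤s lt) = at-All {Q = Q} l qs i lt

at-++ˡ : ∀ {N} (l : List (Fin N)) l′ i → i < length l → at i (l ++ l′) ≡ at i l
at-++ˡ (y ∷ l) l′ zero    lt       = refl
at-++ˡ (y ∷ l) l′ (suc i) (s≤s lt) = at-++ˡ l l′ i lt

at-last : ∀ {N} (l : List (Fin N)) t → at (length l) (l ++ t ∷ []) ≡ toℕ t
at-last []      t = refl
at-last (y ∷ l) t = at-last l t

length-∷ʳ : ∀ {A : Set} (l : List A) t → length (l ++ t ∷ []) ≡ suc (length l)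
length-∷ʳ l t = trans (List.length-++ l) (ℕ.+-comm (length l) 1)

-- A form of NonCrossing that is symmetric, hence does not refer to the order of the lengths.
record Uncrossed {N : ℕ} (a b : List (Fin N)) : Set where
  field
    insideˡ : ∀ i → suc i < length a → suc i < length b →
              ¬ (at i a < at i b × at i b < at (suc i) a × at (suc i) a < at (suc i) b)
    insideʳ : ∀ i → suc i < length a → suc i < length b →
              ¬ (at i b < at i a × at i a < at (suc i) b × at (suc i) b < at (suc i) a)
    endˡ    : ∀ q → length b ≡ suc q → suc q < length a → ¬ (at q a < at q b × at q b < at (suc q) a)
    endʳ    : ∀ q → length a ≡ suc q → suc q < length b → ¬ (at q b < at q a × at q a < at (suc q) b)

Uncrossed-sym : ∀ {N} {a b : List (Fin N)} → Uncrossed a b → Uncrossed b a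
Uncrossed-sym u = record
  { insideˡ = λ i p q → insideʳ i q p ; insideʳ = λ i p q → insideˡ i q p ; endˡ = endʳ ; endʳ = endˡ }
  where open Uncrossed u

Uncrossed-[] : ∀ {N} {b : List (Fin N)} → Uncrossed [] b
Uncrossed-[] = record { insideˡ = λ _ () ; insideʳ = λ _ () ; endˡ = λ _ _ () ; endʳ = λ _ () }

Uncrossed⇒NonCrossing : ∀ {N} {a b : List (Fin N)} → Uncrossed a b → NonCrossing a b
Uncrossed⇒NonCrossing {a = a} {b} u = record
  { interleaving = λ i aᵢ aₛ bᵢ bₛ →
      let _ , eq₁ = ⟨⟩=-at a i aᵢ ; lt₂ , eq₂ = ⟨⟩=-at a (suc i) aₛ
          _ , eq₃ = ⟨⟩=-at b i bᵢ ; lt₄ , eq₄ = ⟨⟩=-at b (suc i) bₛ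
      in (λ { (p , q , r) → insideˡ i lt₂ lt₄ (subst₂ _<_ (sym eq₁) (sym eq₃) p , subst₂ _<_ (sym eq₃) (sym eq₂) q , subst₂ _<_ (sym eq₂) (sym eq₄) r) })
       , (λ { (p , q , r) → insideʳ i lt₂ lt₄ (subst₂ _<_ (sym eq₃) (sym eq₁) p , subst₂ _<_ (sym eq₁) (sym eq₄) q , subst₂ _<_ (sym eq₄) (sym eq₂) r) })
  ; lastEntry = λ _ q q≡ a_q aₛ b_q (p , p′) →
      let _ , eq₁ = ⟨⟩=-at a q a_q ; lt₂ , eq₂ = ⟨⟩=-at a (suc q) aₛ ; _ , eq₃ = ⟨⟩=-at b q b_q
      in endˡ q (sym q≡) lt₂ (subst₂ _<_ (sym eq₁) (sym eq₃) p , subst₂ _<_ (sym eq₃) (sym eq₂) p′)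
  }
  where open Uncrossed u

-- With the lengths in this order only `endˡ` has content; `endʳ` is vacuous.
NonCrossing⇒Uncrossed : ∀ {N} {a b : List (Fin N)} → length b ≤ length a → NonCrossing a b → Uncrossed a b
NonCrossing⇒Uncrossed {a = a} {b} b≤a nc = record
  { insideˡ = λ i p q → proj₁ (inside i p q)
  ; insideʳ = λ i p q → proj₂ (inside i p q)
  ; endˡ = λ q eq lt (p , p′) →
      let _ , x₁ , e₁ = at-⟨⟩= a q (ℕ.<⇒≤ lt) ; _ , x₂ , e₂ = at-⟨⟩= a (suc q) lt
          _ , x₃ , e₃ = at-⟨⟩= b q (ℕ.≤-reflexive (sym eq))
      in lastEntry (subst (_< length a) (sym eq) lt) q (sym eq) x₁ x₂ x₃ (subst₂ _<_ e₁ e₃ p , subst₂ _<_ e₃ e₂ p′)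
  ; endʳ = λ q eq lt _ → ℕ.<⇒≱ lt (ℕ.≤-trans b≤a (ℕ.≤-reflexive eq))
  }
  where
  open NonCrossing nc
  inside : ∀ i → suc i < length a → suc i < length b →
    ¬ (at i a < at i b × at i b < at (suc i) a × at (suc i) a < at (suc i) b) ×
    ¬ (at i b < at i a × at i a < at (suc i) b × at (suc i) b < at (suc i) a)
  inside i p q =
    let _ , x₁ , e₁ = at-⟨⟩= a i (ℕ.<⇒≤ p) ; _ , x₂ , e₂ = at-⟨⟩= a (suc i) p
        _ , x₃ , e₃ = at-⟨⟩= b i (ℕ.<⇒≤ q) ; _ , x₄ , e₄ = at-⟨⟩= b (suc i) q
        h , h′ = interleaving i x₁ x₂ x₃ x₄
    in (λ { (s , t , u) → h (subst₂ _<_ e₁ e₃ s , subst₂ _<_ e₃ e₂ t , subst₂ _<_ e₂ e₄ u) })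
     , (λ { (s , t , u) → h′ (subst₂ _<_ e₃ e₁ s , subst₂ _<_ e₁ e₄ t , subst₂ _<_ e₄ e₂ u) })

-- As `t` exceeds all of `b`, a forbidden pattern with the new entry would put `t` below an element
-- of `b`, or already violates `endʳ` for `c`, or occurs where `b` and `c` end in the same row. The
-- last case is excluded by `recent`; this is what forces the greedy choice of the most recent
-- block.
Uncrossed-∷ʳ : ∀ {N} {c b : List (Fin N)} (t : Fin N) → All (Fin._< t) b → Uncrossed c b →
  (∀ q → length c ≡ suc q → length b ≡ suc q → at q b < at q c) → Uncrossed (c ++ t ∷ []) b
Uncrossed-∷ʳ {c = c} {b} t b<t u recent = record
  { insideˡ = λ i p p′ → case ℕ.m≤n⇒m<n∨m≡n (ℕ.s≤s⁻¹ (subst (suc (suc i) ≤_) (length-∷ʳ c t) p)) of λ where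
      (inj₁ lt) (x , y , z) → insideˡ i lt p′ (old i (ℕ.<⇒≤ lt) ▹ˡ x , old (suc i) lt ▹ʳ y , old (suc i) lt ▹ˡ z)
      (inj₂ eq) (x , y , z) → ℕ.<-asym (b< (suc i) p′) (new eq ▹ˡ z)
  ; insideʳ = λ i p p′ → case ℕ.m≤n⇒m<n∨m≡n (ℕ.s≤s⁻¹ (subst (suc (suc i) ≤_) (length-∷ʳ c t) p)) of λ where
      (inj₁ lt) (x , y , z) → insideʳ i lt p′ (old i (ℕ.<⇒≤ lt) ▹ʳ x , old i (ℕ.<⇒≤ lt) ▹ˡ y , old (suc i) lt ▹ʳ z)
      (inj₂ eq) (x , y , z) → endʳ i (sym eq) p′ (old i (ℕ.≤-reflexive eq) ▹ʳ x , old i (ℕ.≤-reflexive eq) ▹ˡ y)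
  ; endˡ = λ q eq p → case ℕ.m≤n⇒m<n∨m≡n (ℕ.s≤s⁻¹ (subst (suc (suc q) ≤_) (length-∷ʳ c t) p)) of λ where
      (inj₁ lt) (x , y) → endˡ q eq lt (old q (ℕ.<⇒≤ lt) ▹ˡ x , old (suc q) lt ▹ʳ y)
      (inj₂ e) (x , y)  → ℕ.<-asym (old q (ℕ.≤-reflexive e) ▹ˡ x) (recent q (sym e) eq)
  ; endʳ = λ q eq p (x , y) → ℕ.<-asym (b< (suc q) p) (new (ℕ.suc-injective (trans (sym eq) (length-∷ʳ c t))) ▹ˡ y)
  }
  where
  open Uncrossed u
  b< : ∀ i → i < length b → at i b < toℕ t
  b< = at-All {Q = _< toℕ t} b b<t
  old : ∀ i → i < length c → at i (c ++ t ∷ []) ≡ at i c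
  old = at-++ˡ c (t ∷ [])
  new : ∀ {i} → i ≡ length c → at i (c ++ t ∷ []) ≡ toℕ t
  new refl = at-last c t
  _▹ˡ_ : ∀ {x y z} → x ≡ y → x < z → y < z
  eq ▹ˡ lt = subst (_< _) eq lt
  _▹ʳ_ : ∀ {x y z} → x ≡ y → z < x → z < y
  eq ▹ʳ lt = subst (_ <_) eq lt

-- The greedy construction of a non-crossing partition

cells : ∀ {N} → ℕ → List (Fin N) → List (ℕ × Fin N)
cells s []      = []
cells s (v ∷ J) = (s , v) ∷ cells (suc s) J

cells-∷ʳ : ∀ {N} s (c : List (Fin N)) t → cells s (c ++ t ∷ []) ≡ cells s c ++ (s ℕ.+ length c , t) ∷ []
cells-∷ʳ s []      t = cong (λ k → (k , t) ∷ []) (sym (ℕ.+-identityʳ s))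
cells-∷ʳ s (v ∷ c) t = cong ((s , v) ∷_) (trans (cells-∷ʳ (suc s) c t) (cong (λ k → cells (suc s) c ++ (k , t) ∷ []) (sym (ℕ.+-suc s (length c)))))

cells-labels : ∀ {N} s (c : List (Fin N)) → map proj₂ (cells s c) ≡ c
cells-labels s []      = refl
cells-labels s (v ∷ c) = cong (v ∷_) (cells-labels (suc s) c)

allCells : ∀ {N} → List (List (Fin N)) → List (ℕ × Fin N)
allCells = List.concatMap (cells 0)

allCells-++ : ∀ {N} (as bs : List (List (Fin N))) → allCells (as ++ bs) ≡ allCells as ++ allCells bs
allCells-++ as bs = List.concatMap-++ (cells 0) as bs

allCells-labels : ∀ {N} (Bs : List (List (Fin N))) → map proj₂ (allCells Bs) ≡ concat Bs
allCells-labels []       = refl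
allCells-labels (b ∷ Bs) = trans (List.map-++ proj₂ (cells 0 b) (allCells Bs)) (cong₂ _++_ (cells-labels 0 b) (allCells-labels Bs))

rowCount : ∀ {N} → ℕ → List (ℕ × Fin N) → ℕ
rowCount i cs = ListAction.sum (map (kronecker i ∘ proj₁) cs)

rowCount-allCells : ∀ {N} i (Bs : List (List (Fin N))) → rowCount i (allCells Bs) ≡ longer i Bs
rowCount-allCells     i []       = refl
rowCount-allCells {N} i (b ∷ Bs) = trans (cong ListAction.sum (List.map-++ _ (cells 0 b) (allCells Bs)))
  (trans (ListAction.sum-++ (map _ (cells 0 b)) _) (cong₂ ℕ._+_ (block i b) (rowCount-allCells i Bs)))
  where
  block′ : ∀ s i (b : List (Fin N)) → ListAction.sum (map (kronecker (s ℕ.+ i) ∘ proj₁) (cells s b)) ≡ less i (length b)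
  below : ∀ s s′ (b : List (Fin N)) → s < s′ → ListAction.sum (map (kronecker s ∘ proj₁) (cells s′ b)) ≡ 0
  below s s′ []      lt = refl
  below s s′ (v ∷ b) lt = cong₂ ℕ._+_ (kronecker-≢ (ℕ.<⇒≢ lt)) (below s (suc s′) b (ℕ.m<n⇒m<1+n lt))
  block′ s i       []      = refl
  block′ s zero    (v ∷ b) = cong₂ ℕ._+_ (trans (cong (λ k → kronecker k s) (ℕ.+-identityʳ s)) (kronecker-refl s))
    (below (s ℕ.+ 0) (suc s) b (s≤s (ℕ.≤-reflexive (ℕ.+-identityʳ s))))
  block′ s (suc i) (v ∷ b) = cong₂ ℕ._+_ (kronecker-≢ (ℕ.m+1+n≢m s))
    (trans (cong (λ k → ListAction.sum (map (kronecker k ∘ proj₁) (cells (suc s) b))) (ℕ.+-suc s i)) (block′ (suc s) i b))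
  block : ∀ i (b : List (Fin N)) → ListAction.sum (map (kronecker i ∘ proj₁) (cells 0 b)) ≡ less i (length b)
  block = block′ 0

longer-suc : ∀ {A : Set} i (Bs : List (List A)) → All (λ b → length b ≢ suc i) Bs → longer (suc i) Bs ≡ longer i Bs
longer-suc i []       []       = refl
longer-suc i (b ∷ Bs) (h ∷ hs) = cong₂ ℕ._+_
  (trans (cong (ℕ._+ less (suc i) (length b)) (sym (kronecker-≢ (h ∘ sym)))) (less-suc i (length b))) (longer-suc i Bs hs)

module _ {n N : ℕ} where

  last : List (Fin N) → ℕ
  last a = at (ℕ.pred (length a)) a

  MoreRecent : List (Fin N) → List (Fin N) → Set
  MoreRecent a b = Uncrossed a b × last b < last a

  -- `uncrossed` also keeps the blocks in the order of decreasing last elements, so the first block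
  -- of a given length is the most recent one. `contents` says that letter i in position t has
  -- become the element t in row i of its block.
  record Partial (processed : List (Fin n × Fin N)) (Bs : List (List (Fin N))) : Set where
    field
      increasing : All (AllPairs Fin._<_) Bs
      nonEmpty   : All (λ b → 0 < length b) Bs
      uncrossed  : AllPairs MoreRecent Bs
      contents   : allCells Bs ↭ map (λ (x , t) → toℕ x , t) processed

  -- Failure comes with a certificate: the letters `x` and `y` balance in `p`, so `p` followed by
  -- `x` has one `x` too many for a ballot word.
  data Outcome (z : List (Fin n × Fin N)) : Set where
    built : ∀ Bs → Partial z Bs → Outcome z
    stuck : ∀ p x t s y → z ≡ p ++ (x , t) ∷ s → toℕ x ≡ suc (toℕ y) →
            occurrences x (map proj₁ p) ≡ occurrences y (map proj₁ p) → Outcome z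

  private
    append : ∀ {us c vs} x t → All (AllPairs Fin._<_) (us ++ vs) → All (λ b → 0 < length b) (us ++ vs) → AllPairs MoreRecent (us ++ vs) →
      All (Fin._< t) (concat (us ++ vs)) → All (Fin._< t) c →
      AllPairs Fin._<_ c → All (Uncrossed c) (us ++ vs) → All (λ b → ∀ q → length c ≡ suc q → length b ≡ suc q → at q b < at q c) (us ++ vs) →
      ∀ {processed′} → length c ≡ toℕ x → cells 0 c ++ allCells (us ++ vs) ↭ map (λ (x , t) → toℕ x , t) processed′ →
      Partial (processed′ ++ (x , t) ∷ []) ((c ++ t ∷ []) ∷ us ++ vs)
    append {us} {c} {vs} x t incr nonEmpty uncrossed <t c<t c-incr uncr recent {processed′} len perm = record
      { increasing = AllPairs.++⁺ c-incr ([] ∷ []) (All.map (_∷ []) c<t) ∷ incr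
      ; nonEmpty   = subst (0 <_) (sym (length-∷ʳ c t)) (s≤s z≤n) ∷ nonEmpty
      ; uncrossed  = pairs (us ++ vs) <t uncr recent nonEmpty ∷ uncrossed
      ; contents   = ↭-trans (↭-reflexive (cong (_++ allCells (us ++ vs)) (cells-∷ʳ 0 c t)))
          (↭-trans (↭-reflexive (List.++-assoc (cells 0 c) _ _)) (↭-trans (↭.shift _ (cells 0 c) (allCells (us ++ vs)))
            (↭-trans (↭.prep _ perm) (↭-trans (↭.∷↭∷ʳ _ _) (↭-reflexive (trans (cong (λ k → map _ processed′ ++ (k , t) ∷ []) len)
              (sym (List.map-++ _ processed′ ((x , t) ∷ [])))))))))
      }
      where
      last-new : last (c ++ t ∷ []) ≡ toℕ t
      last-new = trans (cong (λ k → at (ℕ.pred k) (c ++ t ∷ [])) (length-∷ʳ c t)) (at-last c t)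
      pairs : ∀ bs → All (Fin._< t) (concat bs) → All (Uncrossed c) bs → All (λ b → ∀ q → length c ≡ suc q → length b ≡ suc q → at q b < at q c) bs →
        All (λ b → 0 < length b) bs → All (MoreRecent (c ++ t ∷ [])) bs
      pairs []       _  []       []       []         = []
      pairs (b ∷ bs) lt (u ∷ us) (r ∷ rs) (b>0 ∷ hs) =
        (Uncrossed-∷ʳ t (All.++⁻ˡ b lt) u r , subst (last b <_) (sym last-new)
          (at-All {Q = _< toℕ t} b (All.++⁻ˡ b lt) (ℕ.pred (length b)) (ℕ.≤-reflexive (ℕ.suc-pred (length b) {{ℕ.>-nonZero b>0}}))))
        ∷ pairs bs (All.++⁻ʳ b lt) us rs hs

    find : ∀ k (Bs : List (List (Fin N))) →
      (∃[ us ] ∃[ c ] ∃[ vs ] Bs ≡ us ++ c ∷ vs × length c ≡ k × All (λ b → length b ≢ k) us) ⊎ All (λ b → length b ≢ k) Bs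
    find k []       = inj₂ []
    find k (b ∷ Bs) with length b ℕ.≟ k | find k Bs
    ... | yes eq | _ = inj₁ ([] , b , Bs , refl , eq , [])
    ... | no neq | inj₁ (us , c , vs , refl , eq , hs) = inj₁ (b ∷ us , c , vs , refl , eq , neq ∷ hs)
    ... | no neq | inj₂ hs = inj₂ (neq ∷ hs)

  -- Each letter x extends the most recently extended block of length x.
  run : ∀ processed Bs → Partial processed Bs → ∀ z → AllPairs (λ e e′ → proj₂ e Fin.< proj₂ e′) (processed ++ z) → Outcome (processed ++ z)
  run processed Bs inv []            lt = subst Outcome (sym (List.++-identityʳ processed)) (built Bs inv)
  run processed Bs inv ((x , t) ∷ z) lt = subst Outcome (List.++-assoc processed ((x , t) ∷ []) z) (step (toℕ x) refl)
    where
    lt′ = subst (AllPairs _) (sym (List.++-assoc processed ((x , t) ∷ []) z)) lt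
    processed<t : All (λ e → proj₂ e Fin.< t) processed
    processed<t = proj₁ (proj₂ (AllPairs-remove processed lt))
    elements : concat Bs ↭ map proj₂ processed
    elements = ↭-trans (↭-reflexive (sym (allCells-labels Bs))) (↭-trans (↭.map⁺ proj₂ (Partial.contents inv)) (↭-reflexive (sym (List.map-∘ processed))))
    <t : All (Fin._< t) (concat Bs)
    <t = ↭.All-resp-↭ (↭-sym elements) (All.map⁺ processed<t)
    step : ∀ k → toℕ x ≡ k → Outcome ((processed ++ (x , t) ∷ []) ++ z)
    -- A letter 0 extends the empty list, that is, opens a new block.
    step zero    eq = run _ _ (append {us = []} {c = []} {vs = Bs} x t (Partial.increasing inv) (Partial.nonEmpty inv) (Partial.uncrossed inv)
        <t [] [] (All.universal (λ _ → Uncrossed-[]) Bs) (All.universal (λ _ _ ()) Bs)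
        (sym eq) (Partial.contents inv)) z lt′
    step (suc y) eq with find (suc y) Bs
    -- No block ends in row `y`, so every block with an element in that row has one in the next row
    -- too. The two numbers count the letters `y` and `x` read so far.
    ... | inj₂ none = stuck processed x t z y′ (List.++-assoc processed _ z) (trans eq (cong suc (sym (Fin.toℕ-fromℕ< y<n))))
        (trans (letters x) (trans (cong (λ k → longer k Bs) eq) (trans (longer-suc y Bs none) (trans (cong (λ k → longer k Bs) (sym (Fin.toℕ-fromℕ< y<n))) (sym (letters y′))))))
      where
      y<n : y < n
      y<n = ℕ.<-trans (ℕ.n<1+n y) (subst (_< n) eq (Fin.toℕ<n x))
      y′ = fromℕ< y<n
      letters : ∀ a → occurrences a (map proj₁ processed) ≡ longer (toℕ a) Bs
      letters a = trans (trans (cong ListAction.sum (sym (List.map-∘ processed))) (trans (cong ListAction.sum (List.map-∘ processed))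
        (sym (ListAction.sum-↭ (↭.map⁺ (kronecker (toℕ a) ∘ proj₁) (Partial.contents inv)))))) (rowCount-allCells (toℕ a) Bs)
    ... | inj₁ (us , c , vs , refl , len , before) = run _ _ (append {us = us} {c = c} {vs = vs} x t
        (proj₁ incr) (proj₁ (All-remove us (Partial.nonEmpty inv))) (proj₁ parts)
        (All.concat⁺ (proj₁ small)) (proj₂ small) (proj₂ incr)
        (All.++⁺ (All.map (Uncrossed-sym ∘ proj₁) (proj₁ (proj₂ parts))) (All.map proj₁ (proj₂ (proj₂ parts))))
        -- The blocks before `c` differ from it in length; those after it have smaller last
        -- elements.
        (All.++⁺ (All.map (λ neq q e e′ → ⊥-elim (neq (trans e′ (trans (sym e) len)))) before)
                 (All.map (λ {b} (_ , r) q e e′ → subst₂ _<_ (cong (λ k → at (ℕ.pred k) b) e′) (cong (λ k → at (ℕ.pred k) c) e) r) (proj₂ (proj₂ parts))))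
        (trans len (sym eq))
        (↭-trans (↭-sym moved) (Partial.contents inv))) z lt′
      where
      parts = AllPairs-remove us (Partial.uncrossed inv)
      incr = All-remove us (Partial.increasing inv)
      small = All-remove us (All.concat⁻ <t)
      moved : allCells (us ++ c ∷ vs) ↭ cells 0 c ++ allCells (us ++ vs)
      moved = ↭-trans (↭-reflexive (allCells-++ us (c ∷ vs))) (↭-trans (↭.shifts (allCells us) (cells 0 c))
        (↭-reflexive (cong (cells 0 c ++_) (sym (allCells-++ us vs)))))

-- Reconstructing the columns from the contents of the rows

module _ {A : Set} where

  sortBy : (key : A → ℕ) (xs : List A) → ∃[ ys ] xs ↭ ys × AllPairs (λ a b → key a ≤ key b) ys
  sortBy key xs = sort xs , ↭-sym (sort-↭ xs) , Linked.Linked⇒AllPairs ℕ.≤-trans (sort-↗ xs)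
    where open Sorting (On.decTotalOrder ℕ.≤-decTotalOrder key) using (sort; sort-↭; sort-↗)

  separate : ∀ {Q : A → Set} → (∀ a → Dec (Q a)) → ∀ xs → ∃[ ys ] ∃[ zs ] xs ↭ ys ++ zs × All Q ys × All (¬_ ∘ Q) zs
  separate Q? []       = [] , [] , ↭-refl , [] , []
  separate Q? (x ∷ xs) with separate Q? xs | Q? x
  ... | ys , zs , p , q , r | yes qx = x ∷ ys , zs , ↭.prep x p , qx ∷ q , r
  ... | ys , zs , p , q , r | no ¬qx = ys , x ∷ zs , ↭-trans (↭.prep x p) (↭-sym (↭.shift x ys zs)) , q , ¬qx ∷ r

  AllPairs-∈ : ∀ {Q Q′ : A → A → Set} {xs} → (∀ {a b} → a ∈ xs → b ∈ xs → Q a b → Q′ a b) → AllPairs Q xs → AllPairs Q′ xs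
  AllPairs-∈ h []        = []
  AllPairs-∈ h (qs ∷ ps) = All.tabulate (λ b∈ → h (here refl) (there b∈) (All.lookup qs b∈)) ∷ AllPairs-∈ (λ a∈ b∈ → h (there a∈) (there b∈)) ps

  AllPairs-++ˡ : ∀ {Q : A → A → Set} xs {ys} → AllPairs Q (xs ++ ys) → AllPairs Q xs
  AllPairs-++ˡ []       _        = []
  AllPairs-++ˡ (x ∷ xs) (q ∷ qs) = All.++⁻ˡ xs q ∷ AllPairs-++ˡ xs qs

  -- Both splittings cut at the last element that satisfies `Q`.
  split-unique : ∀ {Q : A → Set} {us c vs us′ c′ vs′} → us ++ c ∷ vs ≡ us′ ++ c′ ∷ vs′ →
    All Q us → Q c → All (¬_ ∘ Q) vs → All Q us′ → Q c′ → All (¬_ ∘ Q) vs′ →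
    us ≡ us′ × c ≡ c′ × vs ≡ vs′
  split-unique {us = []}    {us′ = []}     refl _ _ _ _ _ _ = refl , refl , refl
  split-unique {us = []}    {us′ = u ∷ us} refl _ _ ¬vs _ q′ _ = ⊥-elim (All.lookup ¬vs (∈.∈-++⁺ʳ us (here refl)) q′)
  split-unique {us = u ∷ us} {us′ = []}    refl _ q _ _ _ ¬vs′ = ⊥-elim (All.lookup ¬vs′ (∈.∈-++⁺ʳ us (here refl)) q)
  split-unique {us = u ∷ us} {us′ = u′ ∷ us′} eq (_ ∷ qs) q ¬vs (_ ∷ qs′) q′ ¬vs′ with List.∷-injective eq
  ... | refl , eq′ with split-unique eq′ qs q ¬vs qs′ q′ ¬vs′
  ...   | refl , refl , refl = refl , refl , refl

sorted-↭⇒≡ : ∀ {xs ys : List ℕ} → AllPairs _≤_ xs → AllPairs _≤_ ys → xs ↭ ys → xs ≡ ys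
sorted-↭⇒≡ p q h = Pointwise.Pointwise-≡⇒≡ (↗↭↗⇒≋ ℕ.≤-totalOrder (Linked.AllPairs⇒Linked p) (Linked.AllPairs⇒Linked q) (↭.↭⇒↭ₛ h))

at-take : ∀ {N} k (l : List (Fin N)) → at k (take (suc k) l) ≡ at k l
at-take zero    []      = refl
at-take zero    (x ∷ l) = refl
at-take (suc k) []      = refl
at-take (suc k) (x ∷ l) = at-take k l

take-suc-≡ : ∀ {N} k (l l′ : List (Fin N)) → k < length l → k < length l′ → take k l ≡ take k l′ → at k l ≡ at k l′ →
  take (suc k) l ≡ take (suc k) l′
take-suc-≡ zero    (x ∷ l) (y ∷ l′) _        _         _  eq = cong (_∷ []) (Fin.toℕ-injective eq)
take-suc-≡ (suc k) (x ∷ l) (y ∷ l′) (s≤s lt) (s≤s lt′) t≡ eq = cong₂ _∷_ (List.∷-injectiveˡ t≡) (take-suc-≡ k l l′ lt lt′ (List.∷-injectiveʳ t≡) eq)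

less-< : ∀ {i k} → i < k → less i k ≡ 1
less-< {zero}  {suc k} _        = refl
less-< {suc i} {suc k} (s≤s lt) = less-< lt

less-≥ : ∀ {i k} → k ≤ i → less i k ≡ 0
less-≥ {i}     {zero}  _        = refl
less-≥ {suc i} {suc k} (s≤s le) = less-≥ le

module _ {N r : ℕ} where

  -- A block of labels together with the column of values of its elements.
  Item : Set
  Item = List (Fin N) × List (Fin r)

  height : Item → ℕ
  height = length ∘ proj₁

  label value : ℕ → Item → ℕ
  label i = at i ∘ proj₁
  value i = at i ∘ proj₂

  Separated : Item → Item → Set
  Separated a b = Uncrossed (proj₁ a) (proj₁ b) × (∀ i → i < height a → i < height b → label i a ≢ label i b)

  Separated-sym : Symmetric Separated
  Separated-sym (u , h) = Uncrossed-sym u , λ i p q eq → h i q p (sym eq)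

  -- The consequences of a lifting from which the columns are reconstructed. `monotone` compares any
  -- two rows, so values determine the order of labels except for ties. All fields are insensitive
  -- to the order of the items, which are sorted anew for every row.
  record Lifted (A : List Item) : Set where
    field
      lengths   : All (λ a → height a ≡ length (proj₂ a)) A
      strict    : All (λ a → ∀ i → suc i < height a → value i a < value (suc i) a) A
      separated : AllPairs Separated A
      monotone  : ∀ {a b} → a ∈ A → b ∈ A → ∀ i j → i < height a → j < height b → value i a < value j b → label i a < label j b

    monotone-≤ : ∀ {a b} → a ∈ A → b ∈ A → ∀ i j → i < height a → j < height b → label i a < label j b → value i a ≤ value j b
    monotone-≤ a∈ b∈ i j p q lt = ℕ.≮⇒≥ λ lt′ → ℕ.<-asym lt (monotone b∈ a∈ j i q p lt′)

  Lifted-↭ : ∀ {A B} → A ↭ B → Lifted A → Lifted B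
  Lifted-↭ h l = record
    { lengths = ↭.All-resp-↭ h lengths ; strict = ↭.All-resp-↭ h strict
    ; separated = ↭ₛ.AllPairs-resp-↭ (≡-setoid Item) (λ {a} {b} → Separated-sym {a} {b})
        ((λ { refl s → s }) , λ { refl s → s }) (↭.↭⇒↭ₛ h) separated
    ; monotone = λ a∈ b∈ → monotone (↭.∈-resp-↭ (↭-sym h) a∈) (↭.∈-resp-↭ (↭-sym h) b∈) }
    where open Lifted l

  Lifted-++ˡ : ∀ A {B} → Lifted (A ++ B) → Lifted A
  Lifted-++ˡ A l = record
    { lengths = All.++⁻ˡ A lengths ; strict = All.++⁻ˡ A strict ; separated = AllPairs-++ˡ A separated
    ; monotone = λ a∈ b∈ → monotone (∈.∈-++⁺ˡ a∈) (∈.∈-++⁺ˡ b∈) }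
    where open Lifted l

  -- The number of entries v in row i. The factor `less` discards the default value 0 of `at` for
  -- items that do not reach this row.
  frequency : ℕ → ℕ → List Item → ℕ
  frequency i v A = ListAction.sum (map (λ a → less i (height a) ℕ.* kronecker v (value i a)) A)

  frequency-↭ : ∀ i v {A B} → A ↭ B → frequency i v A ≡ frequency i v B
  frequency-↭ i v h = ListAction.sum-↭ (↭.map⁺ _ h)

  frequency-++ : ∀ i v A B → frequency i v (A ++ B) ≡ frequency i v A ℕ.+ frequency i v B
  frequency-++ i v A B = trans (cong ListAction.sum (List.map-++ _ A B)) (ListAction.sum-++ (map _ A) _)

  frequency-short : ∀ i v C → All (λ a → height a ≤ i) C → frequency i v C ≡ 0
  frequency-short i v []      []       = refl
  frequency-short i v (a ∷ C) (h ∷ hs) = cong₂ ℕ._+_ (cong (ℕ._* kronecker v (value i a)) (less-≥ h)) (frequency-short i v C hs)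

  frequency-long : ∀ i v B → All (λ a → i < height a) B → frequency i v B ≡ count v (map (value i) B)
  frequency-long i v []      []       = refl
  frequency-long i v (a ∷ B) (h ∷ hs) = cong₂ ℕ._+_ (trans (cong (ℕ._* kronecker v (value i a)) (less-< h)) (ℕ.*-identityˡ _)) (frequency-long i v B hs)

  prefix : ℕ → Item → List (Fin r)
  prefix k = take k ∘ proj₂

  RowSorted : ℕ → List Item → Set
  RowSorted i = AllPairs (λ a b → label i a < label i b)

  row : ∀ i A → Lifted A → ∃[ B ] ∃[ C ] A ↭ B ++ C × All (λ a → i < height a) B × All (λ a → ¬ i < height a) C × RowSorted i B
  row i A l with separate (λ a → i ℕ.<? height a) A
  ... | Y , C , perm , long , short with sortBy (label i) Y
  ...   | B , Y↭B , sorted = B , C , perm′ , long′ , short ,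
            AllPairs-∈ (λ a∈ b∈ (le , _ , h) → ℕ.≤∧≢⇒< le (h i (All.lookup long′ a∈) (All.lookup long′ b∈)))
              (AllPairs.zip (sorted , Lifted.separated (Lifted-++ˡ B (Lifted-↭ perm′ l))))
    where
    perm′ = ↭-trans perm (↭.++⁺ʳ C Y↭B)
    long′ = ↭.All-resp-↭ Y↭B long

  -- Sorting by labels sorts the values weakly, by `monotone-≤`, and a weakly increasing sequence is
  -- determined by its multiplicities.
  row-values : ∀ i {B B′} → Lifted B → Lifted B′ → RowSorted i B → RowSorted i B′ →
    All (λ a → i < height a) B → All (λ a → i < height a) B′ → (∀ v → frequency i v B ≡ frequency i v B′) →
    map (value i) B ≡ map (value i) B′
  row-values i {B} {B′} l l′ s s′ long long′ h = sorted-↭⇒≡ (increasing l s long) (increasing l′ s′ long′)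
    (count⇒↭ _ _ λ v → trans (sym (frequency-long i v B long)) (trans (h v) (frequency-long i v B′ long′)))
    where
    increasing : ∀ {B} → Lifted B → RowSorted i B → All (λ a → i < height a) B → AllPairs _≤_ (map (value i) B)
    increasing l s long = AllPairs.map⁺ (AllPairs-∈ (λ a∈ b∈ → Lifted.monotone-≤ l a∈ b∈ i i (All.lookup long a∈) (All.lookup long b∈)) s)

  private
    -- The item that continues first into row x + 1 is the last one of A whose value in row x is below its value there.
    first-removed : ∀ x {A a B C} → Lifted A → RowSorted x A → All (λ b → x < height b) A → A ↭ a ∷ B ++ C →
      All (λ b → suc x < height b) (a ∷ B) → All (λ b → ¬ suc x < height b) C → RowSorted (suc x) (a ∷ B) →
      ∃[ us ] ∃[ vs ] A ≡ us ++ a ∷ vs × us ++ vs ↭ B ++ C ×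
        All (λ b → value x b < value (suc x) a) us × value x a < value (suc x) a × All (λ b → ¬ value x b < value (suc x) a) vs
    first-removed x {a = a} {B} {C} l sorted deep perm long short (a-first ∷ _) with ∈.∈-∃++ (↭.∈-resp-↭ (↭-sym perm) (here refl))
    ... | us , vs , refl = us , vs , refl , rest , All.tabulate before , step , All.tabulate after
      where
      open Lifted l
      a∈ : a ∈ us ++ a ∷ vs
      a∈ = ∈.∈-++⁺ʳ us (here refl)
      rest : us ++ vs ↭ B ++ C
      rest = ↭.drop-∷ (↭-trans (↭-sym (↭.shift a us vs)) perm)
      step : value x a < value (suc x) a
      step = All.lookup strict a∈ x (All.head long)
      before : ∀ {b} → b ∈ us → value x b < value (suc x) a
      before b∈ = ℕ.≤-<-trans (monotone-≤ (∈.∈-++⁺ˡ b∈) a∈ x x (All.lookup deep (∈.∈-++⁺ˡ b∈)) (All.lookup deep a∈)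
        (All.lookup (proj₁ (proj₂ (AllPairs-remove us sorted))) b∈)) step
      -- Otherwise the element of `b` in row x would lie between those of `a` in rows x and x + 1.
      -- As `a` comes first in row x + 1, the item `b` either ends in row x or continues to the
      -- right of `a`; both are crossings.
      after : ∀ {b} → b ∈ vs → ¬ value x b < value (suc x) a
      after {b} b∈ lt = case suc x ℕ.<? height b of λ where
          (yes deeper) → Uncrossed.insideˡ uncrossed x (All.head long) deeper (lab , lab′ , next deeper)
          (no ¬deeper) → Uncrossed.endˡ uncrossed x (ℕ.≤-antisym (ℕ.≮⇒≥ ¬deeper) (All.lookup deep b∈A)) (All.head long) (lab , lab′)
        where
        b∈A = ∈.∈-++⁺ʳ us (there b∈)
        uncrossed = proj₁ (All.lookup (proj₂ (proj₂ (AllPairs-remove us separated))) b∈)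
        lab = All.lookup (proj₂ (proj₂ (AllPairs-remove us sorted))) b∈
        lab′ = monotone b∈A a∈ x (suc x) (All.lookup deep b∈A) (All.head long) lt
        next : suc x < height b → label (suc x) a < label (suc x) b
        next deeper with ∈.∈-++⁻ B (↭.∈-resp-↭ rest (∈.∈-++⁺ʳ us b∈))
        ... | inj₁ b∈B = All.lookup a-first b∈B
        ... | inj₂ b∈C = ⊥-elim (All.lookup short b∈C deeper)

    Lifted-remove : ∀ us {a vs} → Lifted (us ++ a ∷ vs) → Lifted (us ++ vs)
    Lifted-remove us {a} {vs} l = record
      { lengths = proj₁ (All-remove us lengths) ; strict = proj₁ (All-remove us strict) ; separated = proj₁ (AllPairs-remove us separated)
      ; monotone = λ a∈ b∈ → monotone (weaken a∈) (weaken b∈) }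
      where
      open Lifted l
      weaken : ∀ {b} → b ∈ us ++ vs → b ∈ us ++ a ∷ vs
      weaken b∈ with ∈.∈-++⁻ us b∈
      ... | inj₁ p = ∈.∈-++⁺ˡ p
      ... | inj₂ q = ∈.∈-++⁺ʳ us (there q)

    -- The continuing items are treated in the order of row x + 1. The place of the first one in `A`
    -- depends only on its new value and the values in row x, so by `split-unique` it has the same
    -- place in `A′`. It is removed from both lists, and the next one becomes the first. The items
    -- left at the end are those that stop in row x, and their prefixes still agree.
    extend-row : ∀ x {A A′ C C′} B B′ → Lifted A → Lifted A′ → RowSorted x A → RowSorted x A′ →
      All (λ b → x < height b) A → All (λ b → x < height b) A′ → A ↭ B ++ C → A′ ↭ B′ ++ C′ →
      All (λ b → suc x < height b) B → All (λ b → suc x < height b) B′ → All (λ b → ¬ suc x < height b) C → All (λ b → ¬ suc x < height b) C′ →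
      RowSorted (suc x) B → RowSorted (suc x) B′ →
      map (prefix (suc x)) A ≡ map (prefix (suc x)) A′ → map (value (suc x)) B ≡ map (value (suc x)) B′ →
      map (prefix (2 ℕ.+ x)) B ≡ map (prefix (2 ℕ.+ x)) B′ ×
      ∃[ D ] ∃[ D′ ] C ↭ D × C′ ↭ D′ × map (prefix (suc x)) D ≡ map (prefix (suc x)) D′
    extend-row x {A} {A′} [] [] l l′ s s′ d d′ perm perm′ long long′ short short′ t t′ p≡ v≡ =
      refl , A , A′ , ↭-sym perm , ↭-sym perm′ , p≡
    extend-row x (a ∷ B) (a′ ∷ B′) l l′ s s′ d d′ perm perm′ long long′ short short′ t t′ p≡ v≡
      with first-removed x l s d perm long short t | first-removed x l′ s′ d′ perm′ long′ short′ t′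
    ... | us , vs , refl , rest , q₁ , q₂ , q₃ | us′ , vs′ , refl , rest′ , q₁′ , q₂′ , q₃′
      with split-unique {Q = λ c → at x c < value (suc x) a} {us = map (prefix (suc x)) us} {us′ = map (prefix (suc x)) us′}
             (trans (sym (List.map-++ _ us (a ∷ vs))) (trans p≡ (List.map-++ _ us′ (a′ ∷ vs′))))
             (All.map⁺ (All.map (λ {b} → low b) q₁)) (low a q₂) (All.map⁺ (All.map (λ {b} → high b) q₃))
             (All.map⁺ (All.map (λ {b} → low b ∘ back) q₁′)) (low a′ (back q₂′)) (All.map⁺ (All.map (λ {b} h → high b (h ∘ forth)) q₃′))
      where
      va≡ : value (suc x) a ≡ value (suc x) a′
      va≡ = List.∷-injectiveˡ v≡
      low : ∀ b → value x b < value (suc x) a → at x (prefix (suc x) b) < value (suc x) a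
      low b = subst (_< value (suc x) a) (sym (at-take x (proj₂ b)))
      high : ∀ b → ¬ value x b < value (suc x) a → ¬ at x (prefix (suc x) b) < value (suc x) a
      high b h lt = h (subst (_< value (suc x) a) (at-take x (proj₂ b)) lt)
      back : ∀ {y} → y < value (suc x) a′ → y < value (suc x) a
      back = subst (_ <_) (sym va≡)
      forth : ∀ {y} → y < value (suc x) a → y < value (suc x) a′
      forth = subst (_ <_) va≡
    ... | us≡ , a≡ , vs≡ with extend-row x B B′ (Lifted-remove us l) (Lifted-remove us′ l′)
            (proj₁ (AllPairs-remove us s)) (proj₁ (AllPairs-remove us′ s′))
            (proj₁ (All-remove us d)) (proj₁ (All-remove us′ d′))
            rest rest′ (All.tail long) (All.tail long′) short short′ (AllPairs.tail t) (AllPairs.tail t′)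
            (trans (List.map-++ _ us vs) (trans (cong₂ _++_ us≡ vs≡) (sym (List.map-++ _ us′ vs′)))) (List.∷-injectiveʳ v≡)
    ... | B≡ , D , D′ , C↭D , C′↭D′ , D≡ = cong₂ _∷_ (take-suc-≡ (suc x) (proj₂ a) (proj₂ a′) (deep us l long) (deep us′ l′ long′) a≡ (List.∷-injectiveˡ v≡)) B≡ ,
          D , D′ , C↭D , C′↭D′ , D≡
      where
      deep : ∀ {a vs B} us → Lifted (us ++ a ∷ vs) → All (λ b → suc x < height b) (a ∷ B) → suc x < length (proj₂ a)
      deep {a} us l long = subst (suc x <_) (All.head (All.++⁻ʳ us (Lifted.lengths l))) (All.head long)

    Lifted-row : ∀ {A B C} → Lifted A → A ↭ B ++ C → Lifted B
    Lifted-row {B = B} l perm = Lifted-++ˡ B (Lifted-↭ perm l)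

    complete : ∀ k {A A′} → All (λ a → height a ≡ length (proj₂ a)) A → All (λ a → height a ≡ length (proj₂ a)) A′ →
      All (λ a → height a ≤ k) A → All (λ a → height a ≤ k) A′ → map (prefix k) A ≡ map (prefix k) A′ → map proj₂ A ≡ map proj₂ A′
    complete k {A} {A′} l l′ h h′ eq = trans (sym (whole l h)) (trans eq (whole l′ h′))
      where
      whole : ∀ {A} → All (λ a → height a ≡ length (proj₂ a)) A → All (λ a → height a ≤ k) A → map (prefix k) A ≡ map proj₂ A
      whole l h = List.map-cong-local (All.zipWith (λ {a} (e , le) → List.take-all k (proj₂ a) (subst (_≤ k) e le)) (l , h))

    frequency-row : ∀ i v {A B C} → A ↭ B ++ C → All (λ a → height a ≤ i) C → frequency i v A ≡ frequency i v B
    frequency-row i v {B = B} {C} perm short = trans (frequency-↭ i v perm) (trans (frequency-++ i v B C)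
      (trans (cong (frequency i v B ℕ.+_) (frequency-short i v C short)) (ℕ.+-identityʳ _)))

    -- Induction on the number `h` of further rows. Items that stop are complete columns, matched by
    -- their prefixes; those that continue form row x + 1, with equal prefixes that are one longer.
    columns-determined : ∀ h x {A A′} → Lifted A → Lifted A′ → RowSorted x A → RowSorted x A′ →
      All (λ a → x < height a) A → All (λ a → x < height a) A′ →
      All (λ a → height a ≤ suc x ℕ.+ h) A → All (λ a → height a ≤ suc x ℕ.+ h) A′ →
      map (prefix (suc x)) A ≡ map (prefix (suc x)) A′ →
      (∀ i v → x < i → frequency i v A ≡ frequency i v A′) → map proj₂ A ↭ map proj₂ A′
    columns-determined zero x l l′ s s′ d d′ b b′ p≡ f≡ = ↭-reflexive (complete (suc x) (Lifted.lengths l) (Lifted.lengths l′)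
      (All.map (λ le → ℕ.≤-trans le (ℕ.≤-reflexive (ℕ.+-identityʳ (suc x)))) b) (All.map (λ le → ℕ.≤-trans le (ℕ.≤-reflexive (ℕ.+-identityʳ (suc x)))) b′) p≡)
    columns-determined (suc h) x {A} {A′} l l′ s s′ d d′ b b′ p≡ f≡ with row (suc x) A l | row (suc x) A′ l′
    ... | B , C , perm , long , short , t | B′ , C′ , perm′ , long′ , short′ , t′
      with extend-row x B B′ l l′ s s′ d d′ perm perm′ long long′ short short′ t t′ p≡
             (row-values (suc x) (Lifted-row l perm) (Lifted-row l′ perm′) t t′ long long′ (λ v → f≡′ (suc x) v (ℕ.n<1+n x) ℕ.≤-refl))
      where
      f≡′ : ∀ i v → x < i → suc x ≤ i → frequency i v B ≡ frequency i v B′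
      f≡′ i v lt le = trans (sym (frequency-row i v perm (All.map (λ nlt → ℕ.≤-trans (ℕ.≮⇒≥ nlt) le) short)))
        (trans (f≡ i v lt) (frequency-row i v perm′ (All.map (λ nlt → ℕ.≤-trans (ℕ.≮⇒≥ nlt) le) short′)))
    ... | B≡ , D , D′ , C↭D , C′↭D′ , D≡ = ↭-trans (↭.map⁺ proj₂ perm) (↭-trans (↭-reflexive (List.map-++ proj₂ B C))
        (↭-trans (↭.++⁺ first second) (↭-trans (↭-reflexive (sym (List.map-++ proj₂ B′ C′))) (↭-sym (↭.map⁺ proj₂ perm′)))))
      where
      f≡″ : ∀ i v → suc x < i → frequency i v B ≡ frequency i v B′
      f≡″ i v lt = trans (sym (frequency-row i v perm (All.map (λ nlt → ℕ.≤-trans (ℕ.≮⇒≥ nlt) (ℕ.<⇒≤ lt)) short)))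
        (trans (f≡ i v (ℕ.<-trans (ℕ.n<1+n x) lt)) (frequency-row i v perm′ (All.map (λ nlt → ℕ.≤-trans (ℕ.≮⇒≥ nlt) (ℕ.<⇒≤ lt)) short′)))
      bounded : ∀ {A B C} → A ↭ B ++ C → All (λ a → height a ≤ suc x ℕ.+ suc h) A → All (λ a → height a ≤ 2 ℕ.+ x ℕ.+ h) B
      bounded {B = B} perm b = All.map (λ le → ℕ.≤-trans le (ℕ.≤-reflexive (ℕ.+-suc (suc x) h))) (All.++⁻ˡ B (↭.All-resp-↭ perm b))
      first : map proj₂ B ↭ map proj₂ B′
      first = columns-determined h (suc x) (Lifted-row l perm) (Lifted-row l′ perm′) t t′ long long′
        (bounded perm b) (bounded perm′ b′) B≡ f≡″
      rest : ∀ {A B C D} → Lifted A → A ↭ B ++ C → C ↭ D → All (λ a → height a ≡ length (proj₂ a)) D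
      rest {B = B} l perm C↭D = ↭.All-resp-↭ C↭D (All.++⁻ʳ B (↭.All-resp-↭ perm (Lifted.lengths l)))
      second : map proj₂ C ↭ map proj₂ C′
      second = ↭-trans (↭.map⁺ proj₂ C↭D) (↭-trans (↭-reflexive (complete (suc x) (rest l perm C↭D) (rest l′ perm′ C′↭D′)
        (↭.All-resp-↭ C↭D (All.map ℕ.≮⇒≥ short)) (↭.All-resp-↭ C′↭D′ (All.map ℕ.≮⇒≥ short′)) D≡)) (↭-sym (↭.map⁺ proj₂ C′↭D′)))

  -- In row 0 the prefixes of length 1 consist of the sorted values, so the row content alone starts
  -- the induction of `columns-determined`.
  Lifted-unique : ∀ h {A A′} → Lifted A → Lifted A′ → All (λ a → 0 < height a) A → All (λ a → 0 < height a) A′ →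
    All (λ a → height a ≤ suc h) A → All (λ a → height a ≤ suc h) A′ →
    (∀ i v → frequency i v A ≡ frequency i v A′) → map proj₂ A ↭ map proj₂ A′
  Lifted-unique h {A} {A′} l l′ pos pos′ b b′ f≡ with sortRow l pos b | sortRow l′ pos′ b′
    where
    sortRow : ∀ {A} → Lifted A → All (λ a → 0 < height a) A → All (λ a → height a ≤ suc h) A →
      ∃[ B ] A ↭ B × Lifted B × RowSorted 0 B × All (λ a → 0 < height a) B × All (λ a → height a ≤ suc h) B
    sortRow {A} l pos b with sortBy (label 0) A
    ... | B , perm , sorted = B , perm , lB , AllPairs-∈ (λ a∈ b∈ (le , _ , h) → ℕ.≤∧≢⇒< le (h 0 (All.lookup posB a∈) (All.lookup posB b∈)))
            (AllPairs.zip (sorted , Lifted.separated lB)) , posB , ↭.All-resp-↭ perm b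
      where
      lB = Lifted-↭ perm l
      posB = ↭.All-resp-↭ perm pos
  ... | B , perm , lB , s , d , c | B′ , perm′ , lB′ , s′ , d′ , c′ =
    ↭-trans (↭.map⁺ proj₂ perm) (↭-trans (columns-determined h 0 lB lB′ s s′ d d′ c c′ (firsts B B′ (Lifted.lengths lB) (Lifted.lengths lB′) d d′
        (row-values 0 lB lB′ s s′ d d′ (f≡′ 0))) (λ i v _ → f≡′ i v)) (↭-sym (↭.map⁺ proj₂ perm′)))
    where
    f≡′ : ∀ i v → frequency i v B ≡ frequency i v B′
    f≡′ i v = trans (sym (frequency-↭ i v perm)) (trans (f≡ i v) (frequency-↭ i v perm′))
    firsts : ∀ B B′ → All (λ a → height a ≡ length (proj₂ a)) B → All (λ a → height a ≡ length (proj₂ a)) B′ →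
      All (λ a → 0 < height a) B → All (λ a → 0 < height a) B′ → map (value 0) B ≡ map (value 0) B′ → map (prefix 1) B ≡ map (prefix 1) B′
    firsts []      []        _        _          _        _          _  = refl
    firsts (a ∷ B) (a′ ∷ B′) (e ∷ es) (e′ ∷ es′) (p ∷ ps) (p′ ∷ ps′) eq = cong₂ _∷_
      (take-suc-≡ 0 (proj₂ a) (proj₂ a′) (subst (0 <_) e p) (subst (0 <_) e′ p′) refl (List.∷-injectiveˡ eq))
      (firsts B B′ es es′ ps ps′ (List.∷-injectiveʳ eq))

-- Minors indexed by lists, products of cells, and spans

module ListMinors (R : CommutativeRing 0ℓ 0ℓ) (n r : ℕ) where

  private module R = CommutativeRing R
  open Homogeneity R n r
  private module P = CommutativeRing polynomialCommutativeRing

  rowDet-resize : ∀ {V : Set} (Y : ℕ → V → Polynomial) {k k′} (eq : k ≡ k′) (e : Fin k → V) (e′ : Fin k′ → V) →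
    (∀ j → e j ≡ e′ (Fin.cast eq j)) → rowDet Y e ≈ rowDet Y e′
  rowDet-resize Y refl e e′ h = rowDet-cong Y λ j → trans (h j) (cong e′ (Fin.cast-is-id refl j))

  minor-tabulate : ∀ {k} (e : Fin k → Fin r) → rowDet X e ≈ minor (List.tabulate e)
  minor-tabulate {k} e = rowDet-resize X (sym (List.length-tabulate e)) e (lookup (List.tabulate e)) λ j →
    sym (List.lookup-tabulate e j)

  AdjacentEqual : List (Fin r) → Set
  AdjacentEqual J = ∃[ us ] ∃[ v ] ∃[ vs ] J ≡ us ++ v ∷ v ∷ vs

  minor-adjacentEqual : ∀ {J} → AdjacentEqual J → minor J ≈ 0#
  minor-adjacentEqual (us , v , vs , refl) = go us
    where
    position : ∀ us → Σ (Fin (length (us ++ v ∷ vs))) λ j → ∃[ eq ]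
      lookup (us ++ v ∷ v ∷ vs) (Fin.cast eq (inject₁ j)) ≡ lookup (us ++ v ∷ v ∷ vs) (Fin.cast eq (suc j))
    position []       = zero , refl , sym (cong (lookup (v ∷ vs)) (Fin.cast-is-id refl zero))
    position (u ∷ us) = let j , eq , h = position us in suc j , cong suc eq , h
    go : ∀ us → minor (us ++ v ∷ v ∷ vs) ≈ 0#
    go us with position us
    ... | j , eq , h = λ m → R.trans (R.sym (rowDet-resize X eq (lookup (us ++ v ∷ v ∷ vs) ∘ Fin.cast eq) (lookup (us ++ v ∷ v ∷ vs)) (λ _ → refl) m))
      (rowDet-equalColumns X (lookup (us ++ v ∷ v ∷ vs) ∘ Fin.cast eq) j h m)

  bideterminant-zero : ∀ {Js} → Any (λ J → minor J ≈ 0#) Js → bideterminant Js ≈ 0#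
  bideterminant-zero {J ∷ Js} (here h)  m = R.trans (P.*-cong {minor J} {0#} {bideterminant Js} {bideterminant Js} h (≈-refl (bideterminant Js)) m) (P.zeroˡ (bideterminant Js) m)
  bideterminant-zero {J ∷ Js} (there h) m = R.trans (P.*-cong {minor J} {minor J} {bideterminant Js} {0#} (≈-refl (minor J)) (bideterminant-zero h) m) (P.zeroʳ (minor J) m)

  -- In a weakly increasing list a repetition occurs in adjacent places, which is the case that
  -- `rowDet-equalColumns` covers.
  linked-≤ : ∀ J → Linked Fin._≤_ J → Linked Fin._<_ J ⊎ AdjacentEqual J
  linked-≤ []          []       = inj₁ []
  linked-≤ (x ∷ [])    [-]      = inj₁ [-]
  linked-≤ (x ∷ y ∷ J) (le ∷ h) with linked-≤ (y ∷ J) h | x Fin.≟ y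
  ... | inj₂ (us , v , vs , eq) | _        = inj₂ (x ∷ us , v , vs , cong (x ∷_) eq)
  ... | inj₁ _                  | yes refl = inj₂ ([] , x , J , refl)
  ... | inj₁ h′                 | no neq   = inj₁ (ℕ.≤∧≢⇒< le (neq ∘ Fin.toℕ-injective) ∷ h′)

  cellProduct : List (ℕ × Fin r) → Monomial
  cellProduct = foldr (λ (s , v) m → cell s v · m) one

  cellProduct-++ : ∀ cs cs′ → cellProduct (cs ++ cs′) ≡ cellProduct cs · cellProduct cs′
  cellProduct-++ []             cs′ = sym (·-identityˡ _)
  cellProduct-++ ((s , v) ∷ cs) cs′ = trans (cong (cell s v ·_) (cellProduct-++ cs cs′)) (sym (·-assoc (cell s v) (cellProduct cs) (cellProduct cs′)))

  cellProduct-↭ : ∀ {cs cs′} → cs ↭ cs′ → cellProduct cs ≡ cellProduct cs′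
  cellProduct-↭ ↭.refl                     = refl
  cellProduct-↭ (↭.prep (s , v) h)         = cong (cell s v ·_) (cellProduct-↭ h)
  cellProduct-↭ {cs′ = _ ∷ _ ∷ cs} (↭.swap (s , v) (s′ , v′) h) = trans (cong (λ m → cell s v · (cell s′ v′ · m)) (cellProduct-↭ h))
    (trans (sym (·-assoc (cell s v) (cell s′ v′) (cellProduct cs))) (trans (cong (_· cellProduct cs) (·-comm (cell s v) (cell s′ v′)))
      (·-assoc (cell s′ v′) (cell s v) (cellProduct cs))))
  cellProduct-↭ (↭.trans h h′)             = trans (cellProduct-↭ h) (cellProduct-↭ h′)

  leadingMonomial-cells : ∀ Js → leadingMonomial Js ≡ cellProduct (allCells Js)
  leadingMonomial-cells []       = refl
  leadingMonomial-cells (J ∷ Js) = trans (cong₂ _·_ (column 0 J) (leadingMonomial-cells Js)) (sym (cellProduct-++ (cells 0 J) (allCells Js)))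
    where
    column : ∀ s J → columnMonomial s J ≡ cellProduct (cells s J)
    column s []      = refl
    column s (v ∷ J) = cong (cell s v ·_) (column (suc s) J)

  cellProduct-⟦⟧ : ∀ cs i j → cellProduct cs ⟦ i , j ⟧ ≡ ListAction.sum (map (λ (s , v) → kronecker s (toℕ i) ℕ.* kronecker (toℕ v) (toℕ j)) cs)
  cellProduct-⟦⟧ []             i j = one-⟦⟧ i j
  cellProduct-⟦⟧ ((s , v) ∷ cs) i j = trans (·-⟦⟧ (cell s v) (cellProduct cs) i j) (cong₂ ℕ._+_ (cell-⟦⟧ s v i j) (cellProduct-⟦⟧ cs i j))

  cellProduct-word : ∀ w → cellProduct (List.tabulate λ t → toℕ (Vec.lookup w t) , t) ≡ wordMonomial w
  cellProduct-word w = monomial-ext λ i j → trans (cellProduct-⟦⟧ (List.tabulate λ t → toℕ (Vec.lookup w t) , t) i j)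
    (trans (cong ListAction.sum (List.map-tabulate (λ t → toℕ (Vec.lookup w t) , t) (λ (s , v) → kronecker s (toℕ i) ℕ.* kronecker (toℕ v) (toℕ j))))
    (trans (sum-tabulate λ t → kronecker (toℕ (Vec.lookup w t)) (toℕ i) ℕ.* kronecker (toℕ t) (toℕ j))
      (trans (sumℕ-cong λ t → cong (kronecker (toℕ (Vec.lookup w t)) (toℕ i) ℕ.*_) (kronecker-sym (toℕ t) (toℕ j)))
        (trans (sumℕ-kronecker j λ t → kronecker (toℕ (Vec.lookup w t)) (toℕ i)) (sym (wordMonomial-⟦⟧ w i j))))))

  ⟪⟫-linear : ∀ φ c p q → ⟪ φ ⟫ (c • p + q) R.≈ c R.* ⟪ φ ⟫ p R.+ ⟪ φ ⟫ q
  ⟪⟫-linear φ c p q = R.trans (⟪⟫-++ φ (c • p) q) (R.+-congʳ (⟪⟫-• φ c p))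

  coefficient-+ : ∀ p q m → coefficient (p + q) m R.≈ coefficient p m R.+ coefficient q m
  coefficient-+ p q m = R.trans (coefficient-⟪⟫ (p + q) m) (R.trans (⟪⟫-++ (indicator m) p q)
    (R.+-cong (R.sym (coefficient-⟪⟫ p m)) (R.sym (coefficient-⟪⟫ q m))))

  coefficient-• : ∀ c p m → coefficient (c • p) m R.≈ c R.* coefficient p m
  coefficient-• c p m = R.trans (coefficient-⟪⟫ (c • p) m) (R.trans (⟪⟫-• (indicator m) c p) (R.*-congˡ (R.sym (coefficient-⟪⟫ p m))))

  module Spans {I : Set} (f : I → Polynomial) where

    Span-≈ : ∀ {p q} → p ≈ q → Span f q → Span f p
    Span-≈ h (ts , eq) = ts , λ m → R.trans (h m) (eq m)

    Span-0 : Span f 0#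
    Span-0 = [] , λ m → R.refl

    Span-generator : ∀ i → Span f (f i)
    Span-generator i = (R.1# , i) ∷ [] , λ m → R.sym (R.trans (coefficient-+ (R.1# • f i) 0# m)
      (R.trans (R.+-identityʳ _) (R.trans (coefficient-• R.1# (f i) m) (R.*-identityˡ _))))

    combination-++ : ∀ ts us m → coefficient (combination f (ts ++ us)) m R.≈ coefficient (combination f ts) m R.+ coefficient (combination f us) m
    combination-++ []             us m = R.sym (R.+-identityˡ _)
    combination-++ ((c , i) ∷ ts) us m = R.trans (coefficient-+ (c • f i) (combination f (ts ++ us)) m)
      (R.trans (R.+-congˡ (combination-++ ts us m)) (R.trans (R.sym (R.+-assoc _ _ _))
        (R.+-congʳ (R.sym (coefficient-+ (c • f i) (combination f ts) m)))))

    combination-• : ∀ a ts m → coefficient (combination f (map (λ (c , i) → a R.* c , i) ts)) m R.≈ a R.* coefficient (combination f ts) m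
    combination-• a []             m = R.sym (R.zeroʳ a)
    combination-• a ((c , i) ∷ ts) m = R.trans (coefficient-+ ((a R.* c) • f i) _ m) (R.trans
      (R.+-cong (R.trans (coefficient-• (a R.* c) (f i) m) (R.trans (R.*-assoc a c _) (R.*-congˡ (R.sym (coefficient-• c (f i) m)))))
        (combination-• a ts m)) (R.trans (R.sym (R.distribˡ a _ _)) (R.*-congˡ (R.sym (coefficient-+ (c • f i) (combination f ts) m)))))

    Span-linear : ∀ a {p q} → Span f p → Span f q → Span f (a • p + q)
    Span-linear a {p} {q} (ts , eq) (us , eq′) = map (λ (c , i) → a R.* c , i) ts ++ us , λ m →
      R.trans (coefficient-+ (a • p) q m) (R.trans (R.+-cong (R.trans (coefficient-• a p m) (R.*-congˡ (eq m))) (eq′ m))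
        (R.sym (R.trans (combination-++ (map _ ts) us m) (R.+-congʳ (combination-• a ts m)))))

    Span-combination : ∀ {J : Set} (g : J → Polynomial) → (∀ j → Span f (g j)) → ∀ ts → Span f (combination g ts)
    Span-combination g h []             = Span-0
    Span-combination g h ((c , j) ∷ ts) = Span-linear c {g j} {combination g ts} (h j) (Span-combination g h ts)

-- Substituting values for labels

module Specialization (R : CommutativeRing 0ℓ 0ℓ) (n N r : ℕ) (v : Fin N → Fin r) where

  private
    module R = CommutativeRing R
    module A = Homogeneity R n N
    module AL = ListMinors R n N
  open Homogeneity R n r
  open ListMinors R n r
  private
    module P = CommutativeRing polynomialCommutativeRing
    module AP = CommutativeRing A.polynomialCommutativeRing

  -- The exponents after the substitution of x_{i,v t} for x_{i,t}: columns of exponents with the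
  -- same value are added.
  merge : A.Monomial → Monomial
  merge m = monomial λ i j → sumℕ λ t → m A.⟦ i , t ⟧ ℕ.* kronecker (toℕ (v t)) (toℕ j)

  merge-· : ∀ m m′ → merge (m A.· m′) ≡ merge m · merge m′
  merge-· m m′ = monomial-ext λ i j → trans (monomial-⟦⟧ _ i j) (trans
    (sumℕ-cong λ t → trans (cong (ℕ._* kronecker (toℕ (v t)) (toℕ j)) (A.·-⟦⟧ m m′ i t)) (ℕ.*-distribʳ-+ (kronecker (toℕ (v t)) (toℕ j)) (m A.⟦ i , t ⟧) _))
    (trans (sumℕ-+ (λ t → m A.⟦ i , t ⟧ ℕ.* kronecker (toℕ (v t)) (toℕ j)) (λ t → m′ A.⟦ i , t ⟧ ℕ.* kronecker (toℕ (v t)) (toℕ j)))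
      (sym (trans (·-⟦⟧ (merge m) (merge m′) i j) (cong₂ ℕ._+_ (monomial-⟦⟧ _ i j) (monomial-⟦⟧ _ i j))))))

  merge-one : merge A.one ≡ one
  merge-one = monomial-ext λ i j → trans (monomial-⟦⟧ _ i j) (trans
    (sumℕ-0 λ t → cong (ℕ._* kronecker (toℕ (v t)) (toℕ j)) (A.one-⟦⟧ i t)) (sym (one-⟦⟧ i j)))

  merge-cell : ∀ s t → merge (A.cell s t) ≡ cell s (v t)
  merge-cell s t = monomial-ext λ i j → trans (monomial-⟦⟧ _ i j) (trans
    (sumℕ-cong λ t′ → trans (cong (ℕ._* kronecker (toℕ (v t′)) (toℕ j)) (A.cell-⟦⟧ s t i t′)) (swap (kronecker s (toℕ i)) _ _))
    (trans (sumℕ-kronecker t (λ t′ → kronecker s (toℕ i) ℕ.* kronecker (toℕ (v t′)) (toℕ j))) (sym (cell-⟦⟧ s (v t) i j))))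
    where
    swap : ∀ a b c → (a ℕ.* b) ℕ.* c ≡ (a ℕ.* c) ℕ.* b
    swap a b c = trans (ℕ.*-assoc a b c) (trans (cong (a ℕ.*_) (ℕ.*-comm b c)) (sym (ℕ.*-assoc a c b)))

  specialize : A.Polynomial → Polynomial
  specialize = map λ (c , m) → c , merge m

  ⟪⟫-specialize : ∀ φ p → ⟪ φ ⟫ (specialize p) R.≈ A.⟪ (φ ∘ merge) ⟫ p
  ⟪⟫-specialize φ []            = R.refl
  ⟪⟫-specialize φ ((c , m) ∷ p) = R.+-congˡ (⟪⟫-specialize φ p)

  specialize-≈ : ∀ p q → p A.≈ q → specialize p ≈ specialize q
  specialize-≈ p q h = ⟪⟫-ext {specialize p} {specialize q} λ φ →
    R.trans (⟪⟫-specialize φ p) (R.trans (A.⟪⟫-resp (φ ∘ merge) p q h) (R.sym (⟪⟫-specialize φ q)))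

  specialize-+ : ∀ p q → specialize (p A.+ q) ≈ specialize p + specialize q
  specialize-+ p q m = R.reflexive (cong (λ t → coefficient t m) (List.map-++ _ p q))

  specialize-neg : ∀ p → specialize (A.- p) ≈ - specialize p
  specialize-neg p m = R.reflexive (cong (λ t → coefficient t m) (trans (sym (List.map-∘ p)) (List.map-∘ p)))

  specialize-1 : specialize A.1# ≈ 1#
  specialize-1 m = R.reflexive (cong (λ t → coefficient ((R.1# , t) ∷ []) m) merge-one)

  specialize-* : ∀ p q → specialize (p A.* q) ≈ specialize p * specialize q
  specialize-* p q = ⟪⟫-ext {specialize (p A.* q)} {specialize p * specialize q} λ φ →
    R.trans (⟪⟫-specialize φ (p A.* q)) (R.trans (A.⟪⟫-product (φ ∘ merge) p q) (R.sym
      (R.trans (⟪⟫-product φ (specialize p) (specialize q)) (R.trans (⟪⟫-specialize _ p)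
        (A.⟪⟫-cong (λ m → R.trans (⟪⟫-specialize _ q) (A.⟪⟫-cong (λ m′ → R.reflexive (cong φ (sym (merge-· m m′)))) q)) p)))))

  specialize-minor : ∀ J → specialize (A.minor J) ≈ minor (map v J)
  specialize-minor J m = R.trans
    (DeterminantHomomorphism.h-det A.polynomialCommutativeRing polynomialCommutativeRing specialize (≈-refl 0#) specialize-1
      specialize-+ specialize-neg specialize-* (λ a b → A.X (toℕ a) (lookup J b)) m)
    (R.trans (det-cong {A = λ a b → specialize (A.X (toℕ a) (lookup J b))} {B = λ a b → X (toℕ a) (v (lookup J b))}
        (λ a b m → R.reflexive (cong (λ t → coefficient ((R.1# , t) ∷ []) m) (merge-cell (toℕ a) (lookup J b)))) m)
      (rowDet-resize X (sym (List.length-map v J)) (v ∘ lookup J) (lookup (map v J)) (λ j → sym (mapped J j)) m))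
    where
    mapped : ∀ J j → lookup (map v J) (Fin.cast (sym (List.length-map v J)) j) ≡ v (lookup J j)
    mapped (x ∷ J) zero    = refl
    mapped (x ∷ J) (suc j) = mapped J j

  specialize-bideterminant : ∀ Js → specialize (A.bideterminant Js) ≈ bideterminant (map (map v) Js)
  specialize-bideterminant []       = specialize-1
  specialize-bideterminant (J ∷ Js) m = R.trans (specialize-* (A.minor J) (A.bideterminant Js) m)
    (P.*-cong {specialize (A.minor J)} {minor (map v J)} {specialize (A.bideterminant Js)} {bideterminant (map (map v) Js)}
      (specialize-minor J) (specialize-bideterminant Js) m)

  specialize-combination : ∀ {I : Set} (f : I → A.Polynomial) ts → specialize (A.combination f ts) ≈ combination (specialize ∘ f) ts
  specialize-combination f []             m = R.refl
  specialize-combination f ((c , i) ∷ ts) m = R.trans (specialize-+ (c A.• f i) (A.combination f ts) m)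
    (R.trans (coefficient-+ (specialize (c A.• f i)) (specialize (A.combination f ts)) m)
      (R.trans (R.+-cong (R.reflexive (cong (λ t → coefficient t m) (trans (sym (List.map-∘ (f i))) (List.map-∘ (f i)))))
          (specialize-combination f ts m))
        (R.sym (coefficient-+ (c • specialize (f i)) (combination (specialize ∘ f) ts) m))))

-- Straightening multiplicity-free bideterminants

toList-split : ∀ {A : Set} {N} (w : Vec A N) as bs → Vec.toList w ≡ as ++ bs →
  Σ (length as ℕ.+ length bs ≡ N) λ eq → subst (Vec A) eq (Vec.fromList as Vec.++ Vec.fromList bs) ≡ w
toList-split []      []       []       _ = refl , refl
toList-split (x ∷ w) []       (b ∷ bs) h with List.∷-injective h
... | refl , h′ with toList-split w [] bs h′
...   | refl , refl = refl , refl
toList-split (x ∷ w) (a ∷ as) bs       h with List.∷-injective h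
... | refl , h′ with toList-split w as bs h′
...   | refl , refl = refl , refl

searchWord : ∀ {n} N {Q : Vec (Fin n) N → Set} → (∀ w → Dec (Q w)) → Dec (∃ Q)
searchWord zero    Q? with Q? []
... | yes q = yes ([] , q)
... | no ¬q = no λ { ([] , q) → ¬q q }
searchWord (suc N) Q? with Fin.any? (λ x → searchWord N (λ u → Q? (x ∷ u)))
... | yes (x , u , q) = yes (x ∷ u , q)
... | no ¬q = no λ { (x ∷ u , q) → ¬q (x , u , q) }

AllPairs-members : ∀ {A : Set} {Q : A → A → Set} {xs} → AllPairs Q xs → ∀ {a b} → a ∈ xs → b ∈ xs → a ≢ b → Q a b ⊎ Q b a
AllPairs-members (q ∷ qs) (here refl) (here refl) neq = ⊥-elim (neq refl)
AllPairs-members (q ∷ qs) (here refl) (there b∈)  neq = inj₁ (All.lookup q b∈)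
AllPairs-members (q ∷ qs) (there a∈)  (here refl) neq = inj₂ (All.lookup q a∈)
AllPairs-members (q ∷ qs) (there a∈)  (there b∈)  neq = AllPairs-members qs a∈ b∈ neq

module ColumnLengths (Λ : Partition) where

  open Partition Λ

  columnLength-positive : ∀ c → 0 < columnLength c
  columnLength-positive c = go parts (Fin.toℕ<n c)
    where
    go : ∀ ps {c} → c < foldr ℕ._⊔_ 0 ps → 0 < length (filter (c ℕ.<?_) ps)
    go (p ∷ ps) {c} lt with c ℕ.<? p
    ... | yes c<p = subst (λ xs → 0 < length xs) (sym (List.filter-accept (c ℕ.<?_) c<p)) (s≤s z≤n)
    ... | no c≮p  = subst (λ xs → 0 < length xs) (sym (List.filter-reject (c ℕ.<?_) c≮p))
                      (go ps (subst (c <_) (ℕ.m≤n⇒m⊔n≡n (ℕ.<⇒≤ (ℕ.≤-<-trans (ℕ.≮⇒≥ c≮p) (below lt)))) lt))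
      where
      below : c < p ℕ.⊔ foldr ℕ._⊔_ 0 ps → c < foldr ℕ._⊔_ 0 ps
      below lt with ℕ.⊔-sel p (foldr ℕ._⊔_ 0 ps)
      ... | inj₁ eq = ⊥-elim (c≮p (subst (c <_) eq lt))
      ... | inj₂ eq = subst (c <_) eq lt

  columnLengths-bounds : ∀ {n} → rows ≤ n → All (λ l → 0 < l × l ≤ n) columnLengths
  columnLengths-bounds rows≤n = All.tabulate⁺ λ c → columnLength-positive c , ℕ.≤-trans (columnLength≤rows c) rows≤n

module Straightening (R : CommutativeRing 0ℓ 0ℓ) (torsionFree : TorsionFree R) (n : ℕ) (Λ : Partition)
                     (rows≤n : Partition.rows Λ ≤ n) where

  open Partition Λ using (columnLengths) renaming (size to N)
  open ColumnLengths Λ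
  private module R = CommutativeRing R
  open Homogeneity R n N
  open ListMinors R n N

  MultiplicityFreeNCT : Set
  MultiplicityFreeNCT = Σ (List (List (Fin N))) (IsMultiplicityFreeNCT Λ)

  open Spans {MultiplicityFreeNCT} (bideterminant ∘ proj₁)

  private
    B = 2 ℕ.+ n

    β : Fin N → ℕ
    β t = B ℕ.^ toℕ t

    β-increasing : ∀ {u v} → u Fin.< v → β u < β v
    β-increasing = ℕ.^-monoʳ-< B (s≤s (s≤s z≤n))

  open Leading β β-increasing

  weight-word : ∀ w → weight (wordMonomial w) ≡ base w
  weight-word w = trans (sumℕ-cong λ i → sumℕ-cong λ t → cong (toℕ i ℕ.* β t ℕ.*_) (wordMonomial-⟦⟧ w i t))
    (trans (sumℕ-comm {n} {N} λ i t → toℕ i ℕ.* β t ℕ.* kronecker (toℕ (Vec.lookup w t)) (toℕ i))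
      (trans (sumℕ-cong λ t → sumℕ-kronecker (Vec.lookup w t) (λ i → toℕ i ℕ.* β t)) (digits w)))
    where
    digits : ∀ {k} (w : Vec (Fin n) k) → sumℕ (λ t → toℕ (Vec.lookup w t) ℕ.* B ℕ.^ toℕ t) ≡ base w
    digits []      = refl
    digits (x ∷ w) = cong₂ ℕ._+_ (ℕ.*-identityʳ (toℕ x)) (trans
      (sumℕ-cong λ t → trans (cong (toℕ (Vec.lookup w t) ℕ.*_) (ℕ.*-comm B (B ℕ.^ toℕ t))) (sym (ℕ.*-assoc (toℕ (Vec.lookup w t)) (B ℕ.^ toℕ t) B)))
      (trans (sumℕ-*ʳ (λ t → toℕ (Vec.lookup w t) ℕ.* B ℕ.^ toℕ t) B) (trans (cong (ℕ._* B) (digits w)) (ℕ.*-comm (base w) B))))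

  content : Fin n → ℕ
  content i = ListAction.sum (map (less (toℕ i)) columnLengths)

  longer-content : ∀ (Js : List (List (Fin N))) → map length Js ↭ columnLengths → ∀ i → longer i Js ≡ ListAction.sum (map (less i) columnLengths)
  longer-content Js h i = trans (cong ListAction.sum (List.map-∘ Js)) (ListAction.sum-↭ (↭.map⁺ (less i) h))

  -- The properties of multiplicity-free bideterminants of shape λ that determine their span.
  record HighestWeight (p : Polynomial) : Set where
    field
      columns : ∀ t → Terms (λ m → columnDegree t m ≡ 1) p
      rows    : ∀ i → Terms (λ m → rowDegree i m ≡ content i) p
      killed  : ∀ i i′ (eq : toℕ i′ ≡ suc (toℕ i)) → Lowering.δ R n N i i′ eq p ≈ 0#

  lengths≤n : ∀ {Js : List (List (Fin N))} → map length Js ↭ columnLengths → All (λ J → length J ≤ n) Js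
  lengths≤n h = All.map proj₂ (All.map⁻ (↭.All-resp-↭ (↭-sym h) (columnLengths-bounds rows≤n)))

  bideterminant-highestWeight : ∀ Js → concat Js ↭ allFin N → map length Js ↭ columnLengths → HighestWeight (bideterminant Js)
  bideterminant-highestWeight Js labels sizes = record
    { columns = λ t → All.map (λ h → trans h (trans (occurrences-↭ t labels) (occurrences-allFin t))) (bideterminant-columnDegree t (lengths≤n sizes))
    ; rows    = λ i → All.map (λ h → trans h (longer-content Js sizes (toℕ i))) (bideterminant-rowDegree i (lengths≤n sizes))
    ; killed  = λ i i′ eq → Lowering.bideterminant-killed R n N i i′ eq Js
    }

  HighestWeight-linear : ∀ c {p q} → HighestWeight p → HighestWeight q → HighestWeight (c • p + q)
  HighestWeight-linear c {p} {q} hp hq = record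
    { columns = λ t → All.++⁺ (Terms-scale c (columns hp t)) (columns hq t)
    ; rows    = λ i → All.++⁺ (Terms-scale c (rows hp i)) (rows hq i)
    ; killed  = killed′
    }
    where
    open HighestWeight
    killed′ : ∀ i i′ (eq : toℕ i′ ≡ suc (toℕ i)) → Lowering.δ R n N i i′ eq (c • p + q) ≈ 0#
    killed′ i i′ eq = ⟪⟫-ext {δ (c • p + q)} {0#} λ φ → R.trans (⟪⟫-δ φ (c • p + q)) (R.trans (⟪⟫-linear (δ* φ) c p q)
      (R.trans (R.+-cong (R.trans (R.*-congˡ (vanish φ p (killed hp i i′ eq))) (R.zeroʳ c)) (vanish φ q (killed hq i i′ eq))) (R.+-identityˡ _)))
      where
      open Lowering R n N i i′ eq
      vanish : ∀ φ p → δ p ≈ 0# → ⟪ δ* φ ⟫ p R.≈ R.0#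
      vanish φ p h = R.trans (R.sym (⟪⟫-δ φ p)) (⟪⟫-resp φ (δ p) 0# h)

  -- Only word monomials have all column degrees 1; any other monomial is not listed in `p` at all.
  highestWeight-zero : ∀ {p} → HighestWeight p → (∀ w → coefficient p (wordMonomial w) R.≈ R.0#) → p ≈ 0#
  highestWeight-zero {p} h vanish m with Fin.all? (λ t → columnDegree t m ℕ.≟ 1)
  ... | yes all1 = let w , eq = columnDegree-1⇒word m all1 in subst (λ m → coefficient p m R.≈ R.0#) eq (vanish w)
  ... | no ¬all1 with Fin.¬∀⟶∃¬ N _ (λ t → columnDegree t m ℕ.≟ 1) ¬all1
  ...   | t , neq = coefficient-absent (HighestWeight.columns h t) m neq

  word : Vec (Fin n) N → List (Fin n × Fin N)
  word w = List.tabulate λ t → Vec.lookup w t , t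

  word-letters : ∀ w → map proj₁ (word w) ≡ Vec.toList w
  word-letters w = trans (List.map-tabulate (λ t → Vec.lookup w t , t) proj₁) (letters w)
    where
    letters : ∀ {k} (w : Vec (Fin n) k) → List.tabulate (Vec.lookup w) ≡ Vec.toList w
    letters []      = refl
    letters (x ∷ w) = cong (x ∷_) (letters w)

  built-labels : ∀ w {Bs} → Partial (word w) Bs → concat Bs ↭ allFin N
  built-labels w {Bs} h = ↭-trans (↭-reflexive (sym (allCells-labels Bs))) (↭-trans (↭.map⁺ proj₂ (Partial.contents h))
    (↭-reflexive (trans (sym (List.map-∘ (word w))) (List.map-tabulate (λ t → Vec.lookup w t , t) proj₂))))

  -- The blocks with an element in row i are counted by the letters i of `w`, and `content` counts
  -- the columns of λ that reach row i. The family `Js` stands for the shape, so that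
  -- `longer⇒lengths-↭` can recover the lengths from these numbers.
  built-sizes : ∀ w {Bs} (Js : List (List (Fin N))) → map length Js ↭ columnLengths → Partial (word w) Bs →
    (∀ i → letterCount i w ≡ content i) → map length Bs ↭ columnLengths
  built-sizes w {Bs} Js sizes h cont = ↭-trans (longer⇒lengths-↭ Bs Js same (Partial.nonEmpty h)
      (All.map proj₁ (All.map⁻ (↭.All-resp-↭ (↭-sym sizes) (columnLengths-bounds rows≤n))))) sizes
    where
    letters : ∀ i → longer i Bs ≡ ListAction.sum (map (λ e → kronecker i (toℕ (proj₁ e))) (word w))
    letters i = trans (sym (rowCount-allCells i Bs)) (trans (ListAction.sum-↭ (↭.map⁺ (kronecker i ∘ proj₁) (Partial.contents h)))
      (cong ListAction.sum (sym (List.map-∘ (word w)))))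
    high : ∀ i → n ≤ i → ∀ (z : List (Fin n × Fin N)) → ListAction.sum (map (λ e → kronecker i (toℕ (proj₁ e))) z) ≡ 0
    high i le []            = refl
    high i le ((x , t) ∷ z) = cong₂ ℕ._+_ (kronecker-≢ (λ eq → ℕ.<⇒≱ (Fin.toℕ<n x) (subst (n ≤_) eq le))) (high i le z)
    short : ∀ i → n ≤ i → ∀ {Js : List (List (Fin N))} → All (λ J → length J ≤ n) Js → longer i Js ≡ 0
    short i le []       = refl
    short i le (h ∷ hs) = cong₂ ℕ._+_ (less-≥ (ℕ.≤-trans h le)) (short i le hs)
    same : ∀ i → longer i Bs ≡ longer i Js
    same i with i ℕ.<? n
    ... | no i≮n  = trans (letters i) (trans (high i (ℕ.≮⇒≥ i≮n) (word w)) (sym (short i (ℕ.≮⇒≥ i≮n) (lengths≤n sizes))))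
    ... | yes i<n = subst (λ i → longer i Bs ≡ longer i Js) (Fin.toℕ-fromℕ< i<n) (trans (letters (toℕ i′))
        (trans (cong ListAction.sum (List.map-∘ (word w))) (trans (cong (occurrences i′) (word-letters w))
          (trans (cont i′) (sym (longer-content Js sizes (toℕ i′)))))))
      where i′ = fromℕ< i<n

  built-NCT : ∀ w {Bs} → Partial (word w) Bs → map length Bs ↭ columnLengths → IsMultiplicityFreeNCT Λ Bs
  built-NCT w {Bs} h sizes = record
    { isSetPartition = record
      { increasing = All.map Linked.AllPairs⇒Linked (Partial.increasing h)
      ; nonEmpty   = All.map (λ { {[]} () ; {_ ∷ _} _ () }) (Partial.nonEmpty h)
      ; exhaustive = built-labels w h
      }
    ; nonCrossing = λ a∈ b∈ neq _ → case AllPairs-members (Partial.uncrossed h) a∈ b∈ neq of λ where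
        (inj₁ (u , _)) → Uncrossed⇒NonCrossing u
        (inj₂ (u , _)) → Uncrossed⇒NonCrossing (Uncrossed-sym u)
    ; sizes = sizes
    }

  built-lead : ∀ w {Bs} → Partial (word w) Bs → map length Bs ↭ columnLengths → HasLead (bideterminant Bs) (wordMonomial w)
  built-lead w {Bs} h sizes = subst (HasLead (bideterminant Bs)) lead
    (bideterminant-lead β β-increasing (All.zip (Partial.increasing h , lengths≤n sizes)))
    where
    lead : leadingMonomial Bs ≡ wordMonomial w
    lead = trans (leadingMonomial-cells Bs) (trans (cellProduct-↭ (Partial.contents h))
      (trans (cong cellProduct (List.map-tabulate (λ t → Vec.lookup w t , t) (λ (x , t) → toℕ x , t))) (cellProduct-word w)))

  -- The critical prefix is `as` followed by `x`: the letters `x` and `y` balance in `as`, and this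
  -- `x` brings the weight to -1. `toList-split` presents `w` as a concatenation of vectors, as
  -- `unbalanced-coefficient` requires.
  stuck-vanishes : ∀ {p} → HighestWeight p → ∀ w as x t bs y → word w ≡ as ++ (x , t) ∷ bs → toℕ x ≡ suc (toℕ y) →
    occurrences x (map proj₁ as) ≡ occurrences y (map proj₁ as) → (∀ w′ → base w < base w′ → coefficient p (wordMonomial w′) R.≈ R.0#) →
    coefficient p (wordMonomial w) R.≈ R.0#
  stuck-vanishes {p} h w as x t bs y eq x≡1+y balanced larger
    with toList-split w (map proj₁ as ++ x ∷ []) (map proj₁ bs) (trans (sym (word-letters w)) (trans (cong (map proj₁) eq)
           (trans (List.map-++ proj₁ as _) (sym (List.++-assoc (map proj₁ as) (x ∷ []) (map proj₁ bs))))))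
  ... | len , w≡ = subst (λ w → coefficient p (wordMonomial w) R.≈ R.0#) w≡
          (LoweringWords.unbalanced-coefficient R torsionFree n N y x x≡1+y p (HighestWeight.killed h y x x≡1+y) len
            (Vec.fromList us) (Vec.fromList (map proj₁ bs)) unbalanced
            (λ w′ lt → larger w′ (subst (_< base w′) (trans (sym (base-subst len _)) (cong base w≡)) lt)))
    where
    us = map proj₁ as ++ x ∷ []
    base-subst : ∀ {k l} (eq : k ≡ l) (u : Vec (Fin n) k) → base (subst (Vec (Fin n)) eq u) ≡ base u
    base-subst refl u = refl
    after : ∀ a → letterCount a (Vec.fromList us) ≡ occurrences a (map proj₁ as) ℕ.+ kronecker (toℕ a) (toℕ x)
    after a = trans (cong (occurrences a) (Vec.toList∘fromList us)) (trans (occurrences-++ a (map proj₁ as) (x ∷ []))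
      (cong (occurrences a (map proj₁ as) ℕ.+_) (ℕ.+-identityʳ _)))
    unbalanced : letterCount x (Vec.fromList us) ≡ suc (letterCount y (Vec.fromList us))
    unbalanced = trans (after x) (trans (cong₂ ℕ._+_ balanced (kronecker-refl (toℕ x))) (trans (ℕ.+-comm _ 1)
      (cong suc (trans (sym (ℕ.+-identityʳ _)) (trans (cong (occurrences y (map proj₁ as) ℕ.+_) (sym (kronecker-≢ (λ e → ℕ.1+n≢n (trans (sym x≡1+y) (sym e))))))
        (sym (after y)))))))

  module _ (Js : List (List (Fin N))) (sizes : map length Js ↭ columnLengths) where

    private
      VanishesFrom : ℕ → Polynomial → Set
      VanishesFrom k p = ∀ w → k ≤ base w → coefficient p (wordMonomial w) R.≈ R.0#

      from-next : ∀ w p → VanishesFrom (suc (base w)) p → coefficient p (wordMonomial w) R.≈ R.0# → VanishesFrom (base w) p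
      from-next w p above atw w′ le with base w ℕ.≟ base w′
      ... | no neq = above w′ (ℕ.≤∧≢⇒< le neq)
      ... | yes eq = subst (λ w → coefficient p (wordMonomial w) R.≈ R.0#) (base-injective w w′ eq) atw

    -- Clears the coefficient at `w`. It is 0 already if the letters of `w` have the wrong
    -- multiplicities or the greedy algorithm gets stuck. Otherwise a multiple of the bideterminant
    -- of the built partition is subtracted; its leading word is `w`, with coefficient 1, so no
    -- larger word is affected.
    reduce : ∀ w p → HighestWeight p → VanishesFrom (suc (base w)) p →
      ∃[ p′ ] HighestWeight p′ × VanishesFrom (base w) p′ × (Span (bideterminant ∘ proj₁) p′ → Span (bideterminant ∘ proj₁) p)
    reduce w p h above with Fin.all? (λ i → letterCount i w ℕ.≟ content i)
    ... | no ¬cont = p , h , from-next w p above absent , id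
      where
      absent : coefficient p (wordMonomial w) R.≈ R.0#
      absent with Fin.¬∀⟶∃¬ n _ (λ i → letterCount i w ℕ.≟ content i) ¬cont
      ... | i , neq = coefficient-absent (HighestWeight.rows h i) (wordMonomial w) (λ eq → neq (trans (sym (rowDegree-word i w)) eq))
    ... | yes cont with run [] [] (record { increasing = [] ; nonEmpty = [] ; uncrossed = [] ; contents = ↭-refl }) (word w) (AllPairs.tabulate⁺-< id)
    ...   | stuck as x t bs y eq x≡1+y balanced = p , h , from-next w p above (stuck-vanishes h w as x t bs y eq x≡1+y balanced above) , id
    ...   | built Bs partial = p′ , HighestWeight-linear (R.- c) {bideterminant Bs} {p} (bideterminant-highestWeight Bs (built-labels w partial) lengths) h ,
              next , λ span → Span-≈ {p} {c • bideterminant Bs + p′} recover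
                (Span-linear c {bideterminant Bs} {p′} (Span-generator (Bs , built-NCT w partial lengths)) span)
      where
      open import Relation.Binary.Reasoning.Setoid R.setoid
      open RingProperties R.ring using (-‿distribˡ-*)
      lengths = built-sizes w Js sizes partial cont
      lead = built-lead w partial lengths
      c = coefficient p (wordMonomial w)
      p′ = (R.- c) • bideterminant Bs + p
      expand : ∀ m → coefficient p′ m R.≈ R.- (c R.* coefficient (bideterminant Bs) m) R.+ coefficient p m
      expand m = R.trans (coefficient-+ ((R.- c) • bideterminant Bs) p m)
        (R.+-congʳ (R.trans (coefficient-• (R.- c) (bideterminant Bs) m) (R.sym (-‿distribˡ-* c _))))
      recover : p ≈ c • bideterminant Bs + p′
      recover m = R.sym (begin
        coefficient (c • bideterminant Bs + p′) m         ≈⟨ coefficient-+ (c • bideterminant Bs) p′ m ⟩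
        _ R.+ coefficient p′ m                            ≈⟨ R.+-cong (coefficient-• c (bideterminant Bs) m) (expand m) ⟩
        b R.+ (R.- b R.+ coefficient p m)                 ≈⟨ R.+-assoc b _ _ ⟨
        (b R.+ R.- b) R.+ coefficient p m                 ≈⟨ R.+-congʳ (R.-‿inverseʳ b) ⟩
        R.0# R.+ coefficient p m                          ≈⟨ R.+-identityˡ _ ⟩
        coefficient p m                                   ∎)
        where b = c R.* coefficient (bideterminant Bs) m
      next : ∀ w′ → base w ≤ base w′ → coefficient p′ (wordMonomial w′) R.≈ R.0#
      next w′ le with base w ℕ.≟ base w′
      ... | yes eq = subst (λ w → coefficient p′ (wordMonomial w) R.≈ R.0#) (base-injective w w′ eq)
              (R.trans (expand (wordMonomial w)) (R.trans (R.+-congʳ (R.-‿cong (R.trans (R.*-congˡ (coefficient-lead lead)) (R.*-identityʳ c)))) (R.-‿inverseˡ c)))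
      ... | no neq = R.trans (expand (wordMonomial w′)) (R.trans (R.+-cong
                (R.-‿cong (R.trans (R.*-congˡ (coefficient-above lead (wordMonomial w′)
                  (subst₂ _≤_ (sym (weight-word w)) (sym (weight-word w′)) le) (λ eq → neq (cong base (sym (wordMonomial-injective w′ w eq)))))) (R.zeroʳ c)))
                (above w′ (ℕ.≤∧≢⇒< le neq))) (R.-‿inverseˡ R.0#))

    -- `k` bounds the values of the words that may still occur and drops by one in each round. Not
    -- every number is the value of a word, since the base exceeds the number of letters; hence the
    -- search.
    straighten : ∀ k p → HighestWeight p → VanishesFrom k p → Span (bideterminant ∘ proj₁) p
    straighten zero    p h above = Span-≈ {p} {0#} (highestWeight-zero h λ w → above w z≤n) Span-0
    straighten (suc k) p h above with searchWord N (λ w → base w ℕ.≟ k)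
    ... | no none        = straighten k p h λ w le → above w (ℕ.≤∧≢⇒< le λ eq → none (w , sym eq))
    ... | yes (w , eq) = let p′ , h′ , above′ , back = reduce w p h (λ w′ le → above w′ (subst (λ b → suc b ≤ base w′) eq le))
                         in back (straighten k p′ h′ λ w′ le → above′ w′ (subst (_≤ base w′) (sym eq) le))

  bideterminant-straighten : ∀ Js → concat Js ↭ allFin N → map length Js ↭ columnLengths → Span (bideterminant ∘ proj₁) (bideterminant Js)
  -- Every word of length N has a value below B^N, so the initial condition is void.
  bideterminant-straighten Js labels sizes = straighten Js sizes (B ℕ.^ N) (bideterminant Js) (bideterminant-highestWeight Js labels sizes)
    λ w le → ⊥-elim (ℕ.<⇒≱ (base-bounded w) le)

-- The complex numbers as a torsion-free commutative ring

module Complex where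

  open import Data.Rational as ℚ using (ℚ; 0ℚ; 1ℚ; ½; Positive; 1/_)
  import Data.Rational.Properties as ℚ
  open import Data.Rational.Solver using (module +-*-Solver)
  open +-*-Solver

  -- Equality of reals means that the difference is null, so every congruence reduces to a closure
  -- property of null sequences.
  IsNull : (ℕ → ℚ) → Set
  IsNull d = ∀ ε → .{{Positive ε}} → ∃[ K ] (∀ n → K ≤ n → ℚ.∣ d n ∣ ℚ.≤ ε)

  IsNull-≗ : ∀ {d d′} → (∀ n → d n ≡ d′ n) → IsNull d → IsNull d′
  IsNull-≗ eq h ε = let K , small = h ε in K , λ n le → subst (λ q → ℚ.∣ q ∣ ℚ.≤ ε) (eq n) (small n le)

  IsNull-0 : IsNull (λ _ → 0ℚ)
  IsNull-0 ε = 0 , λ _ _ → ℚ.<⇒≤ (ℚ.positive⁻¹ ε)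

  IsNull-+ : ∀ {d e} → IsNull d → IsNull e → IsNull (λ n → d n ℚ.+ e n)
  IsNull-+ {d} {e} hd he ε =
    let instance half>0 = ℚ.pos*pos⇒pos ½ ε
        K , small = hd (½ ℚ.* ε) ; L , small′ = he (½ ℚ.* ε)
    in K ℕ.⊔ L , λ n le → begin
      ℚ.∣ d n ℚ.+ e n ∣             ≤⟨ ℚ.∣p+q∣≤∣p∣+∣q∣ (d n) (e n) ⟩
      ℚ.∣ d n ∣ ℚ.+ ℚ.∣ e n ∣       ≤⟨ ℚ.+-mono-≤ (small n (ℕ.m⊔n≤o⇒m≤o K L le)) (small′ n (ℕ.m⊔n≤o⇒n≤o K L le)) ⟩
      ½ ℚ.* ε ℚ.+ ½ ℚ.* ε           ≡⟨ ℚ.*-distribʳ-+ ε ½ ½ ⟨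
      1ℚ ℚ.* ε                      ≡⟨ ℚ.*-identityˡ ε ⟩
      ε                             ∎
    where open ℚ.≤-Reasoning

  IsNull-neg : ∀ {d} → IsNull d → IsNull (λ n → ℚ.- d n)
  IsNull-neg {d} h ε = let K , small = h ε in K , λ n le → subst (ℚ._≤ ε) (sym (ℚ.∣-p∣≡∣p∣ (d n))) (small n le)

  IsNull-* : ∀ {d} (x : ℝ) → IsNull d → IsNull (λ n → d n ℚ.* sequence x n)
  IsNull-* {d} x h ε =
    let K , close = isCauchy x 1ℚ
        B = ℚ.∣ sequence x K ∣ ℚ.+ 1ℚ
        B>0 : Positive B
        B>0 = ℚ.nonNeg+pos⇒pos ℚ.∣ sequence x K ∣ {{ℚ.∣-∣-nonNeg (sequence x K)}} 1ℚ
        B≢0 = ℚ.pos⇒nonZero B {{B>0}}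
        B⁻¹ = (1/ B) {{B≢0}}
        δ>0 : Positive (ε ℚ.* B⁻¹)
        δ>0 = ℚ.pos*pos⇒pos ε B⁻¹ {{ℚ.1/pos⇒pos B {{B>0}}}}
        L , small = h (ε ℚ.* B⁻¹) {{δ>0}}
    in K ℕ.⊔ L , λ n le → begin
      ℚ.∣ d n ℚ.* sequence x n ∣          ≡⟨ ℚ.∣p*q∣≡∣p∣*∣q∣ (d n) (sequence x n) ⟩
      ℚ.∣ d n ∣ ℚ.* ℚ.∣ sequence x n ∣    ≤⟨ ℚ.*-monoˡ-≤-nonNeg ℚ.∣ d n ∣ {{ℚ.∣-∣-nonNeg (d n)}} (bound K n (close n K (ℕ.m⊔n≤o⇒m≤o K L le) ℕ.≤-refl)) ⟩
      ℚ.∣ d n ∣ ℚ.* B                     ≤⟨ ℚ.*-monoʳ-≤-nonNeg B {{ℚ.pos⇒nonNeg B {{B>0}}}} (small n (ℕ.m⊔n≤o⇒n≤o K L le)) ⟩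
      (ε ℚ.* B⁻¹) ℚ.* B                   ≡⟨ ℚ.*-assoc ε B⁻¹ B ⟩
      ε ℚ.* (B⁻¹ ℚ.* B)                   ≡⟨ cong (ε ℚ.*_) (ℚ.*-inverseˡ B {{B≢0}}) ⟩
      ε ℚ.* 1ℚ                            ≡⟨ ℚ.*-identityʳ ε ⟩
      ε                                   ∎
    where
    open ℚ.≤-Reasoning
    bound : ∀ K n → ℚ.∣ sequence x n ℚ.- sequence x K ∣ ℚ.≤ 1ℚ → ℚ.∣ sequence x n ∣ ℚ.≤ ℚ.∣ sequence x K ∣ ℚ.+ 1ℚ
    bound K n close = begin
      ℚ.∣ sequence x n ∣                                          ≡⟨ cong ℚ.∣_∣ (solve 2 (λ a b → a := b :+ (a :- b)) refl (sequence x n) (sequence x K)) ⟩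
      ℚ.∣ sequence x K ℚ.+ (sequence x n ℚ.- sequence x K) ∣      ≤⟨ ℚ.∣p+q∣≤∣p∣+∣q∣ (sequence x K) _ ⟩
      ℚ.∣ sequence x K ∣ ℚ.+ ℚ.∣ sequence x n ℚ.- sequence x K ∣  ≤⟨ ℚ.+-monoʳ-≤ ℚ.∣ sequence x K ∣ close ⟩
      ℚ.∣ sequence x K ∣ ℚ.+ 1ℚ                                   ∎

  ≗⇒≈ℝ : ∀ x y → (∀ n → sequence x n ≡ sequence y n) → x ≈ℝ y
  ≗⇒≈ℝ x y h = IsNull-≗ (λ n → sym (trans (cong (ℚ._- sequence y n) (h n)) (ℚ.+-inverseʳ (sequence y n)))) IsNull-0

  ≈ℝ-sym : ∀ x y → x ≈ℝ y → y ≈ℝ x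
  ≈ℝ-sym x y h = IsNull-≗ (λ n → solve 2 (λ a b → :- (a :- b) := b :- a) refl (sequence x n) (sequence y n)) (IsNull-neg h)

  ≈ℝ-trans : ∀ x y z → x ≈ℝ y → y ≈ℝ z → x ≈ℝ z
  ≈ℝ-trans x y z h h′ = IsNull-≗ (λ n → solve 3 (λ a b c → (a :- b) :+ (b :- c) := a :- c) refl (sequence x n) (sequence y n) (sequence z n)) (IsNull-+ h h′)

  +ℝ-cong : ∀ x x′ y y′ → x ≈ℝ x′ → y ≈ℝ y′ → (x +ℝ y) ≈ℝ (x′ +ℝ y′)
  +ℝ-cong x x′ y y′ h h′ = IsNull-≗ (λ n → solve 4 (λ a b c d → (a :- b) :+ (c :- d) := (a :+ c) :- (b :+ d)) refl
    (sequence x n) (sequence x′ n) (sequence y n) (sequence y′ n)) (IsNull-+ h h′)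

  -ℝ-cong : ∀ x y → x ≈ℝ y → (-ℝ x) ≈ℝ (-ℝ y)
  -ℝ-cong x y h = IsNull-≗ (λ n → solve 2 (λ a b → :- (a :- b) := (:- a) :- (:- b)) refl (sequence x n) (sequence y n)) (IsNull-neg h)

  -- x y - x′ y′ = (x - x′) y + (y - y′) x′, and a null sequence times a Cauchy sequence is null
  -- because the latter is eventually bounded.
  *ℝ-cong : ∀ x x′ y y′ → x ≈ℝ x′ → y ≈ℝ y′ → (x *ℝ y) ≈ℝ (x′ *ℝ y′)
  *ℝ-cong x x′ y y′ h h′ = IsNull-≗ (λ n → solve 4 (λ a b c d → (a :- b) :* c :+ (c :- d) :* b := a :* c :- b :* d) refl
    (sequence x n) (sequence x′ n) (sequence y n) (sequence y′ n)) (IsNull-+ (IsNull-* y h) (IsNull-* x′ h′))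

  private
    module ℂR = RawRing ℂ-rawRing

    re im : ℂ → ℕ → ℚ
    re z = sequence (ℂ.re z)
    im z = sequence (ℂ.im z)

  ≗⇒≈ : ∀ z w → (∀ n → re z n ≡ re w n) → (∀ n → im z n ≡ im w n) → z ℂR.≈ w
  ≗⇒≈ z w h h′ = ≗⇒≈ℝ (ℂ.re z) (ℂ.re w) h , ≗⇒≈ℝ (ℂ.im z) (ℂ.im w) h′

  ℂ-commutativeRing : CommutativeRing 0ℓ 0ℓ
  ℂ-commutativeRing = record
    { RawRing ℂ-rawRing
    ; isCommutativeRing = record
      { isRing = record
        { +-isAbelianGroup = record
          { isGroup = record
            { isMonoid = record
              { isSemigroup = record
                { isMagma = record
                  { isEquivalence = record
                    { refl  = λ {z} → ≗⇒≈ z z (λ _ → refl) (λ _ → refl)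
                    ; sym   = λ {z} {w} (p , q) → ≈ℝ-sym (ℂ.re z) (ℂ.re w) p , ≈ℝ-sym (ℂ.im z) (ℂ.im w) q
                    ; trans = λ {z} {w} {u} (p , q) (p′ , q′) → ≈ℝ-trans (ℂ.re z) (ℂ.re w) (ℂ.re u) p p′ , ≈ℝ-trans (ℂ.im z) (ℂ.im w) (ℂ.im u) q q′
                    }
                  ; ∙-cong = λ {z} {z′} {w} {w′} (p , q) (p′ , q′) →
                      +ℝ-cong (ℂ.re z) (ℂ.re z′) (ℂ.re w) (ℂ.re w′) p p′ , +ℝ-cong (ℂ.im z) (ℂ.im z′) (ℂ.im w) (ℂ.im w′) q q′
                  }
                ; assoc = λ z w u → ≗⇒≈ ((z ℂR.+ w) ℂR.+ u) (z ℂR.+ (w ℂR.+ u)) 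
                    (λ n → ℚ.+-assoc (re z n) (re w n) (re u n))
                    (λ n → ℚ.+-assoc (im z n) (im w n) (im u n))
                }
              ; identity = (λ z → ≗⇒≈ (ℂR.0# ℂR.+ z) z (λ n → ℚ.+-identityˡ (re z n)) (λ n → ℚ.+-identityˡ (im z n)))
                         , (λ z → ≗⇒≈ (z ℂR.+ ℂR.0#) z (λ n → ℚ.+-identityʳ (re z n)) (λ n → ℚ.+-identityʳ (im z n)))
              }
            ; inverse = (λ z → ≗⇒≈ ((ℂR.- z) ℂR.+ z) ℂR.0# (λ n → ℚ.+-inverseˡ (re z n)) (λ n → ℚ.+-inverseˡ (im z n)))
                      , (λ z → ≗⇒≈ (z ℂR.+ (ℂR.- z)) ℂR.0# (λ n → ℚ.+-inverseʳ (re z n)) (λ n → ℚ.+-inverseʳ (im z n)))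
            ; ⁻¹-cong = λ {z} {w} (p , q) → -ℝ-cong (ℂ.re z) (ℂ.re w) p , -ℝ-cong (ℂ.im z) (ℂ.im w) q
            }
          ; comm = λ z w → ≗⇒≈ (z ℂR.+ w) (w ℂR.+ z) (λ n → ℚ.+-comm (re z n) _) (λ n → ℚ.+-comm (im z n) _)
          }
        ; *-cong = λ {z} {z′} {w} {w′} (p , q) (p′ , q′) →
            +ℝ-cong (ℂ.re z *ℝ ℂ.re w) (ℂ.re z′ *ℝ ℂ.re w′) (-ℝ (ℂ.im z *ℝ ℂ.im w)) (-ℝ (ℂ.im z′ *ℝ ℂ.im w′))
              (*ℝ-cong (ℂ.re z) (ℂ.re z′) (ℂ.re w) (ℂ.re w′) p p′)
              (-ℝ-cong (ℂ.im z *ℝ ℂ.im w) (ℂ.im z′ *ℝ ℂ.im w′) (*ℝ-cong (ℂ.im z) (ℂ.im z′) (ℂ.im w) (ℂ.im w′) q q′)) ,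
            +ℝ-cong (ℂ.re z *ℝ ℂ.im w) (ℂ.re z′ *ℝ ℂ.im w′) (ℂ.im z *ℝ ℂ.re w) (ℂ.im z′ *ℝ ℂ.re w′)
              (*ℝ-cong (ℂ.re z) (ℂ.re z′) (ℂ.im w) (ℂ.im w′) p q′)
              (*ℝ-cong (ℂ.im z) (ℂ.im z′) (ℂ.re w) (ℂ.re w′) q p′)
        ; *-assoc = λ z w u → ≗⇒≈ ((z ℂR.* w) ℂR.* u) (z ℂR.* (w ℂR.* u))
            (λ n → solve 6 (λ a b c d e f →
                (a :* c :+ :- (b :* d)) :* e :+ :- ((a :* d :+ b :* c) :* f) :=
                a :* (c :* e :+ :- (d :* f)) :+ :- (b :* (c :* f :+ d :* e))) refl
              (re z n) (im z n) (re w n) (im w n) (re u n) (im u n))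
            (λ n → solve 6 (λ a b c d e f →
                (a :* c :+ :- (b :* d)) :* f :+ (a :* d :+ b :* c) :* e :=
                a :* (c :* f :+ d :* e) :+ b :* (c :* e :+ :- (d :* f))) refl
              (re z n) (im z n) (re w n) (im w n) (re u n) (im u n))
        ; *-identity = (λ z → ≗⇒≈ (ℂR.1# ℂR.* z) z
              (λ n → solve 2 (λ a b → con 1ℚ :* a :+ :- (con 0ℚ :* b) := a) refl (re z n) (im z n))
              (λ n → solve 2 (λ a b → con 1ℚ :* b :+ con 0ℚ :* a := b) refl (re z n) (im z n)))
          , (λ z → ≗⇒≈ (z ℂR.* ℂR.1#) z
              (λ n → solve 2 (λ a b → a :* con 1ℚ :+ :- (b :* con 0ℚ) := a) refl (re z n) (im z n))
              (λ n → solve 2 (λ a b → a :* con 0ℚ :+ b :* con 1ℚ := b) refl (re z n) (im z n)))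
        ; distrib = (λ z w u → ≗⇒≈ (z ℂR.* (w ℂR.+ u)) ((z ℂR.* w) ℂR.+ (z ℂR.* u))
              (λ n → solve 6 (λ a b c d e f → a :* (c :+ e) :+ :- (b :* (d :+ f)) := (a :* c :+ :- (b :* d)) :+ (a :* e :+ :- (b :* f))) refl
                (re z n) (im z n) (re w n) (im w n) (re u n) (im u n))
              (λ n → solve 6 (λ a b c d e f → a :* (d :+ f) :+ b :* (c :+ e) := (a :* d :+ b :* c) :+ (a :* f :+ b :* e)) refl
                (re z n) (im z n) (re w n) (im w n) (re u n) (im u n)))
          , (λ z w u → ≗⇒≈ ((w ℂR.+ u) ℂR.* z) ((w ℂR.* z) ℂR.+ (u ℂR.* z))
              (λ n → solve 6 (λ a b c d e f → (c :+ e) :* a :+ :- ((d :+ f) :* b) := (c :* a :+ :- (d :* b)) :+ (e :* a :+ :- (f :* b))) refl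
                (re z n) (im z n) (re w n) (im w n) (re u n) (im u n))
              (λ n → solve 6 (λ a b c d e f → (c :+ e) :* b :+ (d :+ f) :* a := (c :* b :+ d :* a) :+ (e :* b :+ f :* a)) refl
                (re z n) (im z n) (re w n) (im w n) (re u n) (im u n)))
        }
      ; *-comm = λ z w → ≗⇒≈ (z ℂR.* w) (w ℂR.* z)
          (λ n → solve 4 (λ a b c d → a :* c :+ :- (b :* d) := c :* a :+ :- (d :* b)) refl
            (re z n) (im z n) (re w n) (im w n))
          (λ n → solve 4 (λ a b c d → a :* d :+ b :* c := c :* b :+ d :* a) refl
            (re z n) (im z n) (re w n) (im w n))
      }
    }

  private
    multiple : ℕ → ℚ → ℚ
    multiple zero    q = 0ℚ
    multiple (suc k) q = q ℚ.+ multiple k q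

    multiple-neg : ∀ k q → ℚ.- multiple k q ≡ multiple k (ℚ.- q)
    multiple-neg zero    q = refl
    multiple-neg (suc k) q = trans (ℚ.neg-distrib-+ q (multiple k q)) (cong (ℚ.- q ℚ.+_) (multiple-neg k q))

    multiple-nonNegative : ∀ k {q} → 0ℚ ℚ.≤ q → 0ℚ ℚ.≤ multiple k q
    multiple-nonNegative zero    h = ℚ.≤-refl
    multiple-nonNegative (suc k) h = ℚ.+-mono-≤ h (multiple-nonNegative k h)


    ∣multiple∣-nonNegative : ∀ k q → 0ℚ ℚ.≤ q → ℚ.∣ q ∣ ℚ.≤ ℚ.∣ multiple (suc k) q ∣
    ∣multiple∣-nonNegative k q 0≤q = subst₂ ℚ._≤_ (sym (ℚ.0≤p⇒∣p∣≡p 0≤q)) (sym (ℚ.0≤p⇒∣p∣≡p (multiple-nonNegative (suc k) 0≤q)))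
      (ℚ.≤-trans (ℚ.≤-reflexive (sym (ℚ.+-identityʳ q))) (ℚ.+-monoʳ-≤ q (multiple-nonNegative k 0≤q)))

    -- For q of either sign, adding further copies of q only moves away from 0. Hence a sequence is
    -- null as soon as a positive multiple of it is, which gives torsion-freeness.
    ∣multiple∣ : ∀ k q → ℚ.∣ q ∣ ℚ.≤ ℚ.∣ multiple (suc k) q ∣
    ∣multiple∣ k q with ℚ.≤-total 0ℚ q
    ... | inj₁ 0≤q = ∣multiple∣-nonNegative k q 0≤q
    ... | inj₂ q≤0 = subst₂ ℚ._≤_ (ℚ.∣-p∣≡∣p∣ q) (trans (cong ℚ.∣_∣ (sym (multiple-neg (suc k) q))) (ℚ.∣-p∣≡∣p∣ _))
                       (∣multiple∣-nonNegative k (ℚ.- q) (ℚ.neg-antimono-≤ q≤0))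

    IsNull-multiple : ∀ k {d} → IsNull (λ n → multiple (suc k) (d n)) → IsNull d
    IsNull-multiple k {d} h ε = let K , small = h ε in K , λ n le → ℚ.≤-trans (∣multiple∣ k (d n)) (small n le)

  open SemiringMult (CommutativeRing.semiring ℂ-commutativeRing) using () renaming (_×_ to _⊠_)

  ℂ-torsionFree : TorsionFree ℂ-commutativeRing
  ℂ-torsionFree k z (p , q) =
    component (ℂ.re z) (IsNull-≗ (λ n → trans (minus-0 _) (proj₁ (parts (suc k) n))) p) ,
    component (ℂ.im z) (IsNull-≗ (λ n → trans (minus-0 _) (proj₂ (parts (suc k) n))) q)
    where
    minus-0 : ∀ a → a ℚ.- 0ℚ ≡ a
    minus-0 = ℚ.+-identityʳ
    component : ∀ x → IsNull (λ n → multiple (suc k) (sequence x n)) → x ≈ℝ fromℚ 0ℚ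
    component x h = IsNull-≗ (λ n → sym (minus-0 (sequence x n))) (IsNull-multiple k {sequence x} h)
    parts : ∀ k n → re (k ⊠ z) n ≡ multiple k (re z n) × im (k ⊠ z) n ≡ multiple k (im z n)
    parts zero    n = refl , refl
    parts (suc k) n = let a , b = parts k n in cong (re z n ℚ.+_) a , cong (im z n ℚ.+_) b

-- Column lengths, segments and the cutting of lists

length-filter-less : ∀ c ps → length (filter (c ℕ.<?_) ps) ≡ ListAction.sum (map (less c) ps)
length-filter-less c []       = refl
length-filter-less c (p ∷ ps) with c ℕ.<? p
... | yes lt = trans (cong length (List.filter-accept (c ℕ.<?_) lt)) (cong₂ ℕ._+_ (sym (less-< lt)) (length-filter-less c ps))
... | no ge  = trans (cong length (List.filter-reject (c ℕ.<?_) ge)) (trans (length-filter-less c ps)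
                 (cong (ℕ._+ ListAction.sum (map (less c) ps)) (sym (less-≥ (ℕ.≮⇒≥ ge)))))

module ColumnShape (Λ : Partition) where

  open Partition Λ

  columnLength-antitone : ∀ {c d} → c Fin.≤ d → columnLength d ≤ columnLength c
  columnLength-antitone {c} {d} le = subst₂ _≤_ (sym (length-filter-less (toℕ d) parts)) (sym (length-filter-less (toℕ c) parts)) (go parts)
    where
    less-antitone : ∀ {i j} p → i ≤ j → less j p ≤ less i p
    less-antitone         zero    _        = z≤n
    less-antitone {zero}  {zero}  (suc p) _ = ℕ.≤-refl
    less-antitone {zero}  {suc j} (suc p) _ = less≤1 j p
      where
      less≤1 : ∀ i k → less i k ≤ 1
      less≤1 i       zero    = z≤n
      less≤1 zero    (suc k) = ℕ.≤-refl
      less≤1 (suc i) (suc k) = less≤1 i k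
    less-antitone {suc i} {suc j} (suc p) (s≤s le) = less-antitone p le
    go : ∀ ps → ListAction.sum (map (less (toℕ d)) ps) ≤ ListAction.sum (map (less (toℕ c)) ps)
    go []       = z≤n
    go (p ∷ ps) = ℕ.+-mono-≤ (less-antitone p le) (go ps)

  -- Double counting of the cells: a part p contributes 1 to each of the first p columns, and
  -- `width` is at least p.
  sum-columnLengths : ListAction.sum columnLengths ≡ size
  sum-columnLengths = trans (sum-tabulate columnLength) (trans (sumℕ-cong {width} λ c → length-filter-less (toℕ c) parts) (conjugate parts width ℕ.≤-refl))
    where
    part : ∀ w p → p ≤ w → sumℕ {w} (λ c → less (toℕ c) p) ≡ p
    part w       zero    _        = sumℕ-0 {w} λ _ → refl
    part (suc w) (suc p) (s≤s le) = cong suc (part w p le)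
    conjugate : ∀ ps w → foldr ℕ._⊔_ 0 ps ≤ w → sumℕ {w} (λ c → ListAction.sum (map (less (toℕ c)) ps)) ≡ ListAction.sum ps
    conjugate []       w _  = sumℕ-0 {w} λ _ → refl
    conjugate (p ∷ ps) w le = trans (sumℕ-+ {w} (λ c → less (toℕ c) p) (λ c → ListAction.sum (map (less (toℕ c)) ps)))
      (cong₂ ℕ._+_ (part w p (ℕ.m⊔n≤o⇒m≤o p _ le)) (conjugate ps w (ℕ.m⊔n≤o⇒n≤o p _ le)))

segments : ∀ {r} → (Fin r → ℕ) → List (Fin r)
segments {zero}  μ = []
segments {suc r} μ = List.replicate (μ zero) zero ++ map suc (segments (μ ∘ suc))

occurrences-segments : ∀ {r} (μ : Fin r → ℕ) v → occurrences v (segments μ) ≡ μ v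
occurrences-segments {suc r} μ v = trans (occurrences-++ v (List.replicate (μ zero) zero) (map suc (segments (μ ∘ suc)))) (go v)
  where
  zeros : ∀ k → occurrences {suc r} zero (List.replicate k zero) ≡ k
  zeros zero    = refl
  zeros (suc k) = cong suc (zeros k)
  none : ∀ k (v : Fin r) → occurrences (suc v) (List.replicate k zero) ≡ 0
  none zero    v = refl
  none (suc k) v = none k v
  shifted : ∀ (v : Fin r) L → occurrences (suc v) (map suc L) ≡ occurrences v L
  shifted v []      = refl
  shifted v (x ∷ L) = cong (kronecker (toℕ v) (toℕ x) ℕ.+_) (shifted v L)
  absent : ∀ (L : List (Fin r)) → occurrences zero (map suc L) ≡ 0
  absent []      = refl
  absent (x ∷ L) = absent L
  go : ∀ v → occurrences v (List.replicate (μ zero) zero) ℕ.+ occurrences v (map suc (segments (μ ∘ suc))) ≡ μ v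
  go zero    = trans (cong₂ ℕ._+_ (zeros (μ zero)) (absent (segments (μ ∘ suc)))) (ℕ.+-identityʳ _)
  go (suc v) = trans (cong₂ ℕ._+_ (none (μ zero) v) (shifted v (segments (μ ∘ suc)))) (occurrences-segments (μ ∘ suc) v)

start : ∀ {r} → (Fin r → ℕ) → Fin r → ℕ
start μ v = ListAction.sum (take (toℕ v) (List.tabulate μ))

segments-position : ∀ {r} (μ : Fin r → ℕ) (j : Fin (length (segments μ))) →
  start μ (lookup (segments μ) j) ≤ toℕ j × toℕ j < start μ (lookup (segments μ) j) ℕ.+ μ (lookup (segments μ) j)
segments-position {suc r} μ = go (μ zero) 0 (ℕ.+-identityʳ _)
  where
  rest = segments (μ ∘ suc)
  mapped : ∀ (L : List (Fin r)) (j : Fin (length (map (suc {n = r}) L))) → ∃[ j′ ] toℕ j′ ≡ toℕ j × lookup (map suc L) j ≡ suc (lookup L j′)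
  mapped (x ∷ L) zero    = zero , refl , refl
  mapped (x ∷ L) (suc j) = let j′ , eq , eq′ = mapped L j in suc j′ , cong suc eq , eq′
  -- Of the `μ zero` copies of `zero`, `d` have been passed and `k` remain.
  go : ∀ k d → k ℕ.+ d ≡ μ zero → (j : Fin (length (List.replicate k (zero {r}) ++ map suc rest))) →
    let v = lookup (List.replicate k zero ++ map suc rest) j in
    start μ v ≤ d ℕ.+ toℕ j × d ℕ.+ toℕ j < start μ v ℕ.+ μ v
  go zero d refl j with mapped rest j
  ... | j′ , eq , eq′ rewrite eq′ | sym eq = let p , q = segments-position (μ ∘ suc) j′ in
        ℕ.+-monoʳ-≤ (μ zero) p , subst (μ zero ℕ.+ toℕ j′ <_) (sym (ℕ.+-assoc (μ zero) _ _)) (ℕ.+-monoʳ-< (μ zero) q)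
  go (suc k) d eq zero    = z≤n , subst (_< μ zero) (sym (ℕ.+-identityʳ d)) (subst (d <_) eq (s≤s (ℕ.m≤n+m d k)))
  go (suc k) d eq (suc j) = let p , q = go k (suc d) (trans (ℕ.+-suc k d) eq) j in
    ℕ.≤-trans p (ℕ.≤-reflexive (sym (ℕ.+-suc d (toℕ j)))) , ℕ.≤-<-trans (ℕ.≤-reflexive (ℕ.+-suc d (toℕ j))) q

InSegment-< : ∀ {r N} (μ : Fin r → ℕ) {s t : Fin N} {u v} → InSegment μ s u → InSegment μ t v → u Fin.< v → s Fin.< t
InSegment-< μ {u = u} {v} (_ , s<) (t≥ , _) u<v = ℕ.<-≤-trans s< (ℕ.≤-trans (next μ u v u<v) t≥)
  where
  next : ∀ {r} (μ : Fin r → ℕ) (u v : Fin r) → u Fin.< v → start μ u ℕ.+ μ u ≤ start μ v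
  next {suc r} μ zero    (suc v) _        = ℕ.m≤m+n (μ zero) _
  next {suc r} μ (suc u) (suc v) (s≤s lt) = ℕ.≤-trans (ℕ.≤-reflexive (ℕ.+-assoc (μ zero) _ _)) (ℕ.+-monoʳ-≤ (μ zero) (next (μ ∘ suc) u v lt))

InSegment-unique : ∀ {r N} (μ : Fin r → ℕ) {t : Fin N} {u v} → InSegment μ t u → InSegment μ t v → u ≡ v
InSegment-unique μ {u = u} {v} p q with Fin.<-cmp u v
... | tri< lt _ _ = ⊥-elim (ℕ.<-irrefl refl (InSegment-< μ p q lt))
... | tri≈ _ eq _ = eq
... | tri> _ _ gt = ⊥-elim (ℕ.<-irrefl refl (InSegment-< μ q p gt))

module _ {A : Set} where

  length-concat : ∀ (xss : List (List A)) → length (concat xss) ≡ ListAction.sum (map length xss)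
  length-concat []         = refl
  length-concat (xs ∷ xss) = trans (List.length-++ xs) (cong (length xs ℕ.+_) (length-concat xss))

  tabulate-injective : ∀ {k} {f g : Fin k → A} → List.tabulate f ≡ List.tabulate g → ∀ i → f i ≡ g i
  tabulate-injective {suc k} eq zero    = List.∷-injectiveˡ eq
  tabulate-injective {suc k} eq (suc i) = tabulate-injective (List.∷-injectiveʳ eq) i

  AllPairs-tabulate⁻ : ∀ {Q : A → A → Set} {k} {f : Fin k → A} → AllPairs Q (List.tabulate f) → ∀ {i j} → i Fin.< j → Q (f i) (f j)
  AllPairs-tabulate⁻ {k = suc k} (q ∷ qs) {zero}  {suc j} _        = All.tabulate⁻ q j
  AllPairs-tabulate⁻ {k = suc k} (q ∷ qs) {suc i} {suc j} (s≤s lt) = AllPairs-tabulate⁻ qs lt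

  untabulate : ∀ {w} (ℓ : Fin w → ℕ) (cs : List (List A)) → map length cs ≡ List.tabulate ℓ →
    Σ (∀ c → Fin (ℓ c) → A) λ e → List.tabulate (λ c → List.tabulate (e c)) ≡ cs
  untabulate {zero}  ℓ []       _  = (λ ()) , refl
  untabulate {suc w} ℓ (c ∷ cs) eq with untabulate (ℓ ∘ suc) cs (List.∷-injectiveʳ eq) | single c (List.∷-injectiveˡ eq)
    where
    single : ∀ {k} c → length c ≡ k → Σ (Fin k → A) λ e → List.tabulate e ≡ c
    single c refl = lookup c , List.tabulate-lookup c
  ... | e , h | e₀ , h₀ = (λ { zero → e₀ ; (suc c) → e c }) , cong₂ _∷_ h₀ h

  map-lookup-cast : ∀ {N} (l : List A) (eq : N ≡ length l) → map (λ t → lookup l (Fin.cast eq t)) (allFin N) ≡ l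
  map-lookup-cast l refl = trans (List.map-tabulate id (λ t → lookup l (Fin.cast refl t)))
    (trans (List.tabulate-cong λ t → cong (lookup l) (Fin.cast-is-id refl t)) (List.tabulate-lookup l))

  map-++⁻ : ∀ {B : Set} (f : B → A) L xs ys → map f L ≡ xs ++ ys → ∃[ L₁ ] ∃[ L₂ ] L ≡ L₁ ++ L₂ × map f L₁ ≡ xs × map f L₂ ≡ ys
  map-++⁻ f L       []       ys eq = [] , L , refl , refl , eq
  map-++⁻ f (b ∷ L) (x ∷ xs) ys eq with map-++⁻ f L xs ys (List.∷-injectiveʳ eq)
  ... | L₁ , L₂ , refl , e₁ , e₂ = b ∷ L₁ , L₂ , refl , cong₂ _∷_ (List.∷-injectiveˡ eq) e₁ , e₂

  unconcat : ∀ {B : Set} (f : B → A) L cs → map f L ≡ concat cs → ∃[ bs ] concat bs ≡ L × map (map f) bs ≡ cs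
  unconcat f []      []       _  = [] , refl , refl
  unconcat f (x ∷ L) []       ()
  unconcat f L       (c ∷ cs) eq with map-++⁻ f L c (concat cs) eq
  ... | L₁ , L₂ , refl , e₁ , e₂ with unconcat f L₂ cs e₂
  ...   | bs , refl , e = L₁ ∷ bs , refl , cong₂ _∷_ e₁ e

-- The canonical order of the columns

-- Sorting by key arranges columns by decreasing length, then as in condition (ii).
module ColumnKey (n r : ℕ) where

  private
    P = (2 ℕ.+ r) ℕ.^ n

  -- `base` takes the last entry as the most significant digit, just as condition (ii) compares
  -- columns at the largest index where they differ.
  value₀ : List (Fin r) → ℕ
  value₀ a = base (Vec.fromList a)

  key : List (Fin r) → ℕ
  key a = (n ℕ.∸ length a) ℕ.* P ℕ.+ value₀ a

  -- `value₀` of a column of length at most n is below `P`, and the key of a shorter column contains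
  -- at least one more `P`.
  key-longer : ∀ {a b} → length a ≤ n → length b < length a → key a < key b
  key-longer {a} {b} a≤n lt = ℕ.<-≤-trans (ℕ.+-monoʳ-< ((n ℕ.∸ length a) ℕ.* P)
      (ℕ.<-≤-trans (base-bounded (Vec.fromList a)) (ℕ.^-monoʳ-≤ (2 ℕ.+ r) a≤n)))
    (ℕ.≤-trans (ℕ.≤-reflexive (ℕ.+-comm _ P)) (ℕ.≤-trans (ℕ.*-monoˡ-≤ P (ℕ.∸-monoʳ-< lt a≤n)) (ℕ.m≤m+n _ _)))

  key-length : ∀ {a b} → length b ≤ n → key a ≤ key b → length b ≤ length a
  key-length {a} {b} b≤n le = ℕ.≮⇒≥ λ lt → ℕ.<⇒≱ (key-longer {b} {a} b≤n lt) le

  key-value : ∀ {a b} → length a ≡ length b → key a ≤ key b → value₀ a ≤ value₀ b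
  key-value {a} {b} eq le = ℕ.+-cancelˡ-≤ ((n ℕ.∸ length b) ℕ.* P) _ _
    (subst (λ l → (n ℕ.∸ l) ℕ.* P ℕ.+ value₀ a ≤ key b) eq le)

  value-key : ∀ {a b} → length a ≡ length b → value₀ a ≤ value₀ b → key a ≤ key b
  value-key {a} {b} eq le = subst (λ l → (n ℕ.∸ l) ℕ.* P ℕ.+ value₀ a ≤ key b) (sym eq) (ℕ.+-monoʳ-≤ ((n ℕ.∸ length b) ℕ.* P) le)

  key-injective : ∀ {a b} → length a ≡ length b → key a ≡ key b → a ≡ b
  key-injective {a} {b} eq k = trans (sym (Vec.toList∘fromList a)) (trans (same (Vec.fromList a) (Vec.fromList b) eq
      (ℕ.≤-antisym (key-value {a} {b} eq (ℕ.≤-reflexive k)) (key-value {b} {a} (sym eq) (ℕ.≤-reflexive (sym k)))))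
      (Vec.toList∘fromList b))
    where
    same : ∀ {k l} (u : Vec (Fin r) k) (w : Vec (Fin r) l) → k ≡ l → base u ≡ base w → Vec.toList u ≡ Vec.toList w
    same u w refl h = cong Vec.toList (base-injective u w h)

  value-tabulate : ∀ {k} (e : Fin k → Fin r) → value₀ (List.tabulate e) ≡ base (Vec.tabulate e)
  value-tabulate {zero}  e = refl
  value-tabulate {suc k} e = cong (λ b → toℕ (e zero) ℕ.+ (2 ℕ.+ r) ℕ.* b) (value-tabulate (e ∘ suc))

  private
    tail-< : ∀ {k} (e e′ : Fin (suc k) → Fin r) → base (Vec.tabulate (e ∘ suc)) < base (Vec.tabulate (e′ ∘ suc)) → base (Vec.tabulate e) < base (Vec.tabulate e′)
    tail-< e e′ = base-++-< (e zero ∷ []) (e′ zero ∷ []) {Vec.tabulate (e ∘ suc)} {Vec.tabulate (e′ ∘ suc)}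

  -- The hypothesis is condition (ii) for two columns, which is void if they are equal. The tails
  -- are compared first, and the first entries decide only if the tails agree.
  base-≤ : ∀ {k} (e e′ : Fin k → Fin r) → (∀ s → e s ≢ e′ s → (∀ t → s Fin.< t → e t ≡ e′ t) → e s Fin.< e′ s) →
    base (Vec.tabulate e) ≤ base (Vec.tabulate e′)
  base-≤ {zero}  e e′ h = z≤n
  base-≤ {suc k} e e′ h with ℕ.m≤n⇒m<n∨m≡n (base-≤ (e ∘ suc) (e′ ∘ suc) λ s neq same → h (suc s) neq λ { (suc t) (s≤s lt) → same t lt })
  ... | inj₁ lt = ℕ.<⇒≤ (tail-< e e′ lt)
  ... | inj₂ eq = ℕ.+-mono-≤ first (ℕ.≤-reflexive (cong ((2 ℕ.+ r) ℕ.*_) eq))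
    where
    tails : ∀ t → e (suc t) ≡ e′ (suc t)
    tails t = trans (sym (Vec.lookup∘tabulate (e ∘ suc) t)) (trans
      (cong (λ u → Vec.lookup u t) (base-injective (Vec.tabulate (e ∘ suc)) (Vec.tabulate (e′ ∘ suc)) eq))
      (Vec.lookup∘tabulate (e′ ∘ suc) t))
    first : toℕ (e zero) ≤ toℕ (e′ zero)
    first with e zero Fin.≟ e′ zero
    ... | yes e≡ = ℕ.≤-reflexive (cong toℕ e≡)
    ... | no neq = ℕ.<⇒≤ (h zero neq λ { (suc t) _ → tails t })

  base-<-at : ∀ {k} (e e′ : Fin k → Fin r) s → e s Fin.< e′ s → (∀ t → s Fin.< t → e t ≡ e′ t) → base (Vec.tabulate e) < base (Vec.tabulate e′)
  base-<-at {suc k} e e′ zero    lt same = ℕ.<-≤-trans (ℕ.+-monoˡ-< _ lt)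
    (ℕ.≤-reflexive (cong (λ u → toℕ (e′ zero) ℕ.+ (2 ℕ.+ r) ℕ.* base u) (Vec.tabulate-cong λ t → same (suc t) (s≤s z≤n))))
  base-<-at {suc k} e e′ (suc s) lt same = tail-< e e′ (base-<-at (e ∘ suc) (e′ ∘ suc) s lt λ t s<t → same (suc t) (s≤s s<t))

  base-≤⁻ : ∀ {k} (e e′ : Fin k → Fin r) → base (Vec.tabulate e) ≤ base (Vec.tabulate e′) →
    ∀ s → e s ≢ e′ s → (∀ t → s Fin.< t → e t ≡ e′ t) → e s Fin.< e′ s
  base-≤⁻ e e′ le s neq same with Fin.<-cmp (e s) (e′ s)
  ... | tri< lt _ _ = lt
  ... | tri≈ _ eq _ = ⊥-elim (neq eq)
  ... | tri> _ _ gt = ⊥-elim (ℕ.<⇒≱ (base-<-at e′ e s gt λ t lt → sym (same t lt)) le)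

-- Fillings and their lists of columns

module Fillings {n r : ℕ} {Λ : Partition} (rows≤n : Partition.rows Λ ≤ n) where

  open Partition Λ
  open ColumnLengths Λ
  open ColumnShape Λ
  open ColumnKey n r

  columns-lengths : ∀ (T : Filling Λ r) → map length (Filling.columns T) ≡ columnLengths
  columns-lengths T = trans (List.map-tabulate _ length) (List.tabulate-cong λ c → List.length-tabulate (Filling.entry T c))

  columns-increasing : ∀ (T : Filling Λ r) → All (AllPairs Fin._<_) (Filling.columns T)
  columns-increasing T = All.tabulate⁺ λ c → AllPairs.tabulate⁺-< (Filling.increasing T c)

  columns-length≤n : ∀ (T : Filling Λ r) → All (λ a → length a ≤ n) (Filling.columns T)
  columns-length≤n T = All.map proj₂ (All.map⁻ (subst (All _) (sym (columns-lengths T)) (columnLengths-bounds rows≤n)))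

  length-concat-columns : ∀ (T : Filling Λ r) → length (concat (Filling.columns T)) ≡ size
  length-concat-columns T = trans (length-concat (Filling.columns T)) (trans (cong ListAction.sum (columns-lengths T)) sum-columnLengths)

  multiplicity-occurrences : ∀ (T : Filling Λ r) v → Filling.multiplicity T v ≡ occurrences v (concat (Filling.columns T))
  multiplicity-occurrences T v = go (concat (Filling.columns T))
    where
    go : ∀ L → length (filter (Fin._≟ v) L) ≡ occurrences v L
    go []      = refl
    go (x ∷ L) with x Fin.≟ v
    ... | yes refl = cong₂ ℕ._+_ (sym (kronecker-refl (toℕ v))) (go L)
    ... | no neq   = trans (go L) (cong (ℕ._+ occurrences v L) (sym (kronecker-≢ (neq ∘ sym ∘ Fin.toℕ-injective))))

  columns-injective : ∀ (T U : Filling Λ r) → Filling.columns T ≡ Filling.columns U → T ≗ᶠ U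
  columns-injective T U eq c = tabulate-injective (tabulate-injective eq c)

  private
    column : Filling Λ r → Fin width → List (Fin r)
    column T c = List.tabulate (Filling.entry T c)

    length-column : ∀ T c → length (column T c) ≡ columnLength c
    length-column T c = List.length-tabulate (Filling.entry T c)

    base-cast : ∀ {k l} (eq : k ≡ l) (e : Fin l → Fin r) → base (Vec.tabulate (e ∘ Fin.cast eq)) ≡ base (Vec.tabulate e)
    base-cast refl e = cong base (Vec.tabulate-cong λ t → cong e (Fin.cast-is-id refl t))

  ordered⇒sorted : ∀ {T : Filling Λ r} → IsNCT T → AllPairs (λ a b → key a ≤ key b) (Filling.columns T)
  ordered⇒sorted {T} nct = AllPairs.tabulate⁺-< λ {c} {d} c<d → case columnLength c ℕ.≟ columnLength d of λ where
      (yes eq) → value-key {column T c} {column T d} (trans (length-column T c) (trans eq (sym (length-column T d))))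
        (subst₂ _≤_ (sym (value-tabulate (Filling.entry T c))) (trans (base-cast eq (Filling.entry T d)) (sym (value-tabulate (Filling.entry T d))))
          (base-≤ (Filling.entry T c) (Filling.entry T d ∘ Fin.cast eq) (IsNCT.ordered nct c d c<d eq)))
      (no neq) → ℕ.<⇒≤ (key-longer {column T c} {column T d} (All.tabulate⁻ (columns-length≤n T) c)
        (subst₂ _<_ (sym (length-column T d)) (sym (length-column T c)) (ℕ.≤∧≢⇒< (columnLength-antitone (ℕ.<⇒≤ c<d)) (neq ∘ sym))))

  sorted⇒ordered : ∀ (T : Filling Λ r) → AllPairs (λ a b → key a ≤ key b) (Filling.columns T) →
    ∀ c d → c Fin.< d → (eq : columnLength c ≡ columnLength d) →
    ∀ s → Filling.entry T c s ≢ Filling.entry T d (Fin.cast eq s) →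
    (∀ t → s Fin.< t → Filling.entry T c t ≡ Filling.entry T d (Fin.cast eq t)) →
    Filling.entry T c s Fin.< Filling.entry T d (Fin.cast eq s)
  sorted⇒ordered T sorted c d c<d eq = base-≤⁻ (Filling.entry T c) (Filling.entry T d ∘ Fin.cast eq)
    (subst₂ _≤_ (value-tabulate (Filling.entry T c)) (trans (value-tabulate (Filling.entry T d)) (sym (base-cast eq (Filling.entry T d))))
      (key-value {column T c} {column T d} (trans (length-column T c) (trans eq (sym (length-column T d)))) (AllPairs-tabulate⁻ sorted c<d)))

  -- Both lists are sorted by `key`, so their keys agree one by one. Corresponding lengths agree
  -- because both fillings have shape λ, and `key` is injective among columns of the same length.
  columns-↭⇒≡ : ∀ {T U : Filling Λ r} → IsNCT T → IsNCT U → Filling.columns T ↭ Filling.columns U → T ≗ᶠ U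
  columns-↭⇒≡ {T} {U} t u h = columns-injective T U (same (Filling.columns T) (Filling.columns U)
      (trans (columns-lengths T) (sym (columns-lengths U)))
      (sorted-↭⇒≡ (AllPairs.map⁺ (ordered⇒sorted t)) (AllPairs.map⁺ (ordered⇒sorted u)) (↭.map⁺ key h)))
    where
    same : ∀ as bs → map length as ≡ map length bs → map key as ≡ map key bs → as ≡ bs
    same []       []       _ _ = refl
    same (a ∷ as) (b ∷ bs) l k = cong₂ _∷_ (key-injective {a} {b} (List.∷-injectiveˡ l) (List.∷-injectiveˡ k)) (same as bs (List.∷-injectiveʳ l) (List.∷-injectiveʳ k))

  -- Sorting by `key` puts longer columns first, and a decreasing list that is a permutation of
  -- `columnLengths` is equal to it; so the sorted columns fit the diagram place by place.
  arrange : ∀ cs → All (AllPairs Fin._<_) cs → map length cs ↭ columnLengths →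
    Σ (Filling Λ r) λ T → cs ↭ Filling.columns T × AllPairs (λ a b → key a ≤ key b) (Filling.columns T)
  arrange cs incr lens with sortBy key cs
  ... | ds , cs↭ds , sorted with untabulate columnLength ds lengths
    where
    ds-lens : map length ds ↭ columnLengths
    ds-lens = ↭-trans (↭.map⁺ length (↭-sym cs↭ds)) lens
    bounded : All (λ a → length a ≤ n) ds
    bounded = All.map proj₂ (All.map⁻ (↭.All-resp-↭ (↭-sym ds-lens) (columnLengths-bounds rows≤n)))
    lengths : map length ds ≡ columnLengths
    lengths = Pointwise.Pointwise-≡⇒≡ (↗↭↗⇒≋ (Flip.totalOrder ℕ.≤-totalOrder)
      (Linked.AllPairs⇒Linked (AllPairs.map⁺ (AllPairs-∈ (λ {a} {b} _ b∈ → key-length {a} {b} (All.lookup bounded b∈)) sorted)))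
      (Linked.AllPairs⇒Linked (AllPairs.tabulate⁺-< (columnLength-antitone ∘ ℕ.<⇒≤))) (↭.↭⇒↭ₛ ds-lens))
  ... | e , refl = record { entry = e ; increasing = λ c → AllPairs-tabulate⁻ (All.tabulate⁻ (↭.All-resp-↭ cs↭ds incr) c) } , cs↭ds , sorted

-- A Non-Crossing Tableau is determined by its row contents

columnFrequency : ∀ {r} → ℕ → ℕ → List (List (Fin r)) → ℕ
columnFrequency i v cs = ListAction.sum (map (λ c → less i (length c) ℕ.* kronecker v (at i c)) cs)

at-AllPairs : ∀ {N} {l : List (Fin N)} → AllPairs Fin._<_ l → ∀ i → suc i < length l → at i l < at (suc i) l
at-AllPairs {l = _ ∷ _ ∷ _} ((lt ∷ _) ∷ _) zero    _        = lt
at-AllPairs {l = _ ∷ _}     (_ ∷ h)        (suc i) (s≤s lt) = at-AllPairs h i lt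

at-∈ : ∀ {N} (l : List (Fin N)) i → i < length l → ∃[ x ] x ∈ l × at i l ≡ toℕ x
at-∈ (x ∷ l) zero    _        = x , here refl , refl
at-∈ (x ∷ l) (suc i) (s≤s lt) = let y , y∈ , eq = at-∈ l i lt in y , there y∈ , eq

at-Pointwise : ∀ {N r} {S : Fin N → Fin r → Set} {l l′} → Pointwise S l l′ → ∀ i → i < length l →
  ∃[ x ] ∃[ y ] S x y × at i l ≡ toℕ x × at i l′ ≡ toℕ y
at-Pointwise (s ∷ ss) zero    _        = _ , _ , s , refl , refl
at-Pointwise (s ∷ ss) (suc i) (s≤s lt) = at-Pointwise ss i lt

pairUp : ∀ {A B : Set} {S : A → B → Set} {as bs} → Pointwise S as bs →
  ∃[ zs ] map proj₁ zs ≡ as × map proj₂ zs ≡ bs × All (λ z → S (proj₁ z) (proj₂ z)) zs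
pairUp []       = [] , refl , refl , []
pairUp (s ∷ ss) = let zs , e , e′ , h = pairUp ss in _ ∷ zs , cong (_ ∷_) e , cong (_ ∷_) e′ , s ∷ h

AllPairs-concat⁻ : ∀ {A : Set} {Q : A → A → Set} (xss : List (List A)) → AllPairs Q (concat xss) →
  AllPairs (λ xs ys → ∀ {x y} → x ∈ xs → y ∈ ys → Q x y) xss
AllPairs-concat⁻ []         _ = []
AllPairs-concat⁻ (xs ∷ xss) h = All.tabulate (λ ys∈ x∈ y∈ → cross xs h x∈ (∈.∈-concat⁺′ y∈ ys∈)) ∷ AllPairs-concat⁻ xss (dropˡ xs h)
  where
  dropˡ : ∀ {A : Set} {Q : A → A → Set} xs {ys} → AllPairs Q (xs ++ ys) → AllPairs Q ys
  dropˡ []       h       = h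
  dropˡ (x ∷ xs) (_ ∷ h) = dropˡ xs h
  cross : ∀ {A : Set} {Q : A → A → Set} xs {ys} → AllPairs Q (xs ++ ys) → ∀ {x y} → x ∈ xs → y ∈ ys → Q x y
  cross (x ∷ xs) (q ∷ _) (here refl) y∈ = All.lookup q (∈.∈-++⁺ʳ xs y∈)
  cross (x ∷ xs) (_ ∷ h) (there x∈)  y∈ = cross xs h x∈ y∈

module Uniqueness {n r : ℕ} {Λ : Partition} (rows≤n : Partition.rows Λ ≤ n) where

  open Partition Λ using () renaming (size to N)
  open Fillings {n} {r} {Λ} rows≤n

  blocks-separated : ∀ {blocks : List (List (Fin N))} → IsMultiplicityFreeNCT Λ blocks →
    AllPairs (λ a b → Uncrossed a b × (∀ i → i < length a → i < length b → at i a ≢ at i b)) blocks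
  blocks-separated {blocks} mf = AllPairs-∈ separate′ (AllPairs-concat⁻ blocks distinct)
    where
    open IsMultiplicityFreeNCT mf
    distinct : AllPairs _≢_ (concat blocks)
    distinct = ↭ₛ.AllPairs-resp-↭ (≡-setoid (Fin N)) (λ neq eq → neq (sym eq)) ((λ { refl h → h }) , λ { refl h → h })
      (↭.↭⇒↭ₛ (↭-sym (IsSetPartition.exhaustive isSetPartition))) (AllPairs.tabulate⁺-< λ lt eq → ℕ.<⇒≢ lt (cong toℕ eq))
    separate′ : ∀ {a b} → a ∈ blocks → b ∈ blocks → (∀ {x y} → x ∈ a → y ∈ b → x ≢ y) →
      Uncrossed a b × (∀ i → i < length a → i < length b → at i a ≢ at i b)
    separate′ {a} {b} a∈ b∈ disjoint = uncrossed , λ i p q eq →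
        let x , x∈ , e = at-∈ a i p ; y , y∈ , e′ = at-∈ b i q
        in disjoint x∈ y∈ (Fin.toℕ-injective (trans (sym e) (trans eq e′)))
      where
      -- Blocks at different places of the list are disjoint; being nonempty, they are also
      -- different, as `nonCrossing` demands.
      a≢b : a ≢ b
      a≢b refl = let x , x∈ = member a (All.lookup (IsSetPartition.nonEmpty isSetPartition) a∈) in disjoint x∈ x∈ refl
        where
        member : ∀ l → l ≢ [] → Σ (Fin N) (_∈ l)
        member []      ne = ⊥-elim (ne refl)
        member (x ∷ _) _  = x , here refl
      uncrossed : Uncrossed a b
      uncrossed with ℕ.≤-total (length b) (length a)
      ... | inj₁ le = NonCrossing⇒Uncrossed le (nonCrossing a∈ b∈ a≢b le)
      ... | inj₂ le = Uncrossed-sym (NonCrossing⇒Uncrossed le (nonCrossing b∈ a∈ (a≢b ∘ sym) le))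

  -- Each block is paired with the column of values that replaces it; `monotone` holds because
  -- smaller values own earlier segments. The bound has the form `suc n` to match `Lifted-unique`,
  -- which counts the rows after the first.
  lift : ∀ {T : Filling Λ r} → IsNCT T → ∃[ Z ] Lifted {N} {r} Z × All (λ a → 0 < height a) Z × All (λ a → height a ≤ suc n) Z ×
    map proj₂ Z ↭ Filling.columns T
  lift {T} nct with IsNCT.liftable nct
  ... | blocks , replaced , mf , _ , segs , perm with pairUp segs
  ...   | Z , refl , refl , inSegs = Z , lifted , nonEmpty , bounded , perm
    where
    μ = Filling.multiplicity T
    lengths : All (λ a → height a ≡ length (proj₂ a)) Z
    lengths = All.map (λ {a} h → Pointwise.Pointwise-length h) inSegs
    replaced-columns : ∀ {Q : List (Fin r) → Set} → All Q (Filling.columns T) → All (Q ∘ proj₂) Z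
    replaced-columns h = All.map⁻ (↭.All-resp-↭ (↭-sym perm) h)
    nonEmpty : All (λ a → 0 < height a) Z
    nonEmpty = All.map (λ { {[] , _} h → ⊥-elim (h refl) ; {_ ∷ _ , _} _ → s≤s z≤n })
      (All.map⁻ (IsSetPartition.nonEmpty (IsMultiplicityFreeNCT.isSetPartition mf)))
    bounded : All (λ a → height a ≤ suc n) Z
    bounded = All.zipWith (λ (e , le) → ℕ.≤-trans (ℕ.≤-reflexive e) (ℕ.m≤n⇒m≤1+n le)) (lengths , replaced-columns (columns-length≤n T))
    lifted : Lifted Z
    lifted = record
      { lengths   = lengths
      ; strict    = All.zipWith (λ (e , h) i lt → at-AllPairs h i (subst (suc i <_) e lt)) (lengths , replaced-columns (columns-increasing T))
      ; separated = AllPairs.map⁻ (blocks-separated mf)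
      ; monotone  = λ a∈ b∈ i j p q lt →
          let s , u , su , e₁ , e₂ = at-Pointwise (All.lookup inSegs a∈) i p
              t , v , tv , e₃ , e₄ = at-Pointwise (All.lookup inSegs b∈) j q
          in subst₂ _<_ (sym e₁) (sym e₃) (InSegment-< μ su tv (subst₂ _<_ e₂ e₄ lt))
      }

  frequency-columns : ∀ i v {Z : List (Item {N} {r})} → All (λ a → height a ≡ length (proj₂ a)) Z → frequency i v Z ≡ columnFrequency i v (map proj₂ Z)
  frequency-columns i v []                 = refl
  frequency-columns i v (_∷_ {a} e es) = cong₂ ℕ._+_ (cong (λ k → less i k ℕ.* kronecker v (value i a)) e) (frequency-columns i v es)

  -- The liftings determine the columns as a multiset; condition (ii) then fixes their order.
  NCT-unique : ∀ {T U : Filling Λ r} → IsNCT T → IsNCT U →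
    (∀ i v → columnFrequency i v (Filling.columns T) ≡ columnFrequency i v (Filling.columns U)) → T ≗ᶠ U
  NCT-unique {T} {U} t u h with lift t | lift u
  ... | Z , l , p , b , perm | Z′ , l′ , p′ , b′ , perm′ = columns-↭⇒≡ t u (↭-trans (↭-sym perm)
      (↭-trans (Lifted-unique n l l′ p p′ b b′ λ i v → trans (onColumns {T = T} l perm i v) (trans (h i v) (sym (onColumns {T = U} l′ perm′ i v)))) perm′))
    where
    onColumns : ∀ {Z : List (Item {N} {r})} {T : Filling Λ r} → Lifted Z → map proj₂ Z ↭ Filling.columns T → ∀ i v → frequency i v Z ≡ columnFrequency i v (Filling.columns T)
    onColumns l perm i v = trans (frequency-columns i v (Lifted.lengths l)) (ListAction.sum-↭ (↭.map⁺ _ perm))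

-- Independence and spanning

module Basis (R : CommutativeRing 0ℓ 0ℓ) (torsionFree : TorsionFree R) (n r : ℕ) (Λ : Partition)
             (rows≤n : Partition.rows Λ ≤ n) where

  open Partition Λ using (columnLengths; columnLength; columnLength≤rows; width) renaming (size to N)
  private module R = CommutativeRing R
  open Homogeneity R n r
  open ListMinors R n r
  open Fillings {n} {r} {Λ} rows≤n
  open Uniqueness {n} {r} {Λ} rows≤n
  open ColumnShape Λ using (sum-columnLengths)
  private
    module P = CommutativeRing polynomialCommutativeRing
    module A = Homogeneity R n N
    module S = Straightening R torsionFree n Λ rows≤n

  M : Filling Λ r → Polynomial
  M T = product (List.tabulate λ c → det λ i j →
    x (inject≤ i (ℕ.≤-trans (columnLength≤rows c) rows≤n)) (Filling.entry T c j))

  M≈bideterminant : ∀ T → M T ≈ bideterminant (Filling.columns T)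
  M≈bideterminant T m = R.trans (go (λ c → det (A c)) (λ c → List.tabulate (Filling.entry T c)) same m)
      (R.reflexive (cong (λ ps → coefficient (product ps) m) (sym (List.map-tabulate (λ c → List.tabulate (Filling.entry T c)) minor))))
    where
    rowOf : ∀ c → Fin (columnLength c) → Fin n
    rowOf c i = inject≤ i (ℕ.≤-trans (columnLength≤rows c) rows≤n)
    A : ∀ c → Fin (columnLength c) → Fin (columnLength c) → Polynomial
    A c i j = x (rowOf c i) (Filling.entry T c j)
    same : ∀ c → det (A c) ≈ minor (List.tabulate (Filling.entry T c))
    same c m = R.trans (det-cong {A = A c} {B = λ i j → X (toℕ i) (Filling.entry T c j)} (λ i j m → R.reflexive (cong (λ p → coefficient p m)
        (trans (x≡X (rowOf c i) (Filling.entry T c j)) (cong (λ k → X k (Filling.entry T c j)) (Fin.toℕ-inject≤ i (ℕ.≤-trans (columnLength≤rows c) rows≤n)))))) m)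
      (minor-tabulate (Filling.entry T c) m)
    go : ∀ {k} (f : Fin k → Polynomial) (J : Fin k → List (Fin r)) → (∀ c → f c ≈ minor (J c)) →
      product (List.tabulate f) ≈ product (List.tabulate (minor ∘ J))
    go {zero}  f J h = ≈-refl 1#
    go {suc k} f J h = P.*-cong {f zero} {minor (J zero)} {product (List.tabulate (f ∘ suc))} {product (List.tabulate (minor ∘ J ∘ suc))}
      (h zero) (go (f ∘ suc) (J ∘ suc) (h ∘ suc))

  lead : Filling Λ r → Monomial
  lead T = leadingMonomial (Filling.columns T)

  columnMonomial-0 : ∀ s J (i : Fin n) v → toℕ i < s → columnMonomial s J ⟦ i , v ⟧ ≡ 0
  columnMonomial-0 s []      i v lt = one-⟦⟧ i v
  columnMonomial-0 s (y ∷ J) i v lt = trans (·-⟦⟧ (cell s y) (columnMonomial (suc s) J) i v) (cong₂ ℕ._+_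
    (trans (cell-⟦⟧ s y i v) (cong (ℕ._* kronecker (toℕ y) (toℕ v)) (kronecker-≢ (ℕ.<⇒≢ lt ∘ sym))))
    (columnMonomial-0 (suc s) J i v (ℕ.m<n⇒m<1+n lt)))

  columnMonomial-⟦⟧ : ∀ s k J (i : Fin n) v → toℕ i ≡ s ℕ.+ k → columnMonomial s J ⟦ i , v ⟧ ≡ less k (length J) ℕ.* kronecker (toℕ v) (at k J)
  columnMonomial-⟦⟧ s k       []      i v eq = one-⟦⟧ i v
  columnMonomial-⟦⟧ s zero    (y ∷ J) i v eq = trans (·-⟦⟧ (cell s y) (columnMonomial (suc s) J) i v) (cong₂ ℕ._+_
    (trans (cell-⟦⟧ s y i v) (trans (cong (ℕ._* kronecker (toℕ y) (toℕ v)) (trans (cong (kronecker s) (trans eq (ℕ.+-identityʳ s))) (kronecker-refl s)))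
      (trans (ℕ.*-identityˡ _) (kronecker-sym (toℕ y) (toℕ v)))))
    (columnMonomial-0 (suc s) J i v (s≤s (ℕ.≤-reflexive (trans eq (ℕ.+-identityʳ s))))))
  columnMonomial-⟦⟧ s (suc k) (y ∷ J) i v eq = trans (·-⟦⟧ (cell s y) (columnMonomial (suc s) J) i v) (cong₂ ℕ._+_
    (trans (cell-⟦⟧ s y i v) (cong (ℕ._* kronecker (toℕ y) (toℕ v)) (kronecker-≢ {s} {toℕ i} (λ e → ℕ.m+1+n≢m s (sym (trans e eq))))))
    (columnMonomial-⟦⟧ (suc s) k J i v (trans eq (ℕ.+-suc s k))))

  leadingMonomial-⟦⟧ : ∀ Js (i : Fin n) v → leadingMonomial Js ⟦ i , v ⟧ ≡ columnFrequency (toℕ i) (toℕ v) Js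
  leadingMonomial-⟦⟧ []       i v = one-⟦⟧ i v
  leadingMonomial-⟦⟧ (J ∷ Js) i v = trans (·-⟦⟧ (columnMonomial 0 J) (leadingMonomial Js) i v)
    (cong₂ ℕ._+_ (columnMonomial-⟦⟧ 0 (toℕ i) J i v refl) (leadingMonomial-⟦⟧ Js i v))

  -- The exponent of x_{i,v} in `lead T` is the number of columns with v in row i. `NCT-unique` asks
  -- for these numbers at all natural i and v; outside the matrix they are 0 on both sides.
  lead-injective : ∀ {T U} → IsNCT T → IsNCT U → lead T ≡ lead U → T ≗ᶠ U
  lead-injective {T} {U} t u eq = NCT-unique t u same
    where
    high : ∀ i v → n ≤ i → ∀ {Js : List (List (Fin r))} → All (λ J → length J ≤ n) Js → columnFrequency i v Js ≡ 0
    high i v le []                 = refl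
    high i v le (_∷_ {J} h hs) = cong₂ ℕ._+_ (cong (ℕ._* kronecker v (at i J)) (less-≥ (ℕ.≤-trans h le))) (high i v le hs)
    foreign : ∀ i v → r ≤ v → ∀ Js → columnFrequency i v Js ≡ 0
    foreign i v le []       = refl
    foreign i v le (J ∷ Js) = cong₂ ℕ._+_ (entry J) (foreign i v le Js)
      where
      entry : ∀ J → less i (length J) ℕ.* kronecker v (at {r} i J) ≡ 0
      entry J with i ℕ.<? length J
      ... | no i≮ = cong (ℕ._* kronecker v (at i J)) (less-≥ (ℕ.≮⇒≥ i≮))
      ... | yes i< = let y , _ , e = at-∈ J i i< in trans (cong (less i (length J) ℕ.*_)
              (kronecker-≢ (λ e′ → ℕ.<⇒≱ (Fin.toℕ<n y) (subst (r ≤_) (trans e′ e) le)))) (ℕ.*-zeroʳ (less i (length J)))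
    same : ∀ i v → columnFrequency i v (Filling.columns T) ≡ columnFrequency i v (Filling.columns U)
    same i v with i ℕ.<? n | v ℕ.<? r
    ... | no i≮n  | _       = trans (high i v (ℕ.≮⇒≥ i≮n) (columns-length≤n T)) (sym (high i v (ℕ.≮⇒≥ i≮n) (columns-length≤n U)))
    ... | yes _   | no v≮r  = trans (foreign i v (ℕ.≮⇒≥ v≮r) (Filling.columns T)) (sym (foreign i v (ℕ.≮⇒≥ v≮r) (Filling.columns U)))
    ... | yes i<n | yes v<r = subst₂ (λ i v → columnFrequency i v (Filling.columns T) ≡ columnFrequency i v (Filling.columns U))
          (Fin.toℕ-fromℕ< i<n) (Fin.toℕ-fromℕ< v<r)
          (trans (sym (leadingMonomial-⟦⟧ (Filling.columns T) (fromℕ< i<n) (fromℕ< v<r)))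
            (trans (cong (_⟦ fromℕ< i<n , fromℕ< v<r ⟧) eq) (leadingMonomial-⟦⟧ (Filling.columns U) (fromℕ< i<n) (fromℕ< v<r))))

  open Leading toℕ id

  M-lead : ∀ T → HasLead (M T) (lead T)
  M-lead T = HasLead-≈ {bideterminant (Filling.columns T)} {M T} (λ m → R.sym (M≈bideterminant T m))
    (bideterminant-lead toℕ id (All.zip (columns-increasing T , columns-length≤n T)))

  f : NCT Λ r → Polynomial
  f T = M (proj₁ T)

  open Spans f

  -- Descending induction on the weight of the leading monomials. To the coefficient of `lead T` the
  -- other terms contribute nothing: those with a lead of the same or smaller weight because their
  -- lead is a different monomial, those with a heavier lead because their coefficient is already
  -- known to be 0.
  independent : ∀ (terms : List (R.Carrier × NCT Λ r)) → AllPairs (λ s t → ¬ proj₁ (proj₂ s) ≗ᶠ proj₁ (proj₂ t)) terms →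
    combination f terms ≈ 0# → All (λ t → proj₁ t R.≈ R.0#) terms
  independent terms distinct zero-sum = All.tabulate λ t∈ → descend bound t∈ (ℕ.m≤n+m _ _)
    where
    leadWeight : R.Carrier × NCT Λ r → ℕ
    leadWeight (_ , T , _) = weight (lead T)
    bound : ℕ
    bound = suc (ListAction.sum (map leadWeight terms))
    below : ∀ {t} ts → t ∈ ts → leadWeight t ≤ ListAction.sum (map leadWeight ts)
    below (t ∷ ts) (here refl) = ℕ.m≤m+n _ _
    below (s ∷ ts) (there t∈)  = ℕ.≤-trans (below ts t∈) (ℕ.m≤n+m _ (leadWeight s))
    absent : ∀ m us → All (λ (c , T) → c R.* coefficient (f T) m R.≈ R.0#) us → coefficient (combination f us) m R.≈ R.0#
    absent m []             []       = R.refl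
    absent m ((c , T) ∷ us) (h ∷ hs) = R.trans (coefficient-+ (c • f T) (combination f us) m)
      (R.trans (R.+-cong (R.trans (coefficient-• c (f T) m) h) (absent m us hs)) (R.+-identityˡ _))
    -- `k` bounds the distance of the weight from `bound`, which exceeds every weight that occurs;
    -- distance 0 is therefore impossible.
    descend : ∀ k {t} → t ∈ terms → bound ≤ leadWeight t ℕ.+ k → proj₁ t R.≈ R.0#
    descend zero    {t} t∈ le = ⊥-elim (ℕ.<⇒≱ (s≤s (below terms t∈)) (ℕ.≤-trans le (ℕ.≤-reflexive (ℕ.+-identityʳ _))))
    descend (suc k) {c , T} t∈ le with ∈.∈-∃++ t∈
    ... | us , vs , split = R.trans (R.sym (R.trans (R.*-congˡ (coefficient-lead (M-lead (proj₁ T)))) (R.*-identityʳ c))) (begin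
        c R.* coefficient (f T) m
          ≈⟨ R.+-identityʳ _ ⟨
        c R.* coefficient (f T) m R.+ R.0#
          ≈⟨ R.+-cong (R.sym (coefficient-• c (f T) m)) (R.sym (absent m vs (All.tabulate λ {u} u∈ →
               other (weaken (∈.∈-++⁺ʳ us (there u∈))) (λ eq → All.lookup (proj₂ (proj₂ pairs)) u∈
                 (lead-injective {proj₁ T} {proj₁ (proj₂ u)} (proj₂ T) (proj₂ (proj₂ u)) (sym eq)))))) ⟩
        coefficient (c • f T) m R.+ coefficient (combination f vs) m
          ≈⟨ coefficient-+ (c • f T) (combination f vs) m ⟨
        coefficient (combination f ((c , T) ∷ vs)) m
          ≈⟨ R.+-identityˡ _ ⟨
        R.0# R.+ coefficient (combination f ((c , T) ∷ vs)) m
          ≈⟨ R.+-congʳ (R.sym (absent m us (All.tabulate λ {u} u∈ →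
               other (weaken (∈.∈-++⁺ˡ u∈)) (λ eq → All.lookup (proj₁ (proj₂ pairs)) u∈ (lead-injective {proj₁ (proj₂ u)} {proj₁ T} (proj₂ (proj₂ u)) (proj₂ T) eq))))) ⟩
        coefficient (combination f us) m R.+ coefficient (combination f ((c , T) ∷ vs)) m
          ≈⟨ combination-++ us ((c , T) ∷ vs) m ⟨
        coefficient (combination f (us ++ (c , T) ∷ vs)) m
          ≈⟨ R.reflexive (cong (λ ts → coefficient (combination f ts) m) (sym split)) ⟩
        coefficient (combination f terms) m
          ≈⟨ zero-sum m ⟩
        R.0# ∎)
      where
      open import Relation.Binary.Reasoning.Setoid R.setoid
      m = lead (proj₁ T)
      pairs = AllPairs-remove us (subst (AllPairs _) split distinct)
      weaken : ∀ {u} → u ∈ us ++ (c , T) ∷ vs → u ∈ terms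
      weaken = subst (_ ∈_) (sym split)
      other : ∀ {u} → u ∈ terms → lead (proj₁ (proj₂ u)) ≢ m → proj₁ u R.* coefficient (f (proj₂ u)) m R.≈ R.0#
      other {d , U} u∈ neq with ℕ.<-cmp (weight (lead (proj₁ U))) (weight m)
      ... | tri< lt _ _ = R.trans (R.*-congˡ (coefficient-above (M-lead (proj₁ U)) m (ℕ.<⇒≤ lt) (neq ∘ sym))) (R.zeroʳ d)
      ... | tri≈ _ eq _ = R.trans (R.*-congˡ (coefficient-above (M-lead (proj₁ U)) m (ℕ.≤-reflexive eq) (neq ∘ sym))) (R.zeroʳ d)
      ... | tri> _ _ gt = R.trans (R.*-congʳ (descend k u∈ (ℕ.≤-trans le (ℕ.≤-trans (ℕ.≤-reflexive (ℕ.+-suc _ k)) (ℕ.+-monoˡ-≤ k gt))))) (R.zeroˡ _)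

  module Standardize (μ : Fin r → ℕ) (total : N ≡ length (segments μ)) where

    -- Labels are handed out in the order of the values: those in the segment B_u receive the value
    -- u.
    v : Fin N → Fin r
    v t = lookup (segments μ) (Fin.cast total t)

    v-segment : ∀ t → InSegment μ t (v t)
    v-segment t = subst (λ k → start μ (v t) ≤ k × k < start μ (v t) ℕ.+ μ (v t)) (Fin.toℕ-cast total t) (segments-position μ (Fin.cast total t))

    v-monotone : ∀ {s t} → s Fin.< t → v s Fin.≤ v t
    v-monotone {s} {t} lt = ℕ.≮⇒≥ λ gt → ℕ.<-asym lt (InSegment-< μ (v-segment t) (v-segment s) gt)

    v-values : map v (allFin N) ≡ segments μ
    v-values = map-lookup-cast (segments μ) total

    open Specialization R n N r v

    -- The given blocks themselves serve as the lifting of the new filling; strict increase along a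
    -- block means that it meets each segment at most once.
    replace-NCT : ∀ {blocks} → IsMultiplicityFreeNCT Λ blocks → All (Linked Fin._<_) (map (map v) blocks) →
      Σ (NCT Λ r) λ T → map (map v) blocks ↭ Filling.columns (proj₁ T)
    replace-NCT {blocks} mf increasing with arrange (map (map v) blocks) (All.map (Linked.Linked⇒AllPairs ℕ.<-trans) increasing) lens
      where
      lens : map length (map (map v) blocks) ↭ columnLengths
      lens = ↭-trans (↭-reflexive (trans (sym (List.map-∘ blocks)) (List.map-cong (List.length-map v) blocks))) (IsMultiplicityFreeNCT.sizes mf)
    ... | T , perm , sorted = (T , record { liftable = blocks , map (map v) blocks , mf , distinct , segs , perm ; ordered = sorted⇒ordered T sorted }) , perm
      where
      concat-map : ∀ bs → concat (map (map v) bs) ≡ map v (concat bs)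
      concat-map bs = List.concat-map {f = v} bs
      -- Condition (i) refers to the segments of the multiplicities of the new filling. They agree
      -- with `μ` because the blocks contain every label exactly once.
      multiplicity≡ : ∀ u → Filling.multiplicity T u ≡ μ u
      multiplicity≡ u = trans (multiplicity-occurrences T u) (trans (occurrences-↭ u (↭-sym (concat-↭ perm)))
        (trans (cong (occurrences u) (concat-map blocks)) (trans (occurrences-↭ u (↭.map⁺ v (IsSetPartition.exhaustive (IsMultiplicityFreeNCT.isSetPartition mf))))
          (trans (cong (occurrences u) v-values) (occurrences-segments μ u)))))
        where
        concat-↭ : ∀ {as bs : List (List (Fin r))} → as ↭ bs → concat as ↭ concat bs
        concat-↭ ↭.refl         = ↭-refl
        concat-↭ (↭.prep a h)   = ↭.++⁺ˡ a (concat-↭ h)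
        concat-↭ (↭.swap a b h) = ↭-trans (↭.shifts a b) (↭.++⁺ˡ b (↭.++⁺ˡ a (concat-↭ h)))
        concat-↭ (↭.trans h h′) = ↭-trans (concat-↭ h) (concat-↭ h′)
      segment : ∀ t u → InSegment (Filling.multiplicity T) t u → InSegment μ t u
      segment t u = subst₂ (λ s k → s ≤ toℕ t × toℕ t < s ℕ.+ k) (cong (λ l → ListAction.sum (take (toℕ u) l)) (List.tabulate-cong multiplicity≡)) (multiplicity≡ u)
      segment′ : ∀ t u → InSegment μ t u → InSegment (Filling.multiplicity T) t u
      segment′ t u = subst₂ (λ s k → s ≤ toℕ t × toℕ t < s ℕ.+ k) (cong (λ l → ListAction.sum (take (toℕ u) l)) (List.tabulate-cong (sym ∘ multiplicity≡))) (sym (multiplicity≡ u))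
      segs : Pointwise (Pointwise (InSegment (Filling.multiplicity T))) blocks (map (map v) blocks)
      segs = each blocks
        where
        block : ∀ b → Pointwise (InSegment (Filling.multiplicity T)) b (map v b)
        block []      = []
        block (t ∷ b) = segment′ t (v t) (v-segment t) ∷ block b
        each : ∀ bs → Pointwise (Pointwise (InSegment (Filling.multiplicity T))) bs (map (map v) bs)
        each []       = []
        each (b ∷ bs) = block b ∷ each bs
      distinct : ∀ {a} → a ∈ blocks → ∀ u {s t} → s ∈ a → t ∈ a → InSegment (Filling.multiplicity T) s u → InSegment (Filling.multiplicity T) t u → s ≡ t
      distinct {a} a∈ u {s} {t} s∈ t∈ su tu with s Fin.≟ t
      ... | yes eq = eq
      ... | no neq = ⊥-elim (case AllPairs-members (AllPairs.map⁻ (Linked.Linked⇒AllPairs ℕ.<-trans (All.lookup (All.map⁻ increasing) a∈))) s∈ t∈ neq of λ where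
              (inj₁ lt) → ℕ.<⇒≢ lt (cong toℕ vs≡vt)
              (inj₂ lt) → ℕ.<⇒≢ lt (cong toℕ (sym vs≡vt)))
        where
        vs≡vt : v s ≡ v t
        vs≡vt = trans (InSegment-unique μ (v-segment s) (segment s u su)) (sym (InSegment-unique μ (v-segment t) (segment t u tu)))

    -- Labels increase along a block, so the values increase weakly, and a repetition shows up in
    -- adjacent columns of the minor.
    specialize-NCT : ∀ (B : S.MultiplicityFreeNCT) → Span f (specialize (A.bideterminant (proj₁ B)))
    specialize-NCT (blocks , mf) = Span-≈ {specialize (A.bideterminant blocks)} {bideterminant (map (map v) blocks)} (specialize-bideterminant blocks)
      (decide (classify blocks (IsSetPartition.increasing (IsMultiplicityFreeNCT.isSetPartition mf))))
      where
      weakly : ∀ {b : List (Fin N)} → Linked Fin._<_ b → Linked Fin._≤_ (map v b)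
      weakly []       = []
      weakly [-]      = [-]
      weakly (lt ∷ h) = v-monotone lt ∷ weakly h
      Vanishing : List (Fin r) → Set
      Vanishing J = minor J ≈ 0#
      extend : ∀ {b bs} → Linked Fin._<_ (map v b) ⊎ AdjacentEqual (map v b) →
        All (Linked Fin._<_) (map (map v) bs) ⊎ Any Vanishing (map (map v) bs) →
        All (Linked Fin._<_) (map (map v) (b ∷ bs)) ⊎ Any Vanishing (map (map v) (b ∷ bs))
      extend (inj₂ adj) _         = inj₂ (here (minor-adjacentEqual adj))
      extend (inj₁ _)   (inj₂ an) = inj₂ (there an)
      extend (inj₁ l)   (inj₁ ls) = inj₁ (l ∷ ls)
      classify : ∀ bs → All (Linked Fin._<_) bs → All (Linked Fin._<_) (map (map v) bs) ⊎ Any Vanishing (map (map v) bs)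
      classify []       []       = inj₁ []
      classify (b ∷ bs) (h ∷ hs) = extend {b} {bs} (linked-≤ (map v b) (weakly h)) (classify bs hs)
      fromNCT : (Σ (NCT Λ r) λ T → map (map v) blocks ↭ Filling.columns (proj₁ T)) → Span f (bideterminant (map (map v) blocks))
      fromNCT (T , perm) = Span-≈ {bideterminant (map (map v) blocks)} {f T}
        (λ m → R.trans (product-↭ (↭.map⁺ minor perm) m) (R.sym (M≈bideterminant (proj₁ T) m))) (Span-generator T)
      decide : All (Linked Fin._<_) (map (map v) blocks) ⊎ Any Vanishing (map (map v) blocks) → Span f (bideterminant (map (map v) blocks))
      decide (inj₂ an)         = Span-≈ {bideterminant (map (map v) blocks)} {0#} (bideterminant-zero an) Span-0
      decide (inj₁ increasing) = fromNCT (replace-NCT mf increasing)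

  -- The entries of `T`, read column by column, are a rearrangement of `segments μ`, the image of
  -- `allFin N` under `v`. The rearrangement lifts to the labels, and cutting it at the ends of the
  -- columns gives blocks `bs` whose values are the columns of `T`. These blocks may cross:
  -- straightening asks only that they exhaust the labels and have the right sizes.
  M-spanned : ∀ T → Span f (M T)
  M-spanned T = Span-≈ {M T} {bideterminant (Filling.columns T)} (M≈bideterminant T)
      (from (↭.↭-map-inv v (↭-trans (↭-reflexive v-values) segments↭)))
    where
    μ = Filling.multiplicity T
    segments↭ : segments μ ↭ concat (Filling.columns T)
    segments↭ = occurrences⇒↭ (segments μ) (concat (Filling.columns T)) λ u → trans (occurrences-segments μ u) (multiplicity-occurrences T u)
    open Standardize μ (sym (trans (↭.↭-length segments↭) (length-concat-columns T)))
    open Specialization R n N r v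
    from : (∃[ L ] concat (Filling.columns T) ≡ map v L × allFin N ↭ L) → Span f (bideterminant (Filling.columns T))
    from (L , eq , perm) = split (unconcat v L (Filling.columns T) (sym eq))
      where
      split : (∃[ bs ] concat bs ≡ L × map (map v) bs ≡ Filling.columns T) → Span f (bideterminant (Filling.columns T))
      split (bs , concat≡ , columns≡) = subst (λ cs → Span f (bideterminant cs)) columns≡
        (Span-≈ {bideterminant (map (map v) bs)} {combination (specialize ∘ A.bideterminant ∘ proj₁) (proj₁ expansion)} expand
          (Span-combination (specialize ∘ A.bideterminant ∘ proj₁) specialize-NCT (proj₁ expansion)))
        where
        lengths : map length bs ≡ columnLengths
        lengths = trans (List.map-cong (λ b → sym (List.length-map v b)) bs)
          (trans (List.map-∘ bs) (trans (cong (map length) columns≡) (columns-lengths T)))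
        expansion : A.Span (A.bideterminant ∘ proj₁) (A.bideterminant bs)
        expansion = S.bideterminant-straighten bs (subst (_↭ allFin N) (sym concat≡) (↭-sym perm)) (↭-reflexive lengths)
        expand : bideterminant (map (map v) bs) ≈ combination (specialize ∘ A.bideterminant ∘ proj₁) (proj₁ expansion)
        expand m = R.trans (R.sym (specialize-bideterminant bs m))
          (R.trans (specialize-≈ (A.bideterminant bs) (A.combination (A.bideterminant ∘ proj₁) (proj₁ expansion)) (proj₂ expansion) m)
            (specialize-combination (A.bideterminant ∘ proj₁) (proj₁ expansion) m))

  basis : IsBasis {NCT Λ r} (λ S T → proj₁ S ≗ᶠ proj₁ T) f (Span M)
  basis = record
    { member      = λ T → Spans.Span-generator M (proj₁ T)
    ; spanning    = λ p (ts , eq) → Span-≈ {p} {combination M ts} eq (Span-combination M M-spanned ts)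
    ; independent = independent
    }

theorem32 : (n r : ℕ) (Λ : Partition) (rows≤n : Partition.rows Λ ≤ n) →
    let open Bideterminants n r Λ rows≤n in
    IsBasis {NCT Λ r} (λ S T → proj₁ S ≗ᶠ proj₁ T) (λ T → M (proj₁ T)) D
theorem32 = Basis.basis Complex.ℂ-commutativeRing Complex.ℂ-torsionFree
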